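{- Let $k$ be a positive integer and let $G$ be a $k$-edge-connected graph. (1) If $k\ge 4$, then $G$ has a spanning closed trail meeting each vertex $v$ at most $f(v)$ times, where $f(v)=\lceil\frac{d_G(v)+k/2-4}{k}\rceil+1$. (2) If $k\le 3$, then $G$ has a spanning closed walk meeting each vertex $v$ at most $f(v)$ times, where $f(v)=\lceil\frac{d_G(v)-1}{k}\rceil+1$.
   Context: Graphs are finite, loopless, and may have multiple edges. A spanning closed trail (resp. walk) is a closed trail (resp. closed walk) passing through every vertex; it meets $v$ at most $f(v)$ times if it passes through $v$ at most $f(v)$ times. $d_G(v)$ is the degree of $v$. -}

module Defs where

open import Data.Nat using (ℕ; zero; suc; _+_; _*_; _<_; NonZero)
open import Data.Nat.Properties using (m*n≢0)
open import Data.Fin using (Fin; _≟_)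
open import Data.Product using (_×_; _,_; proj₁; proj₂; Σ)
open import Data.Sum using (_⊎_)
open import Data.List using (List; []; _∷_; length; filter; allFin)
open import Data.List.Membership.Propositional using (_∈_; _∉_)
open import Data.List.Relation.Unary.All using (All)
open import Data.List.Relation.Unary.Unique.Propositional using (Unique)
open import Data.Integer as ℤ using (ℤ; +_)
open import Data.Rational using (ℚ; _/_; ceiling)
open import Relation.Binary.PropositionalEquality using (_≡_; _≢_)
open import Relation.Nullary using (¬_)
open import Relation.Nullary.Decidable using (_⊎-dec_)

-- A finite loopless multigraph: vertices Fin n, edges Fin m,
-- each edge has two distinct endpoints; parallel edges allowed.
record Graph : Set where
  field
    n     : ℕ
    m     : ℕ
    ends  : Fin m → Fin n × Fin n
    loopless : ∀ e → proj₁ (ends e) ≢ proj₂ (ends e)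
open Graph public

Joins : (G : Graph) → Fin (m G) → Fin (n G) → Fin (n G) → Set
Joins G e u x = (ends G e ≡ (u , x)) ⊎ (ends G e ≡ (x , u))

data Walk (G : Graph) : Fin (n G) → Fin (n G) → Set where
  nil  : ∀ {u} → Walk G u u
  cons : ∀ {u x w} (e : Fin (m G)) → Joins G e u x → Walk G x w → Walk G u w

edges : ∀ {G u w} → Walk G u w → List (Fin (m G))
edges nil = []
edges (cons e _ W) = e ∷ edges W

verts : ∀ {G u w} → Walk G u w → List (Fin (n G))
verts nil = []
verts {u = u} (cons e _ W) = u ∷ verts W

-- the cyclic vertex sequence of a closed walk at s (trivial walk passes s once)
passes : ∀ {G s} → Walk G s s → List (Fin (n G))
passes {s = s} nil = s ∷ []
passes W@(cons _ _ _) = verts W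

times : ∀ {G s} → Walk G s s → Fin (n G) → ℕ
times W v = length (filter (_≟ v) (passes W))

Spanning : ∀ {G s} → Walk G s s → Set
Spanning {G} W = ∀ (v : Fin (n G)) → v ∈ passes W

IsTrail : ∀ {G u w} → Walk G u w → Set
IsTrail W = Unique (edges W)

degree : (G : Graph) → Fin (n G) → ℕ
degree G v = length (filter (λ e → (proj₁ (ends G e) ≟ v) ⊎-dec (proj₂ (ends G e) ≟ v)) (allFin (m G)))

ConnectedAvoiding : (G : Graph) → List (Fin (m G)) → Set
ConnectedAvoiding G F = ∀ (u w : Fin (n G)) → Σ (Walk G u w) (λ W → All (_∉ F) (edges W))

-- k-edge-connected (Diestel's convention): at least 2 vertices, and
-- deleting fewer than k edges leaves the graph connected.
EdgeConnected : ℕ → Graph → Set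
EdgeConnected k G = (1 < n G) × (∀ (F : List (Fin (m G))) → length F < k → ConnectedAvoiding G F)

-- f(v) = ⌈(d + k/2 - 4)/k⌉ + 1 = ⌈(2d + k - 8)/(2k)⌉ + 1
f₁ : (k : ℕ) → .{{NonZero k}} → ℕ → ℤ
f₁ k d = ⌈ (+ (2 * d + k) ℤ.- + 8) / (2 * k) ⌉ ℤ.+ + 1
  where instance _ = m*n≢0 2 k

f₂ : (k : ℕ) → .{{NonZero k}} → ℕ → ℤ
f₂ k d = ⌈ (+ d ℤ.- + 1) / k ⌉ ℤ.+ + 1

{-# OPTIONS --safe #-}
module Submission where

open import Defs
open import Data.Bool using (Bool; true; false; _∧_; _∨_; not; _xor_; if_then_else_)
open import Data.Bool.Properties using (∧-comm; ∧-assoc; ∧-idem; ∧-identityʳ; ∧-zeroʳ; ∨-identityʳ; not-involutive; not-distribˡ-xor; xor-identityʳ; xor-same) renaming (_≟_ to _≟ᵇ_)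
open import Data.Empty using (⊥; ⊥-elim)
open import Data.Fin using (Fin; zero; suc; fromℕ<; splitAt; _↑ˡ_; _↑ʳ_; _≟_)
open import Data.Fin.Permutation using (permutation)
open import Data.Fin.Properties using (splitAt-↑ˡ; splitAt-↑ʳ; any?; all?) renaming (_<?_ to _<ᶠ?_; <-cmp to <ᶠ-cmp)
open import Data.Fin.Subset using (Subset)
open import Data.Fin.Subset.Properties using (anySubset?)
import Data.Integer as ℤ
open import Data.Integer.DivMod using ([n/d]*d≤n)
open import Data.Integer.GCD using (gcd)
import Data.Integer.Properties as ℤ
import Data.Integer.Tactic.RingSolver as ℤ-Solver
open import Data.List using (List; []; _∷_; length; filter; allFin; tabulate)
open import Data.List.Membership.Propositional using (_∈_; _∉_)
open import Data.List.Membership.Propositional.Properties using (∈-filter⁺; ∈-allFin)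
open import Data.List.Relation.Unary.All using (All; []; _∷_)
open import Data.List.Relation.Unary.AllPairs using ([]; _∷_)
open import Data.List.Relation.Unary.Any using (here; there)
open import Data.Nat using (ℕ; zero; suc; pred; _+_; _*_; _∸_; _≤_; _<_; _≤?_; z≤n; s≤s; s≤s⁻¹; NonZero; >-nonZero; >-nonZero⁻¹) renaming (_≟_ to _≟ℕ_)
open import Data.Nat.Induction using (<-wellFounded)
open import Data.Nat.Properties hiding (_≟_; _≤?_)
open import Data.Nat.Tactic.RingSolver using (solve-∀)
open import Data.Product using (_×_; _,_; proj₁; proj₂; Σ; ∃)
open import Data.Rational using (ℚ; mkℚ; ↥_; ↧_; _/_; ceiling; floor)
import Data.Rational as ℚ
open import Data.Rational.Properties using (↥-/; ↧-/; ↥-neg; ↧-neg)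
open import Data.Sum using (_⊎_; inj₁; inj₂; swap; [_,_]′)
open import Data.Unit using (⊤; tt)
open import Data.Vec using (lookup) renaming (tabulate to tabulateᵛ)
open import Data.Vec.Functional using () renaming (_∷_ to _◂_)
open import Data.Vec.Properties using (lookup∘tabulate)
open import Function using (_∘_; id; const; case_of_)
open import Induction.WellFounded using (Acc; acc)
open import Relation.Binary.Definitions using (tri<; tri≈; tri>)
open import Relation.Binary.PropositionalEquality
open import Relation.Nullary using (¬_; Dec; yes; no; does)
open import Relation.Nullary.Decidable using (toWitness; map′; ¬?; _×-dec_; _⊎-dec_; _→-dec_; dec-true; dec-false; decidable-stable)
open import Algebra.Properties.CommutativeMonoid.Sum +-0-commutativeMonoid
  using (sum; sum-cong-≗; ∑-distrib-+; ∑-comm; sum-permute; sum-replicate-zero)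
open import Algebra.Properties.Semiring.Sum +-*-semiring
  using (*-distribˡ-sum; *-distribʳ-sum)

{-
Call an edge set H sparse if every nonempty vertex set Y spans at most 2|Y| − 2 edges of H, and Y tight
if it spans exactly that many. Suppose that every cut has at least k ≥ 4 edges of A, and that
h v ≥ (2/k)(deg v − 4) + 4. Let H ⊆ A be a largest sparse set with deg_H ≤ h. If |H| < 2n − 2, then an
exchange argument produces a set S of vertices with deg_H = h such that all edges of A between different
maximal tight sets of V ∖ S lie in H, and counting edges contradicts the bound on the cuts. So V is tight,
and a Henneberg reduction (removing a vertex of degree 2 or 3) splits H into connected spanning T₁ and T₂.
Adding to T₁ a part of T₂ with the same odd vertices yields a connected even subgraph of H, and its Euler
tour meets v at most deg_H v / 2 times.

Part (1) is the case A = E(G), h = 2f + 1. For (2) the walk is an Euler tour in the doubled graph 2G.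
If k = 1, then 2G itself is Eulerian; if k = 2, then every cut of 2G has at least 4 edges. If k = 3,
it suffices to double an edge set D with deg_D ≡ deg (mod 2), because D meets every cut of size 3. The bound
on the degrees of G + D allows deg_D ≤ g := 4f − 2 − deg, where deg ≤ 3g. Such a D comes from a perfect
matching on g(v) copies of each vertex v, which exists by Tutte's theorem.
-}

Mask : ℕ → Set
Mask n = Fin n → Bool

-- ¬¬ is used as a monad throughout; only the existence of a suitable edge set is decided at the end.

return : ∀ {A : Set} → A → ¬ ¬ A
return a k = k a

_>>=_ : ∀ {A B : Set} → ¬ ¬ A → (A → ¬ ¬ B) → ¬ ¬ B
(m >>= f) k = m (λ a → f a k)

em : ∀ {A : Set} → ¬ ¬ (A ⊎ ¬ A)
em k = k (inj₂ (λ a → k (inj₁ a)))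

¬¬-Fin : ∀ {n} {P : Fin n → Set} → (∀ i → ¬ ¬ P i) → ¬ ¬ (∀ i → P i)
¬¬-Fin {zero}  h = return λ ()
¬¬-Fin {suc n} h = do
  p  ← h zero
  ps ← ¬¬-Fin (λ i → h (suc i))
  return λ { zero → p ; (suc i) → ps i }

minimal : ∀ {A : Set} (P : A → Set) (μ : A → ℕ) → ∀ a → P a →
          ¬ ¬ (Σ A λ x → P x × (∀ y → P y → μ x ≤ μ y))
minimal {A} P μ a pa = go a pa (<-wellFounded (μ a))
  where
  go : ∀ a → P a → Acc _<_ (μ a) → ¬ ¬ (Σ A λ x → P x × (∀ y → P y → μ x ≤ μ y))
  go a pa (acc rs) = em {A = Σ A λ y → P y × μ y < μ a} >>= λ
    { (inj₁ (y , py , lt)) → go y py (rs lt)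
    ; (inj₂ none) → return (a , pa , λ y py → ≮⇒≥ (λ lt → none (y , py , lt))) }

maximal : ∀ {A : Set} (P : A → Set) (μ : A → ℕ) (N : ℕ) → (∀ x → P x → μ x ≤ N) → ∀ a → P a →
          ¬ ¬ (Σ A λ x → P x × (∀ y → P y → μ y ≤ μ x))
maximal P μ N bound a pa = do
  (x , px , least) ← minimal P (λ x → N ∸ μ x) a pa
  return (x , px , λ y py → ∸-cancelʳ-≤′ (bound y py) (least y py))
  where
  ∸-cancelʳ-≤′ : ∀ {x y} → y ≤ N → N ∸ x ≤ N ∸ y → y ≤ x
  ∸-cancelʳ-≤′ {x} {y} y≤N le = ≮⇒≥ (λ x<y → <⇒≱ (∸-monoʳ-< x<y y≤N) le)

comprehension : ∀ {n} (P : Fin n → Set) →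
                ¬ ¬ (Σ (Fin n → Bool) λ f → ∀ v → (f v ≡ true → P v) × (f v ≡ false → ¬ P v))
comprehension P = do
  d ← ¬¬-Fin (λ v → em {A = P v})
  return ((λ v → to (d v)) , λ v → spec (d v))
  where
  to : ∀ {A : Set} → A ⊎ ¬ A → Bool
  to (inj₁ _) = true
  to (inj₂ _) = false
  spec : ∀ {A : Set} (d : A ⊎ ¬ A) → (to d ≡ true → A) × (to d ≡ false → ¬ A)
  spec (inj₁ a)  = (λ _ → a) , λ ()
  spec (inj₂ ¬a) = (λ ()) , λ _ → ¬a

-- Boolean identities by exhaustion, parity, and equality of indices.

∀Bool? : ∀ {P : Bool → Set} → (∀ b → Dec (P b)) → Dec (∀ b → P b)
∀Bool? P? = map′ (λ { (t , f) → λ { true → t ; false → f } }) (λ h → h true , h false) (P? true ×-dec P? false)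

true≢false : ∀ {b} → b ≡ true → b ≡ false → ⊥
true≢false refl ()

¬true⇒false : ∀ {b} → ¬ b ≡ true → b ≡ false
¬true⇒false {true}  h = ⊥-elim (h refl)
¬true⇒false {false} h = refl

∧-split : ∀ {a b} → a ∧ b ≡ true → a ≡ true × b ≡ true
∧-split {true} {true} _ = refl , refl

∧-intro : ∀ {a b} → a ≡ true → b ≡ true → a ∧ b ≡ true
∧-intro refl refl = refl

∨-split : ∀ {a b} → a ∨ b ≡ true → a ≡ true ⊎ b ≡ true
∨-split {true}  _ = inj₁ refl
∨-split {false} h = inj₂ h

∨-introˡ : ∀ {a b} → a ≡ true → a ∨ b ≡ true
∨-introˡ refl = refl

∨-introʳ : ∀ {a b} → b ≡ true → a ∨ b ≡ true
∨-introʳ {true}  refl = refl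
∨-introʳ {false} refl = refl

not-true : ∀ {a} → not a ≡ true → a ≡ false
not-true {false} _ = refl

not-intro : ∀ {a} → a ≡ false → not a ≡ true
not-intro refl = refl

not-false : ∀ {a} → not a ≡ false → a ≡ true
not-false {true} _ = refl

bool-ext : ∀ {a b} → (a ≡ true → b ≡ true) → (b ≡ true → a ≡ true) → a ≡ b
bool-ext {true}          f g = sym (f refl)
bool-ext {false} {true}  f g = g refl
bool-ext {false} {false} f g = refl

𝟙 : Bool → ℕ
𝟙 true  = 1
𝟙 false = 0

𝟙-∧ : ∀ a b → 𝟙 (a ∧ b) ≡ 𝟙 a * 𝟙 b
𝟙-∧ = toWitness {a? = ∀Bool? λ a → ∀Bool? λ b → _ ≟ℕ _} _

𝟙-mono : ∀ {a b} → (a ≡ true → b ≡ true) → 𝟙 a ≤ 𝟙 b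
𝟙-mono {true}  f = ≤-reflexive (cong 𝟙 (sym (f refl)))
𝟙-mono {false} f = z≤n

odd : ℕ → Bool
odd zero    = false
odd (suc n) = not (odd n)

xor-swap : ∀ a b c d → (a xor b) xor (c xor d) ≡ (a xor c) xor (b xor d)
xor-swap = toWitness {a? = ∀Bool? λ a → ∀Bool? λ b → ∀Bool? λ c → ∀Bool? λ d →
  ((a xor b) xor (c xor d)) ≟ᵇ ((a xor c) xor (b xor d))} _

odd-+ : ∀ m n → odd (m + n) ≡ odd m xor odd n
odd-+ zero    n = refl
odd-+ (suc m) n = trans (cong not (odd-+ m n)) (not-distribˡ-xor (odd m) (odd n))

odd-𝟙 : ∀ a → odd (𝟙 a) ≡ a
odd-𝟙 true  = refl
odd-𝟙 false = refl

odd-double : ∀ m → odd (m + m) ≡ false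
odd-double m = trans (odd-+ m m) (xor-same (odd m))

infix 5 _==_
_==_ : ∀ {n} → Fin n → Fin n → Bool
x == y = does (x ≟ y)

==-refl : ∀ {n} (x : Fin n) → (x == x) ≡ true
==-refl x with x ≟ x
... | yes _ = refl
... | no ne = ⊥-elim (ne refl)

==⇒≡ : ∀ {n} {x y : Fin n} → (x == y) ≡ true → x ≡ y
==⇒≡ {x = x} {y} h with x ≟ y
... | yes p = p

≢⇒== : ∀ {n} {x y : Fin n} → x ≢ y → (x == y) ≡ false
≢⇒== {x = x} {y} h with x ≟ y
... | yes p = ⊥-elim (h p)
... | no _  = refl

==⇒≢ : ∀ {n} {x y : Fin n} → (x == y) ≡ false → x ≢ y
==⇒≢ {x = x} h refl = true≢false (==-refl x) h

==-sym : ∀ {n} (x y : Fin n) → (x == y) ≡ (y == x)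
==-sym x y with x ≟ y
... | yes refl = sym (==-refl x)
... | no ne    = sym (≢⇒== (ne ∘ sym))

suc-== : ∀ {n} (u v : Fin n) → (Fin.suc u == suc v) ≡ (u == v)
suc-== u v with u ≟ v
... | yes _ = refl
... | no _  = refl

-- Sums and cardinalities

sum-mono : ∀ {n} {f g : Fin n → ℕ} → (∀ i → f i ≤ g i) → sum f ≤ sum g
sum-mono {zero}  h = z≤n
sum-mono {suc n} h = +-mono-≤ (h zero) (sum-mono (λ i → h (suc i)))

sum-≥ : ∀ {n} (f : Fin n → ℕ) i → f i ≤ sum f
sum-≥ f zero    = m≤m+n _ _
sum-≥ f (suc i) = ≤-trans (sum-≥ (f ∘ suc) i) (m≤n+m _ _)

sum-zero : ∀ {n} {f : Fin n → ℕ} → (∀ i → f i ≡ 0) → sum f ≡ 0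
sum-zero {n} h = trans (sum-cong-≗ h) (sum-replicate-zero n)

sum-pos : ∀ {n} (f : Fin n → ℕ) → 0 < sum f → Σ (Fin n) λ i → 0 < f i
sum-pos {suc n} f h with f zero in eq
... | suc k = zero , subst (0 <_) (sym eq) (s≤s z≤n)
... | zero  = case sum-pos (f ∘ suc) h of λ { (i , p) → suc i , p }

sum-select : ∀ {n} (g : Fin n → ℕ) (u : Fin n) → sum (λ v → g v * 𝟙 (u == v)) ≡ g u
sum-select {suc n} g zero =
  trans (cong₂ _+_ (*-identityʳ (g zero)) (sum-zero (λ i → *-zeroʳ (g (suc i))))) (+-identityʳ (g zero))
sum-select {suc n} g (suc u) =
  trans (cong₂ _+_ (*-zeroʳ (g zero)) (sum-cong-≗ (λ v → cong (λ b → g (suc v) * 𝟙 b) (suc-== u v)))) (sum-select (g ∘ suc) u)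

sum-odd : ∀ {n} {f g h : Fin n → ℕ} → (∀ i → odd (f i) ≡ odd (g i) xor odd (h i)) →
          odd (sum f) ≡ odd (sum g) xor odd (sum h)
sum-odd {zero}  e = refl
sum-odd {suc n} {f} {g} {h} e = begin
  odd (f zero + sum (f ∘ suc)) ≡⟨ odd-+ (f zero) _ ⟩
  odd (f zero) xor odd (sum (f ∘ suc)) ≡⟨ cong₂ _xor_ (e zero) (sum-odd (λ i → e (suc i))) ⟩
  (odd (g zero) xor odd (h zero)) xor (odd (sum (g ∘ suc)) xor odd (sum (h ∘ suc)))
                                                            ≡⟨ xor-swap (odd (g zero)) _ _ _ ⟩
  (odd (g zero) xor odd (sum (g ∘ suc))) xor (odd (h zero) xor odd (sum (h ∘ suc)))
                                                            ≡⟨ cong₂ _xor_ (odd-+ (g zero) _) (odd-+ (h zero) _) ⟨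
  odd (sum g) xor odd (sum h) ∎
  where open ≡-Reasoning

sum-odd-cong : ∀ {n} {f g : Fin n → ℕ} → (∀ i → odd (f i) ≡ odd (g i)) → odd (sum f) ≡ odd (sum g)
sum-odd-cong {zero}  e = refl
sum-odd-cong {suc n} {f} {g} e =
  trans (odd-+ (f zero) _) (trans (cong₂ _xor_ (e zero) (sum-odd-cong (λ i → e (suc i)))) (sym (odd-+ (g zero) _)))

sum-split : ∀ m {n} (f : Fin (m + n) → ℕ) →
            sum f ≡ sum (λ i → f (i Data.Fin.↑ˡ n)) + sum (λ j → f (m Data.Fin.↑ʳ j))
sum-split zero    f = refl
sum-split (suc m) f = trans (cong (f zero +_) (sum-split m (f ∘ suc))) (sym (+-assoc (f zero) _ _))

at-most-one : ∀ {n} (f : Mask n) → (∀ i j → f i ≡ true → f j ≡ true → i ≡ j) → sum (λ i → 𝟙 (f i)) ≤ 1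
at-most-one {zero}  f h = z≤n
at-most-one {suc n} f h with f zero in eq
... | false = at-most-one (f ∘ suc) (λ i j p q → suc-inj (h _ _ p q))
  where
  suc-inj : ∀ {i j : Fin n} → Fin.suc i ≡ suc j → i ≡ j
  suc-inj refl = refl
... | true = ≤-reflexive (cong suc (sum-zero (λ i → cong 𝟙 (¬true⇒false (λ p → case h zero (suc i) eq p of λ ())))))

size : ∀ {n} → Mask n → ℕ
size Y = sum (λ v → 𝟙 (Y v))

size-pos : ∀ {n} (Y : Mask n) {v} → Y v ≡ true → 1 ≤ size Y
size-pos Y {v} h = ≤-trans (≤-reflexive (cong 𝟙 (sym h))) (sum-≥ (λ v → 𝟙 (Y v)) v)

size-inhabited : ∀ {n} (Y : Mask n) → 1 ≤ size Y → ∃ λ v → Y v ≡ true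
size-inhabited Y h with sum-pos (λ v → 𝟙 (Y v)) h
... | v , p = v , 𝟙-true p
  where
  𝟙-true : ∀ {b} → 0 < 𝟙 b → b ≡ true
  𝟙-true {true} _ = refl

size-⊆ : ∀ {n} {Y Z : Mask n} → (∀ v → Y v ≡ true → Z v ≡ true) → size Y ≤ size Z
size-⊆ h = sum-mono λ v → 𝟙-mono (h v)

size-partition : ∀ {n} (Y Z : Mask n) →
                 size Y ≡ size (λ v → Y v ∧ not (Z v)) + size (λ v → Y v ∧ Z v)
size-partition Y Z = trans (sum-cong-≗ (λ v → pt (Y v) (Z v))) (∑-distrib-+ (λ v → 𝟙 (Y v ∧ not (Z v))) _)
  where
  pt : ∀ y z → 𝟙 y ≡ 𝟙 (y ∧ not z) + 𝟙 (y ∧ z)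
  pt = toWitness {a? = ∀Bool? λ y → ∀Bool? λ z → _ ≟ℕ _} _

full : ∀ {n} → Fin n → Bool
full _ = true

∅ : ∀ {n} → Fin n → Bool
∅ _ = false

infixl 6 _∪_ _∖_ _⊕_
infixl 7 _∩_
_∪_ _∩_ : ∀ {n} → Mask n → Mask n → Fin n → Bool
(Y ∪ Z) v = Y v ∨ Z v
(Y ∩ Z) v = Y v ∧ Z v

_∖_ _⊕_ : ∀ {n} → Mask n → Fin n → Fin n → Bool
(Y ∖ u) v = Y v ∧ not (u == v)
(Y ⊕ u) v = Y v ∨ (u == v)

size-full : ∀ n → size (full {n}) ≡ n
size-full zero    = refl
size-full (suc n) = cong suc (size-full n)

sum-⊕ : ∀ {n} (Y : Mask n) u (w : Fin n → ℕ) → Y u ≡ false →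
        sum (λ v → 𝟙 ((Y ⊕ u) v) * w v) ≡ sum (λ v → 𝟙 (Y v) * w v) + w u
sum-⊕ Y u w h = begin
  sum (λ v → 𝟙 ((Y ⊕ u) v) * w v) ≡⟨ sum-cong-≗ pt ⟩
  sum (λ v → 𝟙 (Y v) * w v + w v * 𝟙 (u == v)) ≡⟨ ∑-distrib-+ (λ v → 𝟙 (Y v) * w v) _ ⟩
  sum (λ v → 𝟙 (Y v) * w v) + sum (λ v → w v * 𝟙 (u == v)) ≡⟨ cong (sum (λ v → 𝟙 (Y v) * w v) +_) (sum-select w u) ⟩
  sum (λ v → 𝟙 (Y v) * w v) + w u ∎
  where
  open ≡-Reasoning
  pt : ∀ v → 𝟙 ((Y ⊕ u) v) * w v ≡ 𝟙 (Y v) * w v + w v * 𝟙 (u == v)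
  pt v with u ≟ v
  ... | yes refl rewrite h = solve-∀′ (w u)
    where solve-∀′ : ∀ x → 1 * x ≡ 0 * x + x * 1
          solve-∀′ = solve-∀
  ... | no _ with Y v
  ...   | true  = solve-∀′ (w v)
    where solve-∀′ : ∀ x → 1 * x ≡ 1 * x + x * 0
          solve-∀′ = solve-∀
  ...   | false = sym (*-zeroʳ (w v))

sum-∖ : ∀ {n} (Y : Mask n) u (w : Fin n → ℕ) → Y u ≡ true →
        sum (λ v → 𝟙 (Y v) * w v) ≡ sum (λ v → 𝟙 ((Y ∖ u) v) * w v) + w u
sum-∖ Y u w h = trans (sum-cong-≗ (λ v → cong (λ b → 𝟙 b * w v) (pt v))) (sum-⊕ (Y ∖ u) u w off)
  where
  off : (Y ∖ u) u ≡ false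
  off rewrite ==-refl u | h = refl
  pt : ∀ v → Y v ≡ ((Y ∖ u) ⊕ u) v
  pt v with u ≟ v
  ... | yes refl rewrite h = refl
  ... | no _ with Y v
  ...   | true = refl
  ...   | false = refl

size-⊕ : ∀ {n} (Y : Mask n) u → Y u ≡ false → size (Y ⊕ u) ≡ suc (size Y)
size-⊕ Y u h = begin
  size (Y ⊕ u) ≡⟨ sum-cong-≗ (λ v → *-identityʳ (𝟙 ((Y ⊕ u) v))) ⟨
  sum (λ v → 𝟙 ((Y ⊕ u) v) * 1) ≡⟨ sum-⊕ Y u (λ _ → 1) h ⟩
  sum (λ v → 𝟙 (Y v) * 1) + 1 ≡⟨ +-comm _ 1 ⟩
  suc (sum (λ v → 𝟙 (Y v) * 1)) ≡⟨ cong suc (sum-cong-≗ (λ v → *-identityʳ (𝟙 (Y v)))) ⟩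
  suc (size Y) ∎
  where open ≡-Reasoning

size-∖ : ∀ {n} (Y : Mask n) u → Y u ≡ true → size Y ≡ suc (size (Y ∖ u))
size-∖ Y u h = begin
  size Y ≡⟨ sum-cong-≗ (λ v → *-identityʳ (𝟙 (Y v))) ⟨
  sum (λ v → 𝟙 (Y v) * 1) ≡⟨ sum-∖ Y u (λ _ → 1) h ⟩
  sum (λ v → 𝟙 ((Y ∖ u) v) * 1) + 1 ≡⟨ +-comm _ 1 ⟩
  suc (sum (λ v → 𝟙 ((Y ∖ u) v) * 1)) ≡⟨ cong suc (sum-cong-≗ (λ v → *-identityʳ (𝟙 ((Y ∖ u) v)))) ⟩
  suc (size (Y ∖ u)) ∎
  where open ≡-Reasoning

-- For inequalities that follow linearly: A ≤ B is a combination of the hypotheses and s the remaining slack,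
-- so that the second premise is a semiring identity.
linear : ∀ {A B L R} s → A ≤ B → B + L + s ≡ A + R → L ≤ R
linear {A} {B} {L} {R} s le eq = +-cancelˡ-≤ A L R (begin
  A + L ≤⟨ +-monoˡ-≤ L le ⟩
  B + L ≤⟨ m≤m+n (B + L) s ⟩
  B + L + s ≡⟨ eq ⟩
  A + R ∎)
  where open ≤-Reasoning

∖-∈ : ∀ {n} (Y : Mask n) u {v} → Y v ≡ true → u ≢ v → (Y ∖ u) v ≡ true
∖-∈ Y u h ne = ∧-intro h (not-intro (≢⇒== ne))

∖-⊆ : ∀ {n} (Y : Mask n) u v → (Y ∖ u) v ≡ true → Y v ≡ true
∖-⊆ Y u v h = proj₁ (∧-split {Y v} h)

∖-≢ : ∀ {n} (Y : Mask n) u v → (Y ∖ u) v ≡ true → u ≢ v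
∖-≢ Y u v h = ==⇒≢ {x = u} (not-true (proj₂ (∧-split {Y v} h)))

⊕-∈ : ∀ {n} (Y : Mask n) u → (Y ⊕ u) u ≡ true
⊕-∈ Y u = ∨-introʳ {Y u} (==-refl u)

⊕-⊇ : ∀ {n} (Y : Mask n) u v → Y v ≡ true → (Y ⊕ u) v ≡ true
⊕-⊇ Y u v h = ∨-introˡ {Y v} h

⊕-split : ∀ {n} (Y : Mask n) u v → (Y ⊕ u) v ≡ true → Y v ≡ true ⊎ u ≡ v
⊕-split Y u v h with ∨-split {Y v} h
... | inj₁ p = inj₁ p
... | inj₂ p = inj₂ (==⇒≡ {x = u} p)

Nonempty : ∀ {n} → Mask n → Set
Nonempty Y = ∃ λ v → Y v ≡ true

size-modular : ∀ {n} (Y Z : Mask n) → size Y + size Z ≡ size (Y ∪ Z) + size (Y ∩ Z)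
size-modular Y Z = begin
  size Y + size Z ≡⟨ ∑-distrib-+ (𝟙 ∘ Y) (𝟙 ∘ Z) ⟨
  sum (λ v → 𝟙 (Y v) + 𝟙 (Z v)) ≡⟨ sum-cong-≗ (λ v → pt (Y v) (Z v)) ⟩
  sum (λ v → 𝟙 ((Y ∪ Z) v) + 𝟙 ((Y ∩ Z) v)) ≡⟨ ∑-distrib-+ (𝟙 ∘ (Y ∪ Z)) (𝟙 ∘ (Y ∩ Z)) ⟩
  size (Y ∪ Z) + size (Y ∩ Z) ∎
  where
  open ≡-Reasoning
  pt : ∀ y z → 𝟙 y + 𝟙 z ≡ 𝟙 (y ∨ z) + 𝟙 (y ∧ z)
  pt = toWitness {a? = ∀Bool? λ y → ∀Bool? λ z → (𝟙 y + 𝟙 z) ≟ℕ (𝟙 (y ∨ z) + 𝟙 (y ∧ z))} _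

-- Sparse and tight edge sets

module Multigraph {n m : ℕ} (a b : Fin m → Fin n) where

  Link : Fin m → Fin n → Fin n → Set
  Link e u v = (a e ≡ u × b e ≡ v) ⊎ (a e ≡ v × b e ≡ u)

  inc : Fin m → Fin n → ℕ
  inc e v = 𝟙 (a e == v) + 𝟙 (b e == v)

  deg : Mask m → Fin n → ℕ
  deg H v = sum λ e → 𝟙 (H e) * inc e v

  within crosses : Mask n → Fin m → Bool
  within  Y e = Y (a e) ∧ Y (b e)
  crosses Y e = Y (a e) xor Y (b e)

  inside cut : Mask m → Mask n → ℕ
  inside H Y = size (H ∩ within Y)
  cut    H Y = size (H ∩ crosses Y)

  -- By Nash-Williams these are the edge sets that split into two forests, that is, the independent
  -- sets of the union of two copies of the graphic matroid.
  Sparse : Mask m → Set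
  Sparse H = ∀ Y → Nonempty Y → inside H Y + 2 ≤ 2 * size Y

  Tight : Mask m → Mask n → Set
  Tight H Y = Nonempty Y × 2 * size Y ≤ inside H Y + 2

  -- Connectedness in cut form: it passes through the reductions by inspecting a single crossing
  -- edge, and it can be decided by running over all subsets.
  Connects : Mask m → Mask n → Set
  Connects T X = ∀ (Y : Mask n) {x y} → X x ≡ true → Y x ≡ true → X y ≡ true → Y y ≡ false →
                 ∃ λ e → T e ≡ true × within X e ≡ true × crosses Y e ≡ true

  MinCut : ℕ → Mask m → Set
  MinCut k A = ∀ Y {x y} → Y x ≡ true → Y y ≡ false → k ≤ cut A Y

  -- Edge by edge; the inequality is strict only for an edge of `H` between the part of `Y` outside
  -- `Z` and the part of `Z` outside `Y`.
  inside-supermodular : ∀ H Y Z → inside H Y + inside H Z ≤ inside H (Y ∪ Z) + inside H (Y ∩ Z)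
  inside-supermodular H Y Z = begin
    inside H Y + inside H Z
      ≡⟨ ∑-distrib-+ (𝟙 ∘ (H ∩ within Y)) (𝟙 ∘ (H ∩ within Z)) ⟨
    sum (λ e → 𝟙 ((H ∩ within Y) e) + 𝟙 ((H ∩ within Z) e))
      ≤⟨ sum-mono (λ e → pt (H e) (Y (a e)) (Y (b e)) (Z (a e)) (Z (b e))) ⟩
    sum (λ e → 𝟙 ((H ∩ within (Y ∪ Z)) e) + 𝟙 ((H ∩ within (Y ∩ Z)) e))
      ≡⟨ ∑-distrib-+ (𝟙 ∘ (H ∩ within (Y ∪ Z))) (𝟙 ∘ (H ∩ within (Y ∩ Z))) ⟩
    inside H (Y ∪ Z) + inside H (Y ∩ Z) ∎
    where
    open ≤-Reasoning
    pt : ∀ h y y′ z z′ → 𝟙 (h ∧ (y ∧ y′)) + 𝟙 (h ∧ (z ∧ z′)) ≤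
                         𝟙 (h ∧ ((y ∨ z) ∧ (y′ ∨ z′))) + 𝟙 (h ∧ ((y ∧ z) ∧ (y′ ∧ z′)))
    pt = toWitness {a? = ∀Bool? λ h → ∀Bool? λ y → ∀Bool? λ y′ → ∀Bool? λ z → ∀Bool? λ z′ → _ ≤? _} _

  -- Uncrossing: `inside` is supermodular and `size` is modular, while the common vertex `v` makes
  -- sparseness applicable to the intersection as well as to the union. Both sparseness bounds must
  -- then be attained.
  tight-∪∩ : ∀ {H Y Z v} → Sparse H → Tight H Y → Tight H Z → Y v ≡ true → Z v ≡ true →
             Tight H (Y ∪ Z) × Tight H (Y ∩ Z)
  tight-∪∩ {H} {Y} {Z} {v} sp (_ , tY) (_ , tZ) yv zv =
    ((v , ∪v) , linear 0 (arith₁ (sp _ (v , ∩v)))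
        (id₁ (size Y) (size Z) (size (Y ∪ Z)) (size (Y ∩ Z)) (inside H Y) (inside H Z) _ _)) ,
    ((v , ∩v) , linear 0 (arith₁ (sp _ (v , ∪v)))
        (id₂ (size Y) (size Z) (size (Y ∪ Z)) (size (Y ∩ Z)) (inside H Y) (inside H Z) _ _))
    where
    ∪v = ∨-introˡ {b = Z v} yv
    ∩v = ∧-intro yv zv
    arith₁ : ∀ {x y} → x ≤ y →
             2 * size Y + 2 * size Z + (inside H Y + inside H Z) + 2 * (size (Y ∪ Z) + size (Y ∩ Z)) + x ≤
             (inside H Y + 2) + (inside H Z + 2) + (inside H (Y ∪ Z) + inside H (Y ∩ Z)) + 2 * (size Y + size Z) + y
    arith₁ = +-mono-≤ (+-mono-≤ (+-mono-≤ (+-mono-≤ tY tZ) (inside-supermodular H Y Z))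
                                (≤-reflexive (cong (2 *_) (sym (size-modular Y Z)))))
    id₁ : ∀ sY sZ s∪ s∩ iY iZ i∪ i∩ →
          (iY + 2) + (iZ + 2) + (i∪ + i∩) + 2 * (sY + sZ) + 2 * s∩ + 2 * s∪ + 0 ≡
          2 * sY + 2 * sZ + (iY + iZ) + 2 * (s∪ + s∩) + (i∩ + 2) + (i∪ + 2)
    id₁ = solve-∀
    id₂ : ∀ sY sZ s∪ s∩ iY iZ i∪ i∩ →
          (iY + 2) + (iZ + 2) + (i∪ + i∩) + 2 * (sY + sZ) + 2 * s∪ + 2 * s∩ + 0 ≡
          2 * sY + 2 * sZ + (iY + iZ) + 2 * (s∪ + s∩) + (i∪ + 2) + (i∩ + 2)
    id₂ = solve-∀

  tight-∪ : ∀ {H Y Z v} → Sparse H → Tight H Y → Tight H Z → Y v ≡ true → Z v ≡ true → Tight H (Y ∪ Z)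
  tight-∪ {H} {Y} {Z} sp tY tZ yv zv = proj₁ (tight-∪∩ {H} {Y} {Z} sp tY tZ yv zv)

  handshake : ∀ H Y → sum (λ v → 𝟙 (Y v) * deg H v) ≡ sum (λ e → 𝟙 (H e) * (𝟙 (Y (a e)) + 𝟙 (Y (b e))))
  handshake H Y = begin
    sum (λ v → 𝟙 (Y v) * deg H v)
      ≡⟨ sum-cong-≗ (λ v → *-distribˡ-sum (𝟙 (Y v)) (λ e → 𝟙 (H e) * inc e v)) ⟩
    sum (λ v → sum λ e → 𝟙 (Y v) * (𝟙 (H e) * inc e v))
      ≡⟨ ∑-comm (λ v e → 𝟙 (Y v) * (𝟙 (H e) * inc e v)) ⟩
    sum (λ e → sum λ v → 𝟙 (Y v) * (𝟙 (H e) * inc e v))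
      ≡⟨ sum-cong-≗ (λ e → sum-cong-≗ (λ v → rearrange (𝟙 (Y v)) (𝟙 (H e)) (𝟙 (a e == v)) (𝟙 (b e == v)))) ⟩
    sum (λ e → sum λ v → 𝟙 (H e) * (𝟙 (Y v) * 𝟙 (a e == v) + 𝟙 (Y v) * 𝟙 (b e == v)))
      ≡⟨ sum-cong-≗ (λ e → *-distribˡ-sum (𝟙 (H e)) (λ v → 𝟙 (Y v) * 𝟙 (a e == v) + 𝟙 (Y v) * 𝟙 (b e == v))) ⟨
    sum (λ e → 𝟙 (H e) * sum λ v → 𝟙 (Y v) * 𝟙 (a e == v) + 𝟙 (Y v) * 𝟙 (b e == v))
      ≡⟨ sum-cong-≗ (λ e → cong (𝟙 (H e) *_) (trans (∑-distrib-+ (λ v → 𝟙 (Y v) * 𝟙 (a e == v)) _)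
           (cong₂ _+_ (sum-select (𝟙 ∘ Y) (a e)) (sum-select (𝟙 ∘ Y) (b e))))) ⟩
    sum (λ e → 𝟙 (H e) * (𝟙 (Y (a e)) + 𝟙 (Y (b e)))) ∎
    where
    open ≡-Reasoning
    rearrange : ∀ y h p q → y * (h * (p + q)) ≡ h * (y * p + y * q)
    rearrange = solve-∀

  -- An edge with both ends in `Y` contributes two to the degree sum, so modulo 2 only the crossing
  -- edges remain.
  odd-cut : ∀ H Y → odd (cut H Y) ≡ odd (sum λ v → 𝟙 (Y v) * deg H v)
  odd-cut H Y = trans (sum-odd-cong (λ e → pt (H e) (Y (a e)) (Y (b e)))) (cong odd (sym (handshake H Y)))
    where
    pt : ∀ h p q → odd (𝟙 (h ∧ (p xor q))) ≡ odd (𝟙 h * (𝟙 p + 𝟙 q))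
    pt = toWitness {a? = ∀Bool? λ h → ∀Bool? λ p → ∀Bool? λ q → _ ≟ᵇ _} _

  deg-∖ : ∀ H e v → H e ≡ true → deg H v ≡ deg (H ∖ e) v + inc e v
  deg-∖ H e v = sum-∖ H e (λ e → inc e v)

  inside-cong : ∀ {H H′ Y} → (∀ e → within Y e ≡ true → H e ≡ H′ e) → inside H Y ≡ inside H′ Y
  inside-cong {H} {H′} {Y} h = sum-cong-≗ λ e → cong 𝟙 (∧-congʳ (h e))
    where
    ∧-congʳ : ∀ {x y z} → (z ≡ true → x ≡ y) → x ∧ z ≡ y ∧ z
    ∧-congʳ {z = true}  f = cong (_∧ true) (f refl)
    ∧-congʳ {x} {y} {z = false} f = trans (∧-comm x false) (∧-comm false y)

  within-⊆ : ∀ {Y Z} → (∀ v → Y v ≡ true → Z v ≡ true) → ∀ e → within Y e ≡ true → within Z e ≡ true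
  within-⊆ h e w = let p , q = ∧-split w in ∧-intro (h _ p) (h _ q)

  link-within : ∀ {Y e u v} → Link e u v → Y u ≡ true → Y v ≡ true → within Y e ≡ true
  link-within (inj₁ (refl , refl)) yu yv = ∧-intro yu yv
  link-within (inj₂ (refl , refl)) yu yv = ∧-intro yv yu

  within-link : ∀ {Y e u v} → Link e u v → within Y e ≡ true → Y u ≡ true × Y v ≡ true
  within-link (inj₁ (refl , refl)) w = ∧-split w
  within-link {Y} {e} (inj₂ (refl , refl)) w = let p , q = ∧-split {Y (a e)} w in q , p

  link-crosses : ∀ {Y e u v} → Link e u v → Y u ≡ true → Y v ≡ false → crosses Y e ≡ true
  link-crosses (inj₁ (refl , refl)) yu yv = cong₂ _xor_ yu yv
  link-crosses (inj₂ (refl , refl)) yu yv = cong₂ _xor_ yv yu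

  link-crosses′ : ∀ {Y e u v} → Link e u v → Y u ≡ false → Y v ≡ true → crosses Y e ≡ true
  link-crosses′ l yu yv = link-crosses (swap l) yv yu

  crosses-link : ∀ {Y} e → crosses Y e ≡ true → ∃ λ u → ∃ λ v → Link e u v × Y u ≡ true × Y v ≡ false
  crosses-link {Y} e h with Y (a e) in p | Y (b e) in q
  ... | true  | false = a e , b e , inj₁ (refl , refl) , p , q
  ... | false | true  = b e , a e , inj₂ (refl , refl) , q , p

  module Loopless (loopless : ∀ e → a e ≢ b e) where

    link-≢ : ∀ {e u v} → Link e u v → u ≢ v
    link-≢ (inj₁ (refl , refl)) = loopless _
    link-≢ (inj₂ (refl , refl)) = loopless _ ∘ sym

    link-inc : ∀ {e u v} → Link e u v → ∀ w → inc e w ≡ 𝟙 (u == w) + 𝟙 (v == w)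
    link-inc (inj₁ (refl , refl)) w = refl
    link-inc {e} (inj₂ (refl , refl)) w = +-comm (𝟙 (a e == w)) _

    link-inc-end : ∀ {e u v} → Link e u v → inc e u ≡ 1
    link-inc-end {u = u} {v} l = trans (link-inc l u)
      (cong₂ (λ p q → 𝟙 p + 𝟙 q) (==-refl u) (≢⇒== (link-≢ l ∘ sym)))

    incident : ∀ {e v} → 0 < inc e v → ∃ λ u → Link e v u
    incident {e} {v} h with a e ≟ v | b e ≟ v
    ... | yes p | _     = b e , inj₁ (p , refl)
    ... | no _  | yes q = a e , inj₂ (refl , q)

    pick : ∀ H v → 0 < deg H v → ∃ λ e → ∃ λ u → H e ≡ true × Link e v u × deg H v ≡ suc (deg (H ∖ e) v)
    pick H v h with sum-pos (λ e → 𝟙 (H e) * inc e v) h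
    ... | e , p with H e in he
    ...   | true with incident {e} {v} (subst (0 <_) (*-identityˡ _) p)
    ...     | u , l = e , u , he , l ,
            trans (deg-∖ H e v he) (trans (cong (deg (H ∖ e) v +_) (link-inc-end l)) (+-comm _ 1))

    inside-∖ : ∀ H X v → X v ≡ true → inside H X ≡ inside H (X ∖ v) + deg (H ∩ within X) v
    inside-∖ H X v xv = trans (sum-cong-≗ pt) (∑-distrib-+ (𝟙 ∘ (H ∩ within (X ∖ v))) _)
      where
      cases : ∀ h x y p q → p ∧ q ≡ false →
              𝟙 (h ∧ (x ∧ y)) ≡ 𝟙 (h ∧ ((x ∧ not p) ∧ (y ∧ not q))) + 𝟙 (h ∧ (x ∧ y)) * (𝟙 p + 𝟙 q)
      cases = toWitness {a? = ∀Bool? λ h → ∀Bool? λ x → ∀Bool? λ y → ∀Bool? λ p → ∀Bool? λ q →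
                (p ∧ q ≟ᵇ false) →-dec (_ ≟ℕ _)} _
      pt : ∀ e → 𝟙 ((H ∩ within X) e) ≡ 𝟙 ((H ∩ within (X ∖ v)) e) + 𝟙 ((H ∩ within X) e) * inc e v
      pt e rewrite ==-sym (a e) v | ==-sym (b e) v = cases (H e) (X (a e)) (X (b e)) (v == a e) (v == b e)
        (¬true⇒false λ pq → let p , q = ∧-split {v == a e} pq in loopless e (trans (sym (==⇒≡ {x = v} p)) (==⇒≡ {x = v} q)))

    -- Because of `x`, deleting `v` leaves a nonempty set, whose sparseness bound is smaller by 2.
    -- The tight count can only drop that far if `v` takes two edges with it.
    tight-deg : ∀ H Q {v x} → Sparse H → Tight H Q → Q v ≡ true → Q x ≡ true → v ≢ x → 2 ≤ deg (H ∩ within Q) v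
    tight-deg H Q {v} {x} sp (_ , t) qv qx v≢x =
      linear 0 (+-mono-≤ (sp (Q ∖ v) (x , ∖-∈ Q v qx v≢x)) (subst₂ (λ s i → 2 * s ≤ i + 2) (size-∖ Q v qv) (inside-∖ H Q v qv) t))
        (count (size (Q ∖ v)) (inside H (Q ∖ v)) (deg (H ∩ within Q) v))
      where
      count : ∀ s i d → 2 * s + (i + d + 2) + 2 + 0 ≡ i + 2 + 2 * suc s + d
      count = solve-∀

-- Two disjoint connected spanning subgraphs

module _ {n m : ℕ} (a b : Fin m → Fin n) where
  open Multigraph a b

  record Packing (H : Mask m) (X : Mask n) : Set where
    field
      T₁ T₂     : Mask m
      T₁⊆       : ∀ e → T₁ e ≡ true → H e ≡ true × within X e ≡ true
      T₂⊆       : ∀ e → T₂ e ≡ true → H e ≡ true × within X e ≡ true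
      disjoint  : ∀ e → T₁ e ≡ true → T₂ e ≡ false
      connects₁ : Connects T₁ X
      connects₂ : Connects T₂ X
open Packing

module _ {n m : ℕ} (a b : Fin m → Fin n) where
  open Multigraph a b

  -- A cut between `v` and another vertex either separates `v` from `u`, and then `e` crosses it, or
  -- separates `u` from that other vertex, which the connectivity of the rest handles.
  attach : ∀ (T : Mask m) (X : Mask n) {v e u} →
           (∀ (Y : Mask n) {x y} → (X ∖ v) x ≡ true → Y x ≡ true → (X ∖ v) y ≡ true → Y y ≡ false →
              ∃ λ e → T e ≡ true × within X e ≡ true × crosses Y e ≡ true) →
           X v ≡ true → T e ≡ true → Link e v u → (X ∖ v) u ≡ true → Connects T X
  attach T X {v} {e} {u} conn xv te l xu Y {x} {y} xx yx xy yy with v ≟ x | v ≟ y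
  ... | no p | no q = conn Y (∖-∈ X v xx p) yx (∖-∈ X v xy q) yy
  ... | yes refl | yes refl = ⊥-elim (true≢false yx yy)
  ... | yes refl | no q with Y u in yu
  ...   | true  = conn Y xu yu (∖-∈ X v xy q) yy
  ...   | false = e , te , link-within {X} l xv (∖-⊆ X v u xu) , link-crosses {Y} l yx yu
  attach T X {v} {e} {u} conn xv te l xu Y {x} {y} xx yx xy yy | no p | yes refl with Y u in yu
  ...   | false = conn Y (∖-∈ X v xx p) yx xu yu
  ...   | true  = e , te , link-within {X} l xv (∖-⊆ X v u xu) , link-crosses′ {Y} l yy yu

  Connects-mono : ∀ (T T′ : Mask m) (X X′ : Mask n) → (∀ e → T e ≡ true → T′ e ≡ true) → (∀ v → X v ≡ true → X′ v ≡ true) →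
                  Connects T X → (Y : Mask n) → ∀ {x y} → X x ≡ true → Y x ≡ true → X y ≡ true → Y y ≡ false →
                  ∃ λ e → T′ e ≡ true × within X′ e ≡ true × crosses Y e ≡ true
  Connects-mono T T′ X X′ T⊆ X⊆ conn Y xx yx xy yy with conn Y xx yx xy yy
  ... | e , te , we , ce = e , T⊆ e te , within-⊆ {X} {X′} X⊆ e we , ce

  -- v has exactly two edges into X, and each of them hangs v onto one of the two packed subgraphs.
  packing-degree-2 : ∀ {H X v e₁ e₂ u₁ u₂} → X v ≡ true →
    (H ∩ within X) e₁ ≡ true → Link e₁ v u₁ → (X ∖ v) u₁ ≡ true →
    (H ∩ within X) e₂ ≡ true → Link e₂ v u₂ → (X ∖ v) u₂ ≡ true → e₁ ≢ e₂ →
    Packing a b H (X ∖ v) → Packing a b H X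
  packing-degree-2 {H} {X} {v} {e₁} {e₂} xv h₁ l₁ x₁ h₂ l₂ x₂ ne P = record
    { T₁ = T₁ P ⊕ e₁
    ; T₂ = T₂ P ⊕ e₂
    ; T₁⊆ = λ e t → [ (λ t → lift (T₁⊆ P e t)) , (λ { refl → ∧-split {H e₁} h₁ }) ]′ (⊕-split (T₁ P) e₁ e t)
    ; T₂⊆ = λ e t → [ (λ t → lift (T₂⊆ P e t)) , (λ { refl → ∧-split {H e₂} h₂ }) ]′ (⊕-split (T₂ P) e₂ e t)
    ; disjoint = λ e t → ¬true⇒false λ t′ → dis e (⊕-split (T₁ P) e₁ e t) (⊕-split (T₂ P) e₂ e t′)
    ; connects₁ = attach (T₁ P ⊕ e₁) X
        (Connects-mono (T₁ P) (T₁ P ⊕ e₁) (X ∖ v) X (⊕-⊇ (T₁ P) e₁) (∖-⊆ X v) (connects₁ P)) xv (⊕-∈ (T₁ P) e₁) l₁ x₁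
    ; connects₂ = attach (T₂ P ⊕ e₂) X
        (Connects-mono (T₂ P) (T₂ P ⊕ e₂) (X ∖ v) X (⊕-⊇ (T₂ P) e₂) (∖-⊆ X v) (connects₂ P)) xv (⊕-∈ (T₂ P) e₂) l₂ x₂
    }
    where
    lift : ∀ {e} → H e ≡ true × within (X ∖ v) e ≡ true → H e ≡ true × within X e ≡ true
    lift {e} (h , w) = h , within-⊆ {X ∖ v} {X} (∖-⊆ X v) e w
    off : ∀ {e u} → Link e v u → ¬ within (X ∖ v) e ≡ true
    off l w = ∖-≢ X v _ (proj₁ (within-link {X ∖ v} l w)) refl
    dis : ∀ e → T₁ P e ≡ true ⊎ e₁ ≡ e → T₂ P e ≡ true ⊎ e₂ ≡ e → ⊥
    dis e (inj₁ t) (inj₁ t′) = true≢false t′ (disjoint P e t)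
    dis e (inj₁ t) (inj₂ refl) = off l₂ (proj₂ (T₁⊆ P e t))
    dis e (inj₂ refl) (inj₁ t′) = off l₁ (proj₂ (T₂⊆ P e t′))
    dis e (inj₂ refl) (inj₂ q) = ne (sym q)

  -- v has exactly three edges into X: the virtual edge u₁u₂ of a packing of X ∖ v is
  -- replaced by the path u₁ v u₂, and the third edge hangs v onto the other subgraph.
  packing-degree-3 : ∀ {H X v e₁ e₂ e₃ u₁ u₂ u₃} → X v ≡ true →
    (H ∩ within X) e₁ ≡ true → Link e₁ v u₁ → (X ∖ v) u₁ ≡ true →
    (H ∩ within X) e₂ ≡ true → Link e₂ v u₂ → (X ∖ v) u₂ ≡ true →
    (H ∩ within X) e₃ ≡ true → Link e₃ v u₃ → (X ∖ v) u₃ ≡ true → e₁ ≢ e₃ → e₂ ≢ e₃ →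
    (P : Packing (u₁ ◂ a) (u₂ ◂ b) (true ◂ (H ∩ within (X ∖ v))) (X ∖ v)) → T₂ P zero ≡ false → Packing a b H X
  packing-degree-3 {H} {X} {v} {e₁} {e₂} {e₃} {u₁} {u₂} xv h₁ l₁ x₁ h₂ l₂ x₂ h₃ l₃ x₃ ne₁ ne₂ P t₂0 = record
    { T₁ = T₁′
    ; T₂ = T₂ P ∘ suc ⊕ e₃
    ; T₁⊆ = λ e t → sub₁ e (split₁ t)
    ; T₂⊆ = λ e t → [ (λ t → lift (T₂⊆ P (suc e) t)) , (λ { refl → ∧-split {H e₃} h₃ }) ]′ (⊕-split (T₂ P ∘ suc) e₃ e t)
    ; disjoint = λ e t → ¬true⇒false λ t′ → dis e (split₁ t) (⊕-split (T₂ P ∘ suc) e₃ e t′)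
    ; connects₁ = attach T₁′ X conn₁ xv e₁∈ l₁ x₁
    ; connects₂ = attach (T₂ P ∘ suc ⊕ e₃) X conn₂ xv (⊕-∈ (T₂ P ∘ suc) e₃) l₃ x₃
    }
    where
    T₁′ = T₁ P ∘ suc ⊕ e₁ ⊕ e₂
    e₁∈ : T₁′ e₁ ≡ true
    e₁∈ = ⊕-⊇ (T₁ P ∘ suc ⊕ e₁) e₂ e₁ (⊕-∈ (T₁ P ∘ suc) e₁)
    split₁ : ∀ {e} → T₁′ e ≡ true → T₁ P (suc e) ≡ true ⊎ (e₁ ≡ e ⊎ e₂ ≡ e)
    split₁ {e} t with ⊕-split (T₁ P ∘ suc ⊕ e₁) e₂ e t
    ... | inj₂ q = inj₂ (inj₂ q)
    ... | inj₁ q with ⊕-split (T₁ P ∘ suc) e₁ e q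
    ...   | inj₁ r = inj₁ r
    ...   | inj₂ r = inj₂ (inj₁ r)
    lift : ∀ {e} → (H ∩ within (X ∖ v)) e ≡ true × within (X ∖ v) e ≡ true → H e ≡ true × within X e ≡ true
    lift {e} (h , w) = proj₁ (∧-split {H e} h) , within-⊆ {X ∖ v} {X} (∖-⊆ X v) e w
    off : ∀ {e u} → Link e v u → ¬ within (X ∖ v) e ≡ true
    off l w = ∖-≢ X v _ (proj₁ (within-link {X ∖ v} l w)) refl
    sub₁ : ∀ e → T₁ P (suc e) ≡ true ⊎ (e₁ ≡ e ⊎ e₂ ≡ e) → H e ≡ true × within X e ≡ true
    sub₁ e (inj₁ t) = lift (T₁⊆ P (suc e) t)
    sub₁ e (inj₂ (inj₁ refl)) = ∧-split {H e₁} h₁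
    sub₁ e (inj₂ (inj₂ refl)) = ∧-split {H e₂} h₂
    dis : ∀ e → T₁ P (suc e) ≡ true ⊎ (e₁ ≡ e ⊎ e₂ ≡ e) → T₂ P (suc e) ≡ true ⊎ e₃ ≡ e → ⊥
    dis e (inj₁ t) (inj₁ t′) = true≢false t′ (disjoint P (suc e) t)
    dis e (inj₁ t) (inj₂ refl) = off l₃ (proj₂ (T₁⊆ P (suc e) t))
    dis e (inj₂ (inj₁ refl)) (inj₁ t′) = off l₁ (proj₂ (T₂⊆ P (suc e) t′))
    dis e (inj₂ (inj₂ refl)) (inj₁ t′) = off l₂ (proj₂ (T₂⊆ P (suc e) t′))
    dis e (inj₂ (inj₁ refl)) (inj₂ q) = ne₁ (sym q)
    dis e (inj₂ (inj₂ refl)) (inj₂ q) = ne₂ (sym q)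
    conn₁ : ∀ (Y : Mask n) {x y} → (X ∖ v) x ≡ true → Y x ≡ true → (X ∖ v) y ≡ true → Y y ≡ false →
              ∃ λ e → T₁′ e ≡ true × within X e ≡ true × crosses Y e ≡ true
    conn₁ Y xx yx xy yy with connects₁ P Y xx yx xy yy
    ... | suc e , t , w , c = e , ⊕-⊇ (T₁ P ∘ suc ⊕ e₁) e₂ e (⊕-⊇ (T₁ P ∘ suc) e₁ e t) , within-⊆ {X ∖ v} {X} (∖-⊆ X v) e w , c
    -- The virtual edge crosses `Y`, so `u₁` and `u₂` lie on different sides. On whichever side `v`
    -- lies, one of `e₁`, `e₂` crosses.
    ... | zero , t , w , c with Y v in yv | Y u₁ in yu₁ | Y u₂ in yu₂ | c
    ...   | true | false | _ | _ = e₁ , e₁∈ , proj₂ (∧-split {H e₁} h₁) , link-crosses {Y} l₁ yv yu₁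
    ...   | false | true | _ | _ = e₁ , e₁∈ , proj₂ (∧-split {H e₁} h₁) , link-crosses′ {Y} l₁ yv yu₁
    ...   | true | _ | false | _ = e₂ , ⊕-∈ (T₁ P ∘ suc ⊕ e₁) e₂ , proj₂ (∧-split {H e₂} h₂) , link-crosses {Y} l₂ yv yu₂
    ...   | false | _ | true | _ = e₂ , ⊕-∈ (T₁ P ∘ suc ⊕ e₁) e₂ , proj₂ (∧-split {H e₂} h₂) , link-crosses′ {Y} l₂ yv yu₂
    conn₂ : ∀ (Y : Mask n) {x y} → (X ∖ v) x ≡ true → Y x ≡ true → (X ∖ v) y ≡ true → Y y ≡ false →
              ∃ λ e → (T₂ P ∘ suc ⊕ e₃) e ≡ true × within X e ≡ true × crosses Y e ≡ true
    conn₂ Y xx yx xy yy with connects₂ P Y xx yx xy yy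
    ... | suc e , t , w , c = e , ⊕-⊇ (T₂ P ∘ suc) e₃ e t , within-⊆ {X ∖ v} {X} (∖-⊆ X v) e w , c
    ... | zero , t , w , c = ⊥-elim (true≢false t t₂0)

Packing-swap : ∀ {n m} {a b : Fin m → Fin n} {H X} → Packing a b H X → Packing a b H X
Packing-swap P = record
  { T₁ = T₂ P ; T₂ = T₁ P ; T₁⊆ = T₂⊆ P ; T₂⊆ = T₁⊆ P
  ; disjoint = λ e t → ¬true⇒false λ t′ → true≢false t (disjoint P e t′)
  ; connects₁ = connects₂ P ; connects₂ = connects₁ P }

size-cong : ∀ {n} {Y Z : Mask n} → (∀ v → Y v ≡ Z v) → size Y ≡ size Z
size-cong h = sum-cong-≗ (λ v → cong 𝟙 (h v))

⁅_⁆ : ∀ {n} → Fin n → Fin n → Bool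
⁅ u ⁆ = u ==_

size-⁅⁆ : ∀ {n} (u : Fin n) → size ⁅ u ⁆ ≡ 1
size-⁅⁆ {n} u = trans (size-⊕ ∅ u refl) (cong suc (sum-zero {n} λ _ → refl))

⊕-∖ : ∀ {n} (U : Mask n) v → U v ≡ false → ∀ w → ((U ⊕ v) ∖ v) w ≡ U w
⊕-∖ U v uv w with v ≟ w
... | yes refl rewrite uv = refl
... | no _ with U w
...   | true  = refl
...   | false = refl

module _ {n m : ℕ} (a b : Fin m → Fin n) (loopless : ∀ e → a e ≢ b e) where
  open Multigraph a b
  open Loopless loopless

  tight-⁅⁆ : ∀ H u → Tight H ⁅ u ⁆
  tight-⁅⁆ H u = (u , ==-refl u) , subst (λ k → 2 * k ≤ inside H ⁅ u ⁆ + 2) (sym (size-⁅⁆ u)) (m≤n+m 2 _)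

  deg-≥3 : ∀ G {v e₁ e₂ e₃ u₁ u₂ u₃} → G e₁ ≡ true → G e₂ ≡ true → G e₃ ≡ true →
           Link e₁ v u₁ → Link e₂ v u₂ → Link e₃ v u₃ → e₁ ≢ e₂ → e₁ ≢ e₃ → e₂ ≢ e₃ → 3 ≤ deg G v
  deg-≥3 G {v} {e₁} {e₂} {e₃} g₁ g₂ g₃ l₁ l₂ l₃ n₁₂ n₁₃ n₂₃ = begin
    3 ≤⟨ m≤n+m 3 (deg G₃ v) ⟩
    deg G₃ v + 3 ≡⟨ +-assoc (deg G₃ v) 1 2 ⟨
    deg G₃ v + 1 + 2 ≡⟨ cong (λ k → deg G₃ v + k + 2) (link-inc-end l₃) ⟨
    deg G₃ v + inc e₃ v + 2 ≡⟨ cong (_+ 2) (deg-∖ G₂ e₃ v g₃′) ⟨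
    deg G₂ v + 2 ≡⟨ +-assoc (deg G₂ v) 1 1 ⟨
    deg G₂ v + 1 + 1 ≡⟨ cong (λ k → deg G₂ v + k + 1) (link-inc-end l₂) ⟨
    deg G₂ v + inc e₂ v + 1 ≡⟨ cong (_+ 1) (deg-∖ G₁ e₂ v (∖-∈ G e₁ g₂ n₁₂)) ⟨
    deg G₁ v + 1 ≡⟨ cong (deg G₁ v +_) (link-inc-end l₁) ⟨
    deg G₁ v + inc e₁ v ≡⟨ deg-∖ G e₁ v g₁ ⟨
    deg G v ∎
    where
    open ≤-Reasoning
    G₁ = G ∖ e₁
    G₂ = G₁ ∖ e₂
    G₃ = G₂ ∖ e₃
    g₃′ : G₂ e₃ ≡ true
    g₃′ = ∖-∈ G₁ e₂ (∖-∈ G e₁ g₃ n₁₃) n₂₃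

  -- The condition under which a virtual edge between `u` and `u′` preserves sparseness. It also
  -- excludes `u ≡ u′`, since singletons are tight, so the virtual edge is no loop.
  Separated : Mask m → Mask n → Fin n → Fin n → Set
  Separated H X u u′ = ∀ Z → (∀ w → Z w ≡ true → X w ≡ true) → Tight H Z → Z u ≡ true → Z u′ ≡ true → ⊥

  -- At most one of the two virtual edges `u₁u₂` and `u₂u₃` can be blocked. If tight sets block
  -- both, their union through `u₂` is tight, and adjoining `v` adds one vertex but three edges, one
  -- too many for sparseness.
  separated : ∀ H X {v e₁ e₂ e₃ u₁ u₂ u₃} → Sparse H → H e₁ ≡ true → H e₂ ≡ true → H e₃ ≡ true →
              Link e₁ v u₁ → Link e₂ v u₂ → Link e₃ v u₃ → e₁ ≢ e₂ → e₁ ≢ e₃ → e₂ ≢ e₃ →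
              (∃ λ Z → (∀ w → Z w ≡ true → (X ∖ v) w ≡ true) × Tight H Z × Z u₁ ≡ true × Z u₂ ≡ true) →
              Separated H (X ∖ v) u₂ u₃
  separated H X {v} {e₁} {e₂} {e₃} {u₁} {u₂} {u₃} sp h₁ h₂ h₃ l₁ l₂ l₃ n₁₂ n₁₃ n₂₃ (Y , Y⊆ , tY , yu₁ , yu₂) Z Z⊆ tZ zu₂ zu₃ =
    1+n≰n (linear 0 (+-mono-≤ (+-mono-≤ (proj₂ tU) (sp (U ⊕ v) (v , ⊕-∈ U v))) i-U⊕v)
      (count (size U) (inside H U) (inside H (U ⊕ v)) (size (U ⊕ v)) (size-⊕ U v uv)))
    where
    U = Y ∪ Z
    tU : Tight H U
    tU = tight-∪ {H} {Y} {Z} sp tY tZ yu₂ zu₂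
    uv : U v ≡ false
    uv = ¬true⇒false λ h → [ (λ p → ∖-≢ X v v (Y⊆ v p) refl) , (λ p → ∖-≢ X v v (Z⊆ v p) refl) ]′ (∨-split {Y v} h)
    W = H ∩ within (U ⊕ v)
    in-W : ∀ {e u} → H e ≡ true → Link e v u → U u ≡ true → W e ≡ true
    in-W {e} {u} h l p = ∧-intro h (link-within {U ⊕ v} l (⊕-∈ U v) (⊕-⊇ U v u p))
    i-U⊕v : inside H U + 3 ≤ inside H (U ⊕ v)
    i-U⊕v = begin
      inside H U + 3 ≡⟨ cong (_+ 3) (sum-cong-≗ (λ e → cong₂ (λ p q → 𝟙 (H e ∧ (p ∧ q))) (⊕-∖ U v uv (a e)) (⊕-∖ U v uv (b e)))) ⟨
      inside H ((U ⊕ v) ∖ v) + 3 ≤⟨ +-monoʳ-≤ _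
          (deg-≥3 W (in-W h₁ l₁ (∨-introˡ yu₁)) (in-W h₂ l₂ (∨-introˡ yu₂))
              (in-W h₃ l₃ (∨-introʳ {Y u₃} zu₃)) l₁ l₂ l₃ n₁₂ n₁₃ n₂₃) ⟩
      inside H ((U ⊕ v) ∖ v) + deg W v ≡⟨ inside-∖ H (U ⊕ v) v (⊕-∈ U v) ⟨
      inside H (U ⊕ v) ∎
      where open ≤-Reasoning
    count : ∀ s i j t → t ≡ suc s → (i + 2) + 2 * t + j + 1 + 0 ≡ 2 * s + (j + 2) + (i + 3) + 0
    count s i j t refl = arith s i j
      where
      arith : ∀ s i j → (i + 2) + 2 * suc s + j + 1 + 0 ≡ 2 * s + (j + 2) + (i + 3) + 0
      arith = solve-∀

-- The induction is on the number of vertices of `X`. The endpoint maps and the number of edges vary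
-- along it, because reducing a vertex of degree 3 passes to a graph with a virtual edge.
packing : ∀ k {n m} (a b : Fin m → Fin n) → (∀ e → a e ≢ b e) → ∀ H X → size X ≡ suc k →
          Multigraph.Sparse a b H → Multigraph.Tight a b H X → ¬ ¬ Packing a b H X
packing zero {n} {m} a b loopless H X sX sp tX = return record
  { T₁ = ∅ ; T₂ = ∅ ; T₁⊆ = λ _ () ; T₂⊆ = λ _ () ; disjoint = λ _ () ; connects₁ = trivial ; connects₂ = trivial }
  where
  open Multigraph a b
  trivial : Connects ∅ X
  trivial Y {x} {y} xx yx xy yy = ⊥-elim (<⇒≱ (s≤s (size-pos (X ∖ x) (∖-∈ X x xy λ { refl → true≢false yx yy })))
    (≤-reflexive (trans (sym (size-∖ X x xx)) sX)))
packing (suc k) {n} {m} a b loopless H X sX sp tX = do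
  (v , xv , d≤3) ← low-degree
  cases v xv d≤3
  where
  open Multigraph a b
  open Loopless loopless
  D = H ∩ within X

  -- Degrees of at least 4 throughout `X` would give twice `inside H X` at least 4|X|, against the
  -- sparseness bound 4|X| - 4.
  low-degree : ¬ ¬ (∃ λ v → X v ≡ true × deg D v ≤ 3)
  low-degree none = <⇒≱ (s≤s (z≤n {3}))
      (linear 0 (+-mono-≤ (+-mono-≤ 4s≤2i (sp X (proj₁ tX))) (sp X (proj₁ tX))) (count (size X) (inside H X)))
    where
    pt : ∀ v → 𝟙 (X v) * 4 ≤ 𝟙 (X v) * deg D v
    pt v with X v in xv
    ... | false = z≤n
    ... | true  = *-monoʳ-≤ 1 (≰⇒> (λ d≤3 → none (v , xv , d≤3)))
    pt′ : ∀ h x y → 𝟙 (h ∧ (x ∧ y)) * (𝟙 x + 𝟙 y) ≡ 𝟙 (h ∧ (x ∧ y)) * 2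
    pt′ = toWitness {a? = ∀Bool? λ h → ∀Bool? λ x → ∀Bool? λ y → _ ≟ℕ _} _
    4s≤2i : size X * 4 ≤ inside H X * 2
    4s≤2i = begin
      size X * 4 ≡⟨ *-distribʳ-sum 4 (𝟙 ∘ X) ⟩
      sum (λ v → 𝟙 (X v) * 4) ≤⟨ sum-mono pt ⟩
      sum (λ v → 𝟙 (X v) * deg D v) ≡⟨ handshake D X ⟩
      sum (λ e → 𝟙 (D e) * (𝟙 (X (a e)) + 𝟙 (X (b e)))) ≡⟨ sum-cong-≗ (λ e → pt′ (H e) (X (a e)) (X (b e))) ⟩
      sum (λ e → 𝟙 (D e) * 2) ≡⟨ *-distribʳ-sum 2 (𝟙 ∘ D) ⟨
      inside H X * 2 ∎
      where open ≤-Reasoning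
    count : ∀ s i → i * 2 + 2 * s + 2 * s + 4 + 0 ≡ s * 4 + (i + 2) + (i + 2) + 0
    count = solve-∀

  module _ (v : Fin n) (xv : X v ≡ true) where
    X′ = X ∖ v

    sX′ : size X ≡ suc (size X′)
    sX′ = size-∖ X v xv

    i-split : inside H X ≡ inside H X′ + deg D v
    i-split = inside-∖ H X v xv

    X′-nonempty : Nonempty X′
    X′-nonempty = size-inhabited X′ (≤-trans (s≤s z≤n) (≤-reflexive (suc-injective (trans (sym sX) sX′))))

    2≤deg : 2 ≤ deg D v
    2≤deg = let x , x∈ = X′-nonempty in tight-deg H X sp tX xv (∖-⊆ X v x x∈) (∖-≢ X v x x∈)

    near : ∀ {e u} → D e ≡ true → Link e v u → X′ u ≡ true
    near {e} {u} d l = ∖-∈ X v (proj₂ (within-link {X} l (proj₂ (∧-split {H e} d)))) (link-≢ l)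

    tX′ : deg D v ≡ 2 → Tight H X′
    tX′ d = X′-nonempty , linear 0 (subst₂ (λ s i → 2 * s ≤ i + 2) sX′ (trans i-split (cong (inside H X′ +_) d)) (proj₂ tX))
      (count (size X′) (inside H X′))
      where
      count : ∀ s i → i + 2 + 2 + 2 * s + 0 ≡ 2 * suc s + (i + 2)
      count = solve-∀

    module Virtual {e₁ e₂ e₃ u₁ u₂ u₃} (d₁ : D e₁ ≡ true) (l₁ : Link e₁ v u₁) (d₂ : D e₂ ≡ true) (l₂ : Link e₂ v u₂)
                   (d₃ : D e₃ ≡ true) (l₃ : Link e₃ v u₃) (n₁₃ : e₁ ≢ e₃) (n₂₃ : e₂ ≢ e₃) (d≡3 : deg D v ≡ 3)
                   (sep : Separated a b loopless H X′ u₁ u₂) where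
      H′ = true ◂ (H ∩ within X′)
      module M′ = Multigraph (u₁ ◂ a) (u₂ ◂ b)

      loopless′ : ∀ e → (u₁ ◂ a) e ≢ (u₂ ◂ b) e
      loopless′ (suc e) = loopless e
      loopless′ zero refl = sep ⁅ u₁ ⁆ (λ w p → subst (λ w → X′ w ≡ true) (==⇒≡ {x = u₁} p) (near d₁ l₁))
        (tight-⁅⁆ a b loopless H u₁) (==-refl u₁) (==-refl u₁)

      restrict : ∀ Y → size ((H ∩ within X′) ∩ within Y) ≡ inside H (Y ∩ X′)
      restrict Y = sum-cong-≗ λ e → cong 𝟙 (pt (H e) (X′ (a e)) (X′ (b e)) (Y (a e)) (Y (b e)))
        where
        pt : ∀ h x x′ y y′ → ((h ∧ (x ∧ x′)) ∧ (y ∧ y′)) ≡ (h ∧ ((y ∧ x) ∧ (y′ ∧ x′)))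
        pt = toWitness {a? = ∀Bool? λ h → ∀Bool? λ x → ∀Bool? λ x′ → ∀Bool? λ y → ∀Bool? λ y′ → _ ≟ᵇ _} _

      sparse′ : M′.Sparse H′
      sparse′ Y (y , yy) rewrite restrict Y with Y u₁ ∧ Y u₂ in yu
      ... | true = let yu₁ , yu₂ = ∧-split {Y u₁} yu in
        ≤-trans (≰⇒> λ t → sep (Y ∩ X′) (λ w p → proj₂ (∧-split {Y w} p)) ((u₁ , ∧-intro yu₁ (near d₁ l₁)) , t)
                                 (∧-intro yu₁ (near d₁ l₁)) (∧-intro yu₂ (near d₂ l₂)))
                (*-monoʳ-≤ 2 (size-⊆ (λ w p → proj₁ (∧-split {Y w} p))))
      ... | false with size (Y ∩ X′) in sY
      ...   | suc _ = ≤-trans (sp (Y ∩ X′) (size-inhabited (Y ∩ X′) (≤-trans (s≤s z≤n) (≤-reflexive (sym sY)))))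
                              (*-monoʳ-≤ 2 (size-⊆ (λ w p → proj₁ (∧-split {Y w} p))))
      -- Sparseness says nothing about the empty trace of `Y` on `X′`. Here no edge lies inside `Y`,
      -- and 2 ≤ 2|Y| holds because `y` lies in `Y`.
      ...   | zero = ≤-trans (≤-reflexive (cong (_+ 2) (sum-zero λ e → cong 𝟙 (¬true⇒false λ p →
                       <⇒≱ (s≤s z≤n) (≤-trans (size-pos (Y ∩ X′)
                           (proj₁ (∧-split {(Y ∩ X′) (a e)} (proj₂ (∧-split {H e} p))))) (≤-reflexive sY))))))
                       (*-monoʳ-≤ 2 (size-pos Y yy))

      tight′ : M′.Tight H′ X′
      tight′ = X′-nonempty , subst (λ k → 2 * size X′ ≤ k + 2) (sym i′)
        (linear 0 (subst₂ (λ s i → 2 * s ≤ i + 2) sX′ (trans i-split (cong (inside H X′ +_) d≡3)) (proj₂ tX))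
            (count (size X′) (inside H X′)))
        where
        i′ : M′.inside H′ X′ ≡ suc (inside H X′)
        i′ = cong₂ _+_ (cong 𝟙 (∧-intro (near d₁ l₁) (near d₂ l₂)))
               (trans (restrict X′) (sum-cong-≗ λ e → cong 𝟙 (cong (H e ∧_) (cong₂ _∧_ (∧-idem (X′ (a e))) (∧-idem (X′ (b e)))))))
        count : ∀ s i → i + 3 + 2 + 2 * s + 0 ≡ 2 * suc s + (suc i + 2)
        count = solve-∀

      extend : ¬ ¬ Packing a b H X
      extend = do
        P ← packing k (u₁ ◂ a) (u₂ ◂ b) loopless′ H′ X′ (suc-injective (trans (sym sX′) sX)) sparse′ tight′
        return (unvirtual P)
        where
        replace = packing-degree-3 a b xv d₁ l₁ (near d₁ l₁) d₂ l₂ (near d₂ l₂) d₃ l₃ (near d₃ l₃) n₁₃ n₂₃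
        unvirtual : Packing (u₁ ◂ a) (u₂ ◂ b) H′ X′ → Packing a b H X
        unvirtual P with T₂ P zero in t
        ... | false = replace P t
        -- The virtual edge belongs to at most one of the two subgraphs; exchanging their roles
        -- keeps it out of `T₂`.
        ... | true  = replace (Packing-swap P) (¬true⇒false λ t₁ → true≢false t (disjoint P zero t₁))

    cases : deg D v ≤ 3 → ¬ ¬ Packing a b H X
    cases d≤3 with pick D v (≤-trans (s≤s z≤n) 2≤deg)
    ... | e₁ , u₁ , d₁ , l₁ , q₁ with pick (D ∖ e₁) v (s≤s⁻¹ (≤-trans 2≤deg (≤-reflexive q₁)))
    ...   | e₂ , u₂ , d₂ , l₂ , q₂ with deg (D ∖ e₁ ∖ e₂) v in q
    ...     | zero = do
      P ← packing k a b loopless H X′ (suc-injective (trans (sym sX′) sX)) sp (tX′ (trans q₁ (cong suc q₂)))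
      return (packing-degree-2 a b xv d₁ l₁ (near d₁ l₁) (∖-⊆ D e₁ e₂ d₂) l₂ (near (∖-⊆ D e₁ e₂ d₂) l₂) (∖-≢ D e₁ e₂ d₂) P)
    ...     | suc d with pick (D ∖ e₁ ∖ e₂) v (≤-trans (s≤s z≤n) (≤-reflexive (sym q)))
    ...       | e₃ , u₃ , d₃ , l₃ , q₃ = do
      -- If no tight set blocks `u₁u₂`, that pair carries the virtual edge and `e₃` hangs. Otherwise
      -- `separated` frees the pair `u₂u₃`, and `e₁` becomes the hanging edge.
      (inj₁ t) ← em {A = ∃ λ Z → (∀ w → Z w ≡ true → X′ w ≡ true) × Tight H Z × Z u₁ ≡ true × Z u₂ ≡ true}
        where (inj₂ s) → Virtual.extend d₁ l₁ d₂′ l₂ d₃′ l₃ n₁₃ n₂₃ d≡3 (λ Z Z⊆ tZ p q → s (Z , Z⊆ , tZ , p , q))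
      Virtual.extend d₂′ l₂ d₃′ l₃ d₁ l₁ (n₁₂ ∘ sym) (n₁₃ ∘ sym) d≡3
        (separated a b loopless H X sp (proj₁ (∧-split {H e₁} d₁)) (proj₁ (∧-split {H e₂} d₂′)) (proj₁ (∧-split {H e₃} d₃′))
          l₁ l₂ l₃ n₁₂ n₁₃ n₂₃ t)
      where
      d₂′ = ∖-⊆ D e₁ e₂ d₂
      d₃″ = ∖-⊆ (D ∖ e₁) e₂ e₃ d₃
      d₃′ = ∖-⊆ D e₁ e₃ d₃″
      n₁₂ = ∖-≢ D e₁ e₂ d₂
      n₁₃ = ∖-≢ D e₁ e₃ d₃″
      n₂₃ = ∖-≢ (D ∖ e₁) e₂ e₃ d₃
      d≡3 : deg D v ≡ 3
      d≡3 = ≤-antisym d≤3 (≤-trans (s≤s (s≤s (s≤s z≤n))) (≤-reflexive (sym (trans q₁ (cong suc q₂)))))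

-- Joins and Euler tours

all-or-missing : ∀ {n} (Y : Mask n) → (∀ v → Y v ≡ true) ⊎ ∃ λ v → Y v ≡ false
all-or-missing {zero}  Y = inj₁ λ ()
all-or-missing {suc n} Y with Y zero in y₀ | all-or-missing (Y ∘ suc)
... | false | _               = inj₂ (zero , y₀)
... | true  | inj₂ (v , y)    = inj₂ (suc v , y)
... | true  | inj₁ ys         = inj₁ λ { zero → y₀ ; (suc v) → ys v }

size-≤ : ∀ {n} (Y : Mask n) → size Y ≤ n
size-≤ {n} Y = ≤-trans (size-⊆ {n} {Y} {full} (λ _ _ → refl)) (≤-reflexive (size-full n))

module _ {n m : ℕ} (a b : Fin m → Fin n) (loopless : ∀ e → a e ≢ b e) where
  open Multigraph a b
  open Loopless loopless

  odd-inc : ∀ {e u w} → Link e u w → ∀ v → odd (inc e v) ≡ (u == v) xor (w == v)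
  odd-inc {e} {u} {w} l v rewrite link-inc l v = pt (u == v) (w == v)
    where
    pt : ∀ p q → odd (𝟙 p + 𝟙 q) ≡ p xor q
    pt = toWitness {a? = ∀Bool? λ p → ∀Bool? λ q → _ ≟ᵇ _} _

  odd-deg-toggle : ∀ (J : Mask m) e v →
    odd (deg (λ f → J f xor (e == f)) v) ≡ odd (deg J v) xor odd (inc e v)
  odd-deg-toggle J e v = trans (sum-odd (λ f → pt (J f) (e == f) (inc f v)))
    (cong (λ k → odd (deg J v) xor odd k) (sum-select (λ f → inc f v) e))
    where
    pt : ∀ j p k → odd (𝟙 (j xor p) * k) ≡ odd (𝟙 j * k) xor odd (k * 𝟙 p)
    pt j false k rewrite *-zeroʳ k | xor-identityʳ j | xor-identityʳ (odd (𝟙 j * k)) = refl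
    pt false true k rewrite *-identityʳ k | +-identityʳ k = refl
    pt true  true k rewrite *-identityʳ k | +-identityʳ k = sym (xor-same (odd k))

  -- `J` is a join in `T` with odd set `ρ`. Confining `ρ` to `Y` allows an induction in which `Y`
  -- grows by one vertex at a time.
  Joinable : Mask m → Mask n → Set
  Joinable T Y = ∀ (ρ : Mask n) → (∀ v → ρ v ≡ true → Y v ≡ true) → odd (size ρ) ≡ false →
    ∃ λ J → (∀ e → J e ≡ true → T e ≡ true) × (∀ v → odd (deg J v) ≡ ρ v)

  -- A parity demanded at the new vertex `w` is handed over to `u` along `e`: flip both ends in `ρ`,
  -- solve inside `Y`, then toggle `e` in the solution. Toggling also covers the case that `e` was
  -- already chosen.
  joinable-⊕ : ∀ T Y {e u w} → T e ≡ true → Link e u w → Y u ≡ true → Joinable T Y → Joinable T (Y ⊕ w)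
  joinable-⊕ T Y {e} {u} {w} te l yu joinable ρ ρ⊆ even with ρ w in ρw
  ... | false = joinable ρ (λ v ρv → [ id , (λ { refl → ⊥-elim (true≢false ρv ρw) }) ]′ (⊕-split Y w v (ρ⊆ v ρv))) even
  ... | true = let J , J⊆ , J-odd = joinable ρ′ ρ′⊆ ρ′-even in
      (λ f → J f xor (e == f)) ,
      (λ f jf → [ J⊆ f , (λ q → subst (λ f → T f ≡ true) (==⇒≡ {x = e} q) te) ]′ (xor-split (J f) jf)) ,
      (λ v → trans (odd-deg-toggle J e v) (trans (cong₂ _xor_ (J-odd v) (odd-inc l v)) (cancel (ρ v) ((u == v) xor (w == v)))))
    where
    ρ′ : Mask n
    ρ′ v = ρ v xor ((u == v) xor (w == v))
    cancel : ∀ p q → (p xor q) xor q ≡ p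
    cancel = toWitness {a? = ∀Bool? λ p → ∀Bool? λ q → _ ≟ᵇ _} _
    xor-split : ∀ x {y} → x xor y ≡ true → x ≡ true ⊎ y ≡ true
    xor-split true  _ = inj₁ refl
    xor-split false h = inj₂ h
    ρ′⊆ : ∀ v → ρ′ v ≡ true → Y v ≡ true
    ρ′⊆ v h with u ≟ v | w ≟ v
    ... | yes refl | _ = yu
    ... | no _ | yes refl rewrite ρw = case h of λ ()
    ... | no _ | no w≢v = [ (λ y → y) , (λ q → ⊥-elim (w≢v q)) ]′ (⊕-split Y w v (ρ⊆ v (trans (sym (xor-identityʳ (ρ v))) h)))
    ρ′-even : odd (size ρ′) ≡ false
    ρ′-even = trans (sum-odd (λ v → pt (ρ v) (u == v) (w == v))) (trans (cong₂ _xor_ even pair) refl)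
      where
      pt : ∀ x p q → odd (𝟙 (x xor (p xor q))) ≡ odd (𝟙 x) xor odd (𝟙 p + 𝟙 q)
      pt = toWitness {a? = ∀Bool? λ x → ∀Bool? λ p → ∀Bool? λ q → _ ≟ᵇ _} _
      pair : odd (sum λ v → 𝟙 (u == v) + 𝟙 (w == v)) ≡ false
      pair = cong odd (trans (∑-distrib-+ (𝟙 ∘ ⁅ u ⁆) (𝟙 ∘ ⁅ w ⁆)) (cong₂ _+_ (size-⁅⁆ u) (size-⁅⁆ w)))

  joinable-⁅⁆ : ∀ T r → Joinable T ⁅ r ⁆
  joinable-⁅⁆ T r ρ ρ⊆ even = ∅ , (λ _ ()) , λ v → trans (cong odd (sum-zero {m} (λ _ → refl))) (sym (ρ-empty v))
    where
    ρ≡ : ∀ v → ρ v ≡ ρ r ∧ (r == v)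
    ρ≡ v with r ≟ v
    ... | yes refl = sym (trans (∧-comm (ρ r) true) refl)
    ... | no r≢v = trans (¬true⇒false λ h → r≢v (==⇒≡ (ρ⊆ v h))) (∧-comm false (ρ r))
    ρr : ρ r ≡ false
    ρr with ρ r in eq
    ... | false = refl
    ... | true  = ⊥-elim (true≢false (cong odd (trans (size-cong (λ v → trans (ρ≡ v) (cong (_∧ (r == v)) eq))) (size-⁅⁆ r))) even)
    ρ-empty : ∀ v → ρ v ≡ false
    ρ-empty v = trans (ρ≡ v) (cong (_∧ (r == v)) ρr)

  -- As long as `Y` misses a vertex, connectivity yields an edge of `T` leaving `Y`, whose outer end
  -- is adjoined. `k` bounds the number of vertices still missing.
  joinable-full : ∀ T → Connects T full → Fin n → Joinable T full
  joinable-full T conn r = grow n ⁅ r ⁆ (==-refl r) (m≤n+m n _) (joinable-⁅⁆ T r)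
    where
    grow : ∀ k Y → Y r ≡ true → n ≤ size Y + k → Joinable T Y → Joinable T full
    grow k Y yr bound joinable with all-or-missing Y
    ... | inj₁ all = λ ρ _ → joinable ρ (λ v _ → all v)
    grow zero Y yr bound joinable | inj₂ (v , yv) = ⊥-elim (<⇒≱ (≤-trans (≤-reflexive (sym (size-⊕ Y v yv))) (size-≤ (Y ⊕ v)))
      (subst (n ≤_) (+-identityʳ _) bound))
    grow (suc k) Y yr bound joinable | inj₂ (v , yv) with conn Y {r} {v} refl yr refl yv
    ... | e , te , _ , c with crosses-link {Y} e c
    ...   | u , w , l , yu , yw = grow k (Y ⊕ w) (⊕-⊇ Y w r yr)
            (subst (n ≤_) (trans (+-suc (size Y) k) (cong (_+ k) (sym (size-⊕ Y w yw)))) bound)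
            (joinable-⊕ T Y te l yu joinable)

  record Eulerian (M : Mask m) : Set where
    field
      even     : ∀ v → odd (deg M v) ≡ false
      connects : Connects M full

  eulerian : ∀ {H} → Packing a b H full → Fin n → ∃ λ M → (∀ e → M e ≡ true → H e ≡ true) × Eulerian M
  eulerian {H} P r = let J , J⊆ , J-odd = joinable-full (T₂ P) (connects₂ P) r ρ (λ _ _ → refl) ρ-even in
    (T₁ P ∪ J) ,
    (λ e h → [ (λ t → proj₁ (T₁⊆ P e t)) , (λ t → proj₁ (T₂⊆ P e (J⊆ e t))) ]′ (∨-split {T₁ P e} h)) ,
    record
      { even = λ v → trans (sum-odd (λ e → pt (T₁ P e) (J e) (inc e v)
          (λ t → ¬true⇒false λ j → true≢false (J⊆ e j) (disjoint P e t))))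
                           (trans (cong (odd (deg (T₁ P) v) xor_) (J-odd v)) (xor-same (odd (deg (T₁ P) v))))
      ; connects = λ Y xx yx xy yy → let e , t , w , c = connects₁ P Y xx yx xy yy in e , ∨-introˡ t , w , c }
    where
    ρ : Mask n
    ρ v = odd (deg (T₁ P) v)
    -- No edge crosses the whole vertex set, so the degree sum of `T₁` is even and its odd vertices
    -- are an admissible target for a join in `T₂`.
    ρ-even : odd (size ρ) ≡ false
    ρ-even = begin
      odd (size ρ) ≡⟨ sum-odd-cong (λ v → trans (odd-𝟙 (ρ v)) (cong odd (sym (+-identityʳ (deg (T₁ P) v))))) ⟩
      odd (sum λ v → 𝟙 (full v) * deg (T₁ P) v) ≡⟨ odd-cut (T₁ P) full ⟨
      odd (cut (T₁ P) full) ≡⟨ cong odd (sum-zero λ e → cong 𝟙 (∧-comm (T₁ P e) false)) ⟩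
      false ∎
      where open ≡-Reasoning
    pt : ∀ t j k → (t ≡ true → j ≡ false) → odd (𝟙 (t ∨ j) * k) ≡ odd (𝟙 t * k) xor odd (𝟙 j * k)
    pt false j k h = refl
    pt true  j k h rewrite h refl = sym (xor-identityʳ _)

src tgt : (G : Graph) → Fin (m G) → Fin (n G)
src G e = proj₁ (ends G e)
tgt G e = proj₂ (ends G e)

module Trails (G : Graph) where
  open Multigraph (src G) (tgt G)
  open Loopless (loopless G)

  link⇒joins : ∀ {e u v} → Link e u v → Joins G e u v
  link⇒joins (inj₁ (p , q)) = inj₁ (cong₂ _,_ p q)
  link⇒joins (inj₂ (p , q)) = inj₂ (cong₂ _,_ p q)

  joins⇒link : ∀ {e u v} → Joins G e u v → Link e u v
  joins⇒link (inj₁ p) = inj₁ (cong proj₁ p , cong proj₂ p)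
  joins⇒link (inj₂ p) = inj₂ (cong proj₁ p , cong proj₂ p)

  uses : ∀ {u w} → Walk G u w → Fin (m G) → ℕ
  uses nil          f = 0
  uses (cons e _ W) f = 𝟙 (e == f) + uses W f

  visits : ∀ {u w} → Walk G u w → Fin (n G) → ℕ
  visits nil v = 0
  visits {u = u} (cons _ _ W) v = 𝟙 (u == v) + visits W v

  _++_ : ∀ {u v w} → Walk G u v → Walk G v w → Walk G u w
  nil        ++ V = V
  cons e j W ++ V = cons e j (W ++ V)

  uses-++ : ∀ {u v w} (W : Walk G u v) (V : Walk G v w) f → uses (W ++ V) f ≡ uses W f + uses V f
  uses-++ nil          V f = refl
  uses-++ (cons e _ W) V f = trans (cong (𝟙 (e == f) +_) (uses-++ W V f)) (sym (+-assoc (𝟙 (e == f)) _ _))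

  visits-++ : ∀ {u v w} (W : Walk G u v) (V : Walk G v w) x → visits (W ++ V) x ≡ visits W x + visits V x
  visits-++ nil V x = refl
  visits-++ {u = u} (cons e _ W) V x = trans (cong (𝟙 (u == x) +_) (visits-++ W V x)) (sym (+-assoc (𝟙 (u == x)) _ _))

  -- `visits` counts departures. Arrivals agree with departures except that the start has one
  -- departure too many and the end one arrival too many; the two indicators correct this.
  walk-degree : ∀ {u w} (W : Walk G u w) v →
                sum (λ f → uses W f * inc f v) + 𝟙 (u == v) ≡ 2 * visits W v + 𝟙 (w == v)
  walk-degree {u} nil v = cong (_+ 𝟙 (u == v)) (sum-zero {m G} (λ _ → refl))
  walk-degree {u} {w} (cons {x = x} e j W) v = begin
    sum (λ f → (𝟙 (e == f) + uses W f) * inc f v) + 𝟙 (u == v)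
      ≡⟨ cong (_+ 𝟙 (u == v)) (trans (sum-cong-≗ (λ f → expand (𝟙 (e == f)) (uses W f) (inc f v)))
           (trans (∑-distrib-+ (λ f → inc f v * 𝟙 (e == f)) _) (cong (_+ S) (sum-select (λ f → inc f v) e)))) ⟩
    inc e v + S + 𝟙 (u == v)
      ≡⟨ cong (λ k → k + S + 𝟙 (u == v)) (link-inc (joins⇒link j) v) ⟩
    𝟙 (u == v) + 𝟙 (x == v) + S + 𝟙 (u == v)
      ≡⟨ gather (𝟙 (u == v)) (𝟙 (x == v)) S ⟩
    2 * 𝟙 (u == v) + (S + 𝟙 (x == v))
      ≡⟨ cong (2 * 𝟙 (u == v) +_) (walk-degree W v) ⟩
    2 * 𝟙 (u == v) + (2 * visits W v + 𝟙 (w == v))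
      ≡⟨ regroup (𝟙 (u == v)) (visits W v) (𝟙 (w == v)) ⟩
    2 * (𝟙 (u == v) + visits W v) + 𝟙 (w == v) ∎
    where
    open ≡-Reasoning
    S = sum (λ f → uses W f * inc f v)
    expand : ∀ p q k → (p + q) * k ≡ k * p + q * k
    expand = solve-∀
    gather : ∀ p q s → p + q + s + p ≡ 2 * p + (s + q)
    gather = solve-∀
    regroup : ∀ p q r → 2 * p + (2 * q + r) ≡ 2 * (p + q) + r
    regroup = solve-∀

  closed-degree : ∀ {u} (W : Walk G u u) v → sum (λ f → uses W f * inc f v) ≡ 2 * visits W v
  closed-degree {u} W v = +-cancelʳ-≡ (𝟙 (u == v)) _ _ (walk-degree W v)

  infix 4 _∣_▷_
  -- One equation per edge says at once that `W` stays in `M`, repeats no edge, and leaves exactly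
  -- `R`.
  record _∣_▷_ {u w} (M : Mask (m G)) (W : Walk G u w) (R : Mask (m G)) : Set where
    constructor run
    field
      consumes : ∀ f → uses W f + 𝟙 (R f) ≡ 𝟙 (M f)
  open _∣_▷_

  consume-size : ∀ {u w M R} {W : Walk G u w} → M ∣ W ▷ R → size M ≡ sum (uses W) + size R
  consume-size {M = M} {R} {W} r = trans (sum-cong-≗ (sym ∘ consumes r)) (∑-distrib-+ (uses W) (𝟙 ∘ R))

  ∣▷-cons : ∀ {M R u v w e} (j : Joins G e u v) {W : Walk G v w} → M e ≡ true → M ∖ e ∣ W ▷ R → M ∣ cons e j W ▷ R
  ∣▷-cons {M} {R} {e = e} j {W} me r = run pt
    where
    pt : ∀ f → 𝟙 (e == f) + uses W f + 𝟙 (R f) ≡ 𝟙 (M f)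
    pt f with e ≟ f | consumes r f
    ... | yes refl | q rewrite me = cong suc q
    ... | no _ | q with M f
    ...   | true  = q
    ...   | false = q

  -- The exclusive or makes the case `x ≡ u` mean that all degrees are even, so the closing trail
  -- needs no separate invariant.
  EvenExcept : Mask (m G) → Fin (n G) → Fin (n G) → Set
  EvenExcept M x u = ∀ v → odd (deg M v) ≡ (x == v) xor (u == v)

  Even : Mask (m G) → Set
  Even M = ∀ v → odd (deg M v) ≡ false

  even-∖ : ∀ {M e x y u} → M e ≡ true → Link e x y → EvenExcept M x u → EvenExcept (M ∖ e) y u
  even-∖ {M} {e} {x} {y} {u} me l ev v = solve-xor (odd (deg (M ∖ e) v)) (x == v) (y == v) (u == v)
    (trans (sym (trans (cong odd (deg-∖ M e v me)) (odd-+ (deg (M ∖ e) v) (inc e v))) )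
           (ev v)) (odd-inc _ _ (loopless G) l v)
    where
    solve-xor : ∀ d p q r {i} → d xor i ≡ p xor r → i ≡ p xor q → d ≡ q xor r
    solve-xor d p q r eq refl = lem d p q r eq
      where
      lem : ∀ d p q r → d xor (p xor q) ≡ p xor r → d ≡ q xor r
      lem = toWitness {a? = ∀Bool? λ d → ∀Bool? λ p → ∀Bool? λ q → ∀Bool? λ r →
              (d xor (p xor q) ≟ᵇ p xor r) →-dec (d ≟ᵇ (q xor r))} _

  -- As long as `x` differs from `u`, its degree in `M` is odd, hence positive, and the walk can go
  -- on; removing the edge moves the odd vertex along. The walk can therefore stop only at `u`.
  close : ∀ M x u → EvenExcept M x u → Acc _<_ (size M) →
          Σ (Walk G x u) λ W → ∃ λ R → M ∣ W ▷ R × Even R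
  close M x u ev (acc rs) with x ≟ u
  ... | yes refl = nil {u = x} , M , run (λ _ → refl) , λ v → trans (ev v) (xor-same (x == v))
  ... | no x≢u with pick M x (odd⇒pos (trans (ev x) (cong₂ _xor_ (==-refl x) (≢⇒== (x≢u ∘ sym)))))
    where
    odd⇒pos : ∀ {k} → odd k ≡ true → 0 < k
    odd⇒pos {suc k} _ = s≤s z≤n
  ... | e , y , me , l , _ with close (M ∖ e) y u (even-∖ {M} {u = u} me l ev) (rs (≤-reflexive (sym (size-∖ M e me))))
  ...   | W , R , r , even = cons e (link⇒joins l) W , R , ∣▷-cons {M} (link⇒joins l) me r , even

  closed-trail-through : ∀ M {e u x} → Even M → M e ≡ true → Link e u x →
    Σ (Walk G u u) λ W → ∃ λ R → M ∣ W ▷ R × Even R × 1 ≤ visits W u × 1 ≤ sum (uses W)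
  closed-trail-through M {e} {u} {x} ev me l
    with close (M ∖ e) x u (even-∖ {M} {e} {u} {x} {u} me l (λ v → trans (ev v) (sym (xor-same (u == v))))) (<-wellFounded _)
  ... | W , R , r , even = cons e (link⇒joins l) W , R , ∣▷-cons {M} (link⇒joins l) me r , even ,
        ≤-trans (≤-reflexive (cong 𝟙 (sym (==-refl u)))) (m≤m+n _ _) ,
        ≤-trans (≤-trans (≤-reflexive (cong 𝟙 (sym (==-refl e)))) (m≤m+n _ _)) (sum-≥ (uses (cons e (link⇒joins l) W)) e)

  split : ∀ {s t} (W : Walk G s t) u → 0 < visits W u → Σ (Walk G s u) λ W₁ → Σ (Walk G u t) λ W₂ →
    (∀ f → uses W f ≡ uses W₁ f + uses W₂ f) × (∀ v → visits W v ≡ visits W₁ v + visits W₂ v)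
  split {s} (cons e j W) u h with s ≟ u
  ... | yes refl = nil , cons e j W , (λ _ → refl) , (λ _ → refl)
  ... | no _ with split W u h
  ...   | W₁ , W₂ , p , q = cons e j W₁ , W₂ ,
          (λ f → trans (cong (𝟙 (e == f) +_) (p f)) (sym (+-assoc (𝟙 (e == f)) _ _))) ,
          (λ v → trans (cong (𝟙 (s == v) +_) (q v)) (sym (+-assoc (𝟙 (s == v)) _ _)))

  positive : ℕ → Bool
  positive zero = false
  positive (suc _) = true

  positive-true : ∀ {k} → positive k ≡ true → 0 < k
  positive-true {suc k} _ = s≤s z≤n

  positive-intro : ∀ {k} → 0 < k → positive k ≡ true
  positive-intro {suc k} _ = refl

  positive-false : ∀ {k} → positive k ≡ false → k ≡ 0
  positive-false {zero} _ = refl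

  module _ {M : Mask (m G)} (conn : Connects M full) where

    -- Hierholzer's splicing. If a vertex is missed, some edge of `M` joins a visited vertex `u` to
    -- an unvisited one and is still in `R`; a closed trail of `R` through it is inserted at `u`.
    -- This shrinks `R`, and the process stops once every vertex is visited.
    absorb : ∀ {s} (W : Walk G s s) R → M ∣ W ▷ R → Even R → 1 ≤ visits W s → Acc _<_ (size R) →
             Σ (Walk G s s) λ W′ → ∃ λ R′ → M ∣ W′ ▷ R′ × (∀ v → 1 ≤ visits W′ v)
    absorb {s} W R r even vs (acc rs) with all-or-missing (positive ∘ visits W)
    ... | inj₁ all = W , R , r , λ v → positive-true (all v)
    ... | inj₂ (v , missing) with conn (positive ∘ visits W) {s} {v} refl (positive-intro vs) refl missing
    ...   | e , me , _ , c with crosses-link {positive ∘ visits W} e c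
    ...     | u , x , l , pu , px with closed-trail-through R even re l
      where
      -- A use of `e` would count towards the degree of `W` at its end `x`, but that degree is zero
      -- since `x` is not visited.
      unused : uses W e ≡ 0
      unused = n≤0⇒n≡0 (begin
        uses W e ≡⟨ *-identityʳ (uses W e) ⟨
        uses W e * 1 ≡⟨ cong (uses W e *_) (link-inc-end (swap l)) ⟨
        uses W e * inc e x ≤⟨ sum-≥ (λ f → uses W f * inc f x) e ⟩
        sum (λ f → uses W f * inc f x) ≡⟨ closed-degree W x ⟩
        2 * visits W x ≡⟨ cong (2 *_) (positive-false px) ⟩
        0 ∎)
        where open ≤-Reasoning
      𝟙-inj : ∀ {p q} → 𝟙 p ≡ 𝟙 q → p ≡ q
      𝟙-inj {true} {true} _ = refl
      𝟙-inj {false} {false} _ = refl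
      re : R e ≡ true
      re = trans (𝟙-inj (trans (cong (_+ 𝟙 (R e)) (sym unused)) (consumes r e))) me
    ...       | Z , R′ , z , even′ , _ , zpos with split W u (positive-true pu)
    ...         | W₁ , W₂ , p , q = absorb (W₁ ++ (Z ++ W₂)) R′ (run consume) even′ vs′
                  (rs (≤-trans (+-monoˡ-≤ (size R′) zpos) (≤-reflexive (sym (consume-size z)))))
      where
      open ≡-Reasoning
      shuffle : ∀ x y z t → x + (y + z) + t ≡ x + z + (y + t)
      shuffle = solve-∀
      consume : ∀ f → uses (W₁ ++ (Z ++ W₂)) f + 𝟙 (R′ f) ≡ 𝟙 (M f)
      consume f = begin
        uses (W₁ ++ (Z ++ W₂)) f + 𝟙 (R′ f)
          ≡⟨ cong (_+ 𝟙 (R′ f)) (trans (uses-++ W₁ (Z ++ W₂) f) (cong (uses W₁ f +_) (uses-++ Z W₂ f))) ⟩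
        uses W₁ f + (uses Z f + uses W₂ f) + 𝟙 (R′ f)
          ≡⟨ shuffle (uses W₁ f) (uses Z f) (uses W₂ f) (𝟙 (R′ f)) ⟩
        uses W₁ f + uses W₂ f + (uses Z f + 𝟙 (R′ f))
          ≡⟨ cong₂ _+_ (sym (p f)) (consumes z f) ⟩
        uses W f + 𝟙 (R f)
          ≡⟨ consumes r f ⟩
        𝟙 (M f) ∎
      vs′ : 1 ≤ visits (W₁ ++ (Z ++ W₂)) s
      vs′ = ≤-trans (subst (1 ≤_) (q s) vs) (≤-trans (+-monoʳ-≤ (visits W₁ s)
        (≤-trans (m≤n+m _ (visits Z s)) (≤-reflexive (sym (visits-++ Z W₂ s))))) (≤-reflexive (sym (visits-++ W₁ (Z ++ W₂) s))))

  times≡visits : ∀ {u w} (W : Walk G u w) v → length (filter (_≟ v) (verts W)) ≡ visits W v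
  times≡visits nil v = refl
  times≡visits {u} (cons e j W) v with u ≟ v
  ... | yes _ = cong suc (times≡visits W v)
  ... | no _  = times≡visits W v

  visits⇒∈ : ∀ {u w} (W : Walk G u w) v → 1 ≤ visits W v → v ∈ verts W
  visits⇒∈ {u} (cons e j W) v h with u ≟ v
  ... | yes refl = here refl
  ... | no _     = there (visits⇒∈ W v h)

  trail : ∀ {u w} (W : Walk G u w) → (∀ f → uses W f ≤ 1) → IsTrail W
  trail nil h = []
  trail (cons e j W) h = unused W (subst (λ p → 𝟙 p + uses W e ≤ 1) (==-refl e) (h e)) ∷
                         trail W (λ f → ≤-trans (m≤n+m _ (𝟙 (e == f))) (h f))
    where
    unused : ∀ {u w} (V : Walk G u w) → 1 + uses V e ≤ 1 → All (e ≢_) (edges V)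
    unused nil h = []
    unused (cons f j V) h = (λ { refl → <⇒≱ (s≤s z≤n)
        (≤-trans (≤-trans (≤-reflexive (cong 𝟙 (sym (==-refl f)))) (m≤m+n _ _)) (s≤s⁻¹ h)) }) ∷
      unused V (s≤s (≤-trans (m≤n+m _ (𝟙 (f == e))) (s≤s⁻¹ h)))

  spanning-closed-trail : 1 < n G → ∀ M → Eulerian _ _ (loopless G) M → (f : Fin (n G) → ℕ) →
    (∀ v → deg M v ≤ 2 * f v) →
    Σ (Fin (n G)) λ s → Σ (Walk G s s) λ W → IsTrail W × Spanning W × (∀ v → times W v ≤ f v)
  spanning-closed-trail 1<n M eul f bound = s , finish (initial (two (n G) 1<n))
    where
    open Eulerian eul
    two : ∀ k → 1 < k → Σ (Fin k) λ s → Σ (Fin k) λ t → s ≢ t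
    two (suc (suc k)) _ = zero , suc zero , λ ()
    two (suc zero) (s≤s ())
    s = proj₁ (two (n G) 1<n)
    initial : (Σ (Fin (n G)) λ s → Σ (Fin (n G)) λ t → s ≢ t) → Σ (Walk G s s) λ W → ∃ λ R → M ∣ W ▷ R × (∀ v → 1 ≤ visits W v)
    initial _ with connects ⁅ s ⁆ {s} {proj₁ (proj₂ (two (n G) 1<n))} refl (==-refl s) refl (≢⇒== (proj₂ (proj₂ (two (n G) 1<n))))
    ... | e , me , _ , c with crosses-link {⁅ s ⁆} e c
    ...   | u , x , l , pu , _ with ==⇒≡ {x = s} pu
    ...     | refl with closed-trail-through M even me l
    ...       | W , R , r , even′ , vs , _ = absorb connects W R r even′ vs (<-wellFounded _)
    finish : (Σ (Walk G s s) λ W → ∃ λ R → M ∣ W ▷ R × (∀ v → 1 ≤ visits W v)) →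
             Σ (Walk G s s) λ W → IsTrail W × Spanning W × (∀ v → times W v ≤ f v)
    -- The trivial walk passes its vertex once but has no departure, so `vs` excludes it; on the
    -- remaining walks `times` and `visits` agree.
    finish (nil , R , r , vs) = ⊥-elim (<⇒≱ (vs s) z≤n)
    finish (W@(cons _ _ _) , R , r , vs) = W ,
      trail W (λ f → ≤-trans (m≤m+n _ (𝟙 (R f))) (≤-trans (≤-reflexive (consumes r f)) (𝟙-≤ (M f)))) ,
      (λ v → visits⇒∈ W v (vs v)) ,
      (λ v → subst (_≤ f v) (sym (times≡visits W v)) (*-cancelˡ-≤ 2 (begin
        2 * visits W v ≡⟨ closed-degree W v ⟨
        sum (λ e → uses W e * inc e v) ≤⟨ sum-mono
            (λ e → *-monoˡ-≤ (inc e v) (≤-trans (m≤m+n _ (𝟙 (R e))) (≤-reflexive (consumes r e)))) ⟩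
        deg M v ≤⟨ bound v ⟩
        2 * f v ∎)))
      where
      open ≤-Reasoning
      𝟙-≤ : ∀ p → 𝟙 p ≤ 1
      𝟙-≤ true = ≤-refl
      𝟙-≤ false = z≤n

-- The exchange argument

_⊆_ : ∀ {n} → Mask n → Mask n → Set
Y ⊆ Z = ∀ v → Y v ≡ true → Z v ≡ true

Disjoint : ∀ {n} → Mask n → Mask n → Set
Disjoint Y Z = ∀ v → Y v ≡ true → Z v ≡ false

module Exchange {n m : ℕ} (a b : Fin m → Fin n) (loopless : ∀ e → a e ≢ b e) where
  open Multigraph a b
  open Loopless loopless

  Agree : Mask n → Mask m → Mask m → Set
  Agree Z H K = ∀ e → within Z e ≡ false → H e ≡ K e

  inside-agree : ∀ Z W H K → Z ⊆ W → Agree Z H K → inside H Z ≡ inside K Z → inside H W ≡ inside K W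
  inside-agree Z W H K Z⊆W agree same = begin
    inside H W ≡⟨ divide H ⟩
    inside H Z + size (λ e → H e ∧ (within W e ∧ not (within Z e))) ≡⟨ cong₂ _+_ same (sum-cong-≗ (λ e → cong 𝟙 (outer e))) ⟩
    inside K Z + size (λ e → K e ∧ (within W e ∧ not (within Z e))) ≡⟨ divide K ⟨
    inside K W ∎
    where
    open ≡-Reasoning
    outer : ∀ e → H e ∧ (within W e ∧ not (within Z e)) ≡ K e ∧ (within W e ∧ not (within Z e))
    outer e with within Z e in z
    ... | false = cong (_∧ (within W e ∧ true)) (agree e z)
    ... | true rewrite ∧-zeroʳ (within W e) | ∧-zeroʳ (H e) | ∧-zeroʳ (K e) = refl
    divide : ∀ F → inside F W ≡ inside F Z + size (λ e → F e ∧ (within W e ∧ not (within Z e)))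
    divide F = trans (sum-cong-≗ (λ e → pt (F e) (within W e) (within Z e) (within-⊆ {Z} {W} Z⊆W e)))
        (∑-distrib-+ (𝟙 ∘ (F ∩ within Z)) _)
      where
      pt : ∀ f w z → (z ≡ true → w ≡ true) → 𝟙 (f ∧ w) ≡ 𝟙 (f ∧ z) + 𝟙 (f ∧ (w ∧ not z))
      pt f w true h rewrite h refl = sym (trans (cong (𝟙 (f ∧ true) +_) (cong 𝟙 (∧-zeroʳ f))) (+-identityʳ _))
      pt f w false h rewrite ∧-zeroʳ f | ∧-identityʳ w = refl

  inside-⊕ : ∀ H e Y → H e ≡ false → inside (H ⊕ e) Y ≡ inside H Y + 𝟙 (within Y e)
  inside-⊕ H e Y he = trans (sum-cong-≗ (λ f → 𝟙-∧ ((H ⊕ e) f) (within Y f)))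
    (trans (sum-⊕ H e (λ f → 𝟙 (within Y f)) he) (cong (_+ 𝟙 (within Y e)) (sum-cong-≗ (λ f → sym (𝟙-∧ (H f) (within Y f))))))

  inside-∖ᵉ : ∀ H e Y → H e ≡ true → inside H Y ≡ inside (H ∖ e) Y + 𝟙 (within Y e)
  inside-∖ᵉ H e Y he = trans (sum-cong-≗ (λ f → 𝟙-∧ (H f) (within Y f)))
    (trans (sum-∖ H e (λ f → 𝟙 (within Y f)) he)
        (cong (_+ 𝟙 (within Y e)) (sum-cong-≗ (λ f → sym (𝟙-∧ ((H ∖ e) f) (within Y f))))))

  deg-⊕ : ∀ H e v → H e ≡ false → deg (H ⊕ e) v ≡ deg H v + inc e v
  deg-⊕ H e v = sum-⊕ H e (λ e → inc e v)

  deg-cong : ∀ H K v → (∀ {e u} → Link e v u → H e ≡ K e) → deg H v ≡ deg K v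
  deg-cong H K v h = sum-cong-≗ pt
    where
    pt : ∀ e → 𝟙 (H e) * inc e v ≡ 𝟙 (K e) * inc e v
    pt e with inc e v in i
    ... | zero  = trans (*-zeroʳ (𝟙 (H e))) (sym (*-zeroʳ (𝟙 (K e))))
    ... | suc k = cong (λ x → 𝟙 x * suc k) (h (proj₂ (incident {e} {v} (≤-trans (s≤s z≤n) (≤-reflexive (sym i))))))

  -- Inside a tight set `Z` of `L` the edges may be exchanged for equally many edges of `K`. A set
  -- `Y` meeting `Z` is uncrossed with `Z`: `K` bounds the intersection, `L` bounds the union, whose
  -- count has not changed, and the tightness of `Z` cancels. A set disjoint from `Z` only sees `L`.
  sparse-replace : ∀ Z H K L → Sparse K → Sparse L → Tight L Z → Agree Z H L →
                   (∀ e → within Z e ≡ true → H e ≡ K e) → inside K Z ≡ inside L Z → Sparse H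
  sparse-replace Z H K L spK spL (_ , tZ) off on same Y (y , yy) with size (Y ∩ Z) in sYZ
  ... | zero = subst (λ k → k + 2 ≤ 2 * size Y)
                (inside-cong {L} {H} {Y} (λ e w → sym (off e (¬true⇒false (apart e w))))) (spL Y (y , yy))
    where
    apart : ∀ e → within Y e ≡ true → ¬ within Z e ≡ true
    apart e w z = <⇒≱ (s≤s z≤n) (≤-trans
        (size-pos (Y ∩ Z) (∧-intro (proj₁ (∧-split {Y (a e)} w)) (proj₁ (∧-split {Z (a e)} z)))) (≤-reflexive sYZ))
  ... | suc _ = linear 0 (+-mono-≤ (+-mono-≤ (+-mono-≤ (+-mono-≤ (inside-supermodular H Y Z) t′) i∪) i∩)
                   (≤-reflexive (cong (2 *_) (sym (size-modular Y Z)))))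
                   (count (size Y) (size Z) (size (Y ∪ Z)) (size (Y ∩ Z)) (inside H Y) (inside H Z) (inside H (Y ∪ Z))
                       (inside H (Y ∩ Z)))
    where
    HZ : inside H Z ≡ inside L Z
    HZ = trans (inside-cong {H} {K} {Z} on) same
    t′ : 2 * size Z ≤ inside H Z + 2
    t′ = subst (λ k → 2 * size Z ≤ k + 2) (sym HZ) tZ
    i∪ : inside H (Y ∪ Z) + 2 ≤ 2 * size (Y ∪ Z)
    i∪ = subst (λ k → k + 2 ≤ 2 * size (Y ∪ Z)) (sym (inside-agree Z (Y ∪ Z) H L (λ v → ∨-introʳ {Y v}) off HZ))
           (spL (Y ∪ Z) (y , ∨-introˡ yy))
    i∩ : inside H (Y ∩ Z) + 2 ≤ 2 * size (Y ∩ Z)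
    i∩ = subst (λ k → k + 2 ≤ 2 * size (Y ∩ Z))
           (sym (inside-cong {H} {K} {Y ∩ Z} (λ e w → on e (within-⊆ {Y ∩ Z} {Z} (λ v p → proj₂ (∧-split {Y v} p)) e w))))
           (spK (Y ∩ Z) (size-inhabited (Y ∩ Z) (≤-trans (s≤s z≤n) (≤-reflexive (sym sYZ)))))
    count : ∀ sY sZ s∪ s∩ iY iZ i∪ i∩ →
      (i∪ + i∩) + (iZ + 2) + 2 * s∪ + 2 * s∩ + 2 * (sY + sZ) + (iY + 2) + 0 ≡
      (iY + iZ) + 2 * sZ + (i∪ + 2) + (i∩ + 2) + 2 * (s∪ + s∩) + 2 * sY
    count = solve-∀

  module Bounded (A : Mask m) (h : Fin n → ℕ) where

    record Feasible (H : Mask m) : Set where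
      field
        allowed : ∀ e → H e ≡ true → A e ≡ true
        sparse  : Sparse H
        bounded : ∀ v → deg H v ≤ h v
    open Feasible

    -- deg v can be brought below h v by an exchange inside a tight set that avoids S.
    record Reducible (H : Mask m) (S : Mask n) (v : Fin n) : Set where
      field
        Z        : Mask n
        contains : Z v ≡ true
        avoids   : Disjoint Z S
        tight    : Tight H Z
        H′       : Mask m
        feasible : Feasible H′
        agree    : Agree Z H′ H
        same     : inside H′ Z ≡ inside H Z
        slack    : deg H′ v < h v
    open Reducible

    Related : Mask m → Mask n → Fin n → Fin n → Set
    Related H S x y = ∃ λ Z → Tight H Z × Disjoint Z S × Z x ≡ true × Z y ≡ true

    Closed : Mask m → Mask n → Set
    Closed H S = ∀ {e x y} → A e ≡ true → H e ≡ false → Link e x y →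
                 Reducible H S x → Reducible H S y → ¬ ¬ Related H S x y

    module _ (H : Mask m) (fH : Feasible H) where

      module Simultaneous {S S′ e x y} (ae : A e ≡ true) (he : H e ≡ false) (l : Link e x y)
                          (S⊆S′ : S ⊆ S′) (rx : Reducible H S′ x) (ry : Reducible H S′ y)
                          (apart : Disjoint (Z rx) (Z ry)) where
        Zx = Z rx
        Zy = Z ry
        H₁ = H′ rx

        H″ : Mask m
        H″ f = if within Zy f then H′ ry f else H₁ f

        on-Zy : ∀ f → within Zy f ≡ true → H″ f ≡ H′ ry f
        on-Zy f w rewrite w = refl

        off-Zy : Agree Zy H″ H₁
        off-Zy f w rewrite w = refl

        Zy⇒¬Zx : ∀ f → within Zy f ≡ true → within Zx f ≡ false
        Zy⇒¬Zx f w = ¬true⇒false λ w′ → true≢false (proj₁ (∧-split {Zy (a f)} w)) (apart (a f) (proj₁ (∧-split {Zx (a f)} w′)))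

        H₁-Zy : inside H₁ Zy ≡ inside H Zy
        H₁-Zy = inside-cong {H₁} {H} {Zy} (λ f w → agree rx f (Zy⇒¬Zx f w))

        H″-Zy : inside H″ Zy ≡ inside H₁ Zy
        H″-Zy = trans (inside-cong {H″} {H′ ry} {Zy} on-Zy) (trans (same ry) (sym H₁-Zy))

        H″≡H : ∀ f → within Zx f ≡ false → within Zy f ≡ false → H″ f ≡ H f
        H″≡H f p q = trans (off-Zy f q) (agree rx f p)

        sparse″ : Sparse H″
        sparse″ = sparse-replace Zy H″ (H′ ry) H₁ (sparse (feasible ry)) (sparse (feasible rx))
          (proj₁ (tight ry) , subst (λ k → 2 * size Zy ≤ k + 2) (sym H₁-Zy) (proj₂ (tight ry)))
          off-Zy on-Zy (trans (same ry) (sym H₁-Zy))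

        deg-Zy : ∀ v → Zy v ≡ true → deg H″ v ≡ deg (H′ ry) v
        deg-Zy v zv = deg-cong H″ (H′ ry) v pt
          where
          pt : ∀ {f u} → Link f v u → H″ f ≡ H′ ry f
          pt {f} {u} lk with within Zy f in w
          ... | true = refl
          ... | false = trans (agree rx f (¬true⇒false λ w′ →
                  true≢false zv (apart v (proj₁ (within-link {Zx} lk w′))))) (sym (agree ry f w))

        deg-off : ∀ v → Zy v ≡ false → deg H″ v ≡ deg H₁ v
        deg-off v zv = deg-cong H″ H₁ v (λ {f} lk → off-Zy f (¬true⇒false λ w → true≢false (proj₁ (within-link {Zy} lk w)) zv))

        feasible″ : Feasible H″
        feasible″ = record { allowed = all ; sparse = sparse″ ; bounded = bnd }
          where
          all : ∀ f → H″ f ≡ true → A f ≡ true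
          all f p with within Zy f
          ... | true  = allowed (feasible ry) f p
          ... | false = allowed (feasible rx) f p
          bnd : ∀ v → deg H″ v ≤ h v
          bnd v with Zy v in zv
          ... | true  = subst (_≤ h v) (sym (deg-Zy v zv)) (bounded (feasible ry) v)
          ... | false = subst (_≤ h v) (sym (deg-off v zv)) (bounded (feasible rx) v)

        slack-x : deg H″ x < h x
        slack-x = subst (_< h x) (sym (deg-off x (apart x (contains rx)))) (slack rx)

        slack-y : deg H″ y < h y
        slack-y = subst (_< h y) (sym (deg-Zy y (contains ry))) (slack ry)

        x≢y : x ≢ y
        x≢y = link-≢ l

        e∉ : H″ e ≡ false
        e∉ = trans (H″≡H e
          (¬true⇒false λ w → true≢false (contains ry) (apart y (proj₂ (within-link {Zx} l w))))
          (¬true⇒false λ w → true≢false (proj₁ (within-link {Zy} l w)) (apart x (contains rx)))) he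

        inside″ : ∀ W → Zx ⊆ W → Zy ⊆ W → inside H″ W ≡ inside H W
        inside″ W p q = trans (inside-agree Zy W H″ H₁ q off-Zy H″-Zy) (inside-agree Zx W H₁ H p (agree rx) (same rx))

        tight-Zy : Tight H″ Zy
        tight-Zy = proj₁ (tight ry) , subst (λ k → 2 * size Zy ≤ k + 2) (sym (trans H″-Zy H₁-Zy)) (proj₂ (tight ry))

        tight-Zx : Tight H″ Zx
        tight-Zx = proj₁ (tight rx) , subst (λ k → 2 * size Zx ≤ k + 2) (sym eq) (proj₂ (tight rx))
          where
          eq : inside H″ Zx ≡ inside H Zx
          eq = trans (inside-cong {H″} {H₁} {Zx} (λ f w → off-Zy f (¬true⇒false λ w′ → true≢false w (Zy⇒¬Zx f w′)))) (same rx)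

        -- A set containing `Zx` and `Zy` has equally many edges of `H″` and of `H`, so enlarging
        -- `Q` in this way transports tightness between the two edge sets.
        hull : Mask n → Fin n → Bool
        hull Q = Q ∪ Zx ∪ Zy

        hull-Zx : ∀ Q → Zx ⊆ hull Q
        hull-Zx Q v z = ∨-introˡ (∨-introʳ {Q v} z)

        hull-Zy : ∀ Q → Zy ⊆ hull Q
        hull-Zy Q v z = ∨-introʳ {(Q ∪ Zx) v} z

        hull-⊇ : ∀ Q → Q ⊆ hull Q
        hull-⊇ Q v q = ∨-introˡ (∨-introˡ q)

        hull-avoids : ∀ Q {T} → Disjoint Q T → T ⊆ S′ → Disjoint (hull Q) T
        hull-avoids Q {T} d T⊆ v p with ∨-split {(Q ∪ Zx) v} p
        ... | inj₂ zy = ¬true⇒false λ t → true≢false (T⊆ v t) (avoids ry v zy)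
        ... | inj₁ p′ with ∨-split {Q v} p′
        ...   | inj₁ q  = d v q
        ...   | inj₂ zx = ¬true⇒false λ t → true≢false (T⊆ v t) (avoids rx v zx)

        hull-tight″ : ∀ Q → Tight H″ Q → Q x ≡ true → Q y ≡ true → Tight H″ (hull Q)
        hull-tight″ Q tQ qx qy = tight-∪ {H″} {Q ∪ Zx} {Zy} sparse″
            (tight-∪ {H″} {Q} {Zx} sparse″ tQ tight-Zx qx (contains rx)) tight-Zy
          (∨-introˡ qy) (contains ry)

        hull-tight : ∀ Q → Tight H″ Q → Q x ≡ true → Q y ≡ true → Tight H (hull Q)
        hull-tight Q tQ qx qy = let ne , t = hull-tight″ Q tQ qx qy in
          ne , subst (λ k → 2 * size (hull Q) ≤ k + 2) (inside″ (hull Q) (hull-Zx Q) (hull-Zy Q)) t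

        relate : ∀ Q {T} → Tight H″ Q → Q x ≡ true → Q y ≡ true → Disjoint Q T → T ⊆ S′ → Related H T x y
        relate Q tQ qx qy d T⊆ = hull Q , hull-tight Q tQ qx qy , hull-avoids Q d T⊆ , hull-⊇ Q x qx , hull-⊇ Q y qy

        H⁺ = H″ ⊕ e

        degree⁺ : ∀ v → deg H⁺ v ≤ h v
        degree⁺ v rewrite deg-⊕ H″ e v e∉ | link-inc l v with x ≟ v | y ≟ v
        ... | yes refl | yes q    = ⊥-elim (x≢y (sym q))
        ... | yes refl | no _     = subst (_≤ h x) (+-comm 1 _) slack-x
        ... | no _     | yes refl = subst (_≤ h y) (+-comm 1 _) slack-y
        ... | no _     | no _     = subst (_≤ h v) (sym (+-identityʳ _)) (bounded feasible″ v)

        allowed⁺ : ∀ f → H⁺ f ≡ true → A f ≡ true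
        allowed⁺ f p = [ allowed feasible″ f , (λ { refl → ae }) ]′ (⊕-split H″ e f p)

        -- Either e can be added, which maximality forbids, or e closes a circuit.
        circuit : (∀ K → Feasible K → size K ≤ size H) → ¬ ¬ (∃ λ Q → Tight H″ Q × Q x ≡ true × Q y ≡ true)
        circuit largest none = <⇒≱ (≤-reflexive size⁺)
            (largest H⁺ (record { allowed = allowed⁺ ; sparse = sparse⁺ ; bounded = degree⁺ }))
          where
          total : ∀ K → inside K full ≡ size K
          total K = sum-cong-≗ (λ f → cong 𝟙 (∧-identityʳ (K f)))
          size⁺ : suc (size H) ≡ size H⁺
          size⁺ = sym (trans (size-⊕ H″ e e∉)
              (cong suc (trans (sym (total H″)) (trans (inside″ full (λ _ _ → refl) (λ _ _ → refl)) (total H)))))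
          sparse⁺ : Sparse H⁺
          sparse⁺ Y ne rewrite inside-⊕ H″ e Y e∉ with within Y e in w
          ... | false = subst (λ k → k + 2 ≤ 2 * size Y) (sym (+-identityʳ (inside H″ Y))) (sparse″ Y ne)
          ... | true  = ≮⇒≥ λ lt → none (Y ,
              (ne , s≤s⁻¹ (subst (2 * size Y <_) (cong (_+ 2) (+-comm (inside H″ Y) 1)) lt)) , within-link {Y} l w)

      overlapping : ∀ {S x y w} (rx : Reducible H S x) (ry : Reducible H S y) → Z rx w ≡ true → Z ry w ≡ true → Related H S x y
      overlapping {S} {x} {y} rx ry zx zy = Z rx ∪ Z ry ,
        tight-∪ {H} {Z rx} {Z ry} (sparse fH) (tight rx) (tight ry) zx zy ,
        (λ v p → [ avoids rx v , avoids ry v ]′ (∨-split {Z rx v} p)) ,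
        ∨-introˡ (contains rx) , ∨-introʳ {Z rx y} (contains ry)

      closed-∅ : (∀ K → Feasible K → size K ≤ size H) → Closed H ∅
      closed-∅ largest {e} {x} {y} ae he l rx ry = do
        (inj₂ none) ← em {A = ∃ λ w → Z rx w ≡ true × Z ry w ≡ true}
          where (inj₁ (w , zx , zy)) → return (overlapping rx ry zx zy)
        let module M = Simultaneous {∅} {∅} ae he l (λ _ p → p) rx ry (λ v zx → ¬true⇒false λ zy → none (v , zx , zy))
        (Q , tQ , qx , qy) ← M.circuit largest
        return (M.relate Q {∅} tQ qx qy (λ _ _ → refl) (λ _ p → p))

      -- The old invariant confines the circuit of `e` to a tight set `W` avoiding `S`. If the
      -- smallest tight set `Q` around `e` contained some `v` of `S′`, then trading an edge of `Q`
      -- at `v` for `e` would be an exchange inside `W` that lowers `v`, contrary to the choice of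
      -- `S′`. So `Q` avoids `S′`, and its hull relates the ends of `e`.
      closed-step : ∀ {S S′} → S ⊆ S′ → (∀ v → S′ v ≡ true → ¬ Reducible H S v) → Closed H S → Closed H S′
      closed-step {S} {S′} S⊆S′ irreducible closed {e} {x} {y} ae he l rx ry = do
        (inj₂ none) ← em {A = ∃ λ w → Z rx w ≡ true × Z ry w ≡ true}
          where (inj₁ (w , zx , zy)) → return (overlapping rx ry zx zy)
        (Z₀ , t₀ , d₀ , z₀x , z₀y) ← closed ae he l (coarsen rx) (coarsen ry)
        exchange (λ v zx → ¬true⇒false λ zy → none (v , zx , zy)) Z₀ t₀ d₀ z₀x z₀y
        where
        coarsen : ∀ {v} → Reducible H S′ v → Reducible H S v
        coarsen r = record { Reducible r ; avoids = λ v z → ¬true⇒false λ s → true≢false (S⊆S′ v s) (avoids r v z) }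

        exchange : Disjoint (Z rx) (Z ry) → ∀ Z₀ → Tight H Z₀ → Disjoint Z₀ S → Z₀ x ≡ true → Z₀ y ≡ true → ¬ ¬ Related H S′ x y
        exchange apart Z₀ t₀ d₀ z₀x z₀y = do
          -- `W` shows that there is a candidate. By uncrossing, a smallest one is contained in
          -- every set tight for `H″` that contains both ends of `e`, as in the fundamental circuit
          -- of `e`.
          (Q , (tQ , qx , qy , Q⊆W) , least) ← minimal (λ Q → Tight H″ Q × Q x ≡ true × Q y ≡ true × Q ⊆ W) size
                                                 W (tight-W , hull-⊇ Z₀ x z₀x , hull-⊇ Z₀ y z₀y , λ _ p → p)
          (inj₁ (v , qv , s′v)) ← em {A = ∃ λ v → Q v ≡ true × S′ v ≡ true}
            where (inj₂ none) → return (relate Q tQ qx qy (λ v qv → ¬true⇒false λ s → none (v , qv , s)) (λ _ p → p))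
          λ _ → irreducible v s′v (reduce Q tQ qx qy Q⊆W least v qv s′v)
          where
          open Simultaneous {S} {S′} ae he l S⊆S′ rx ry apart
          W = hull Z₀
          W-tight : Tight H W
          W-tight = tight-∪ {H} {Z₀ ∪ Zx} {Zy} (sparse fH)
              (tight-∪ {H} {Z₀} {Zx} (sparse fH) t₀ (tight rx) z₀x (contains rx)) (tight ry)
                      (∨-introˡ z₀y) (contains ry)
          tight-W : Tight H″ W
          tight-W = proj₁ W-tight , subst (λ k → 2 * size W ≤ k + 2) (sym (inside″ W (hull-Zx Z₀) (hull-Zy Z₀))) (proj₂ W-tight)

          reduce : ∀ Q → Tight H″ Q → Q x ≡ true → Q y ≡ true → Q ⊆ W →
                   (∀ Y → (Tight H″ Y × Y x ≡ true × Y y ≡ true × Y ⊆ W) → size Q ≤ size Y) →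
                   ∀ v → Q v ≡ true → S′ v ≡ true → Reducible H S v
          reduce Q tQ qx qy Q⊆W least v qv s′v with pick (H″ ∩ within Q) v
              (≤-trans (s≤s z≤n) (tight-deg H″ Q sparse″ tQ qv qx v≢x))
            where
            v≢x : v ≢ x
            v≢x refl = true≢false s′v (avoids rx v (contains rx))
          ... | e′ , u′ , p′ , l′ , _ = record
            { Z = W ; contains = Q⊆W v qv ; avoids = hull-avoids Z₀ d₀ S⊆S′ ; tight = W-tight
            ; H′ = H* ; feasible = record
                { allowed = λ f p → allowed⁺ f (∖-⊆ H⁺ e′ f p)
                ; sparse  = sparse*
                ; bounded = λ w → ≤-trans (≤-trans (m≤m+n (deg H* w) (inc e′ w))
                    (≤-reflexive (sym (deg-∖ H⁺ e′ w e′∈⁺)))) (degree⁺ w) }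
            ; agree = agree* ; same = same* ; slack = slack* }
            where
            h″e′ : H″ e′ ≡ true
            h″e′ = proj₁ (∧-split {H″ e′} p′)
            we′ : within Q e′ ≡ true
            we′ = proj₂ (∧-split {H″ e′} p′)
            H* = H⁺ ∖ e′
            e′∈⁺ : H⁺ e′ ≡ true
            e′∈⁺ = ⊕-⊇ H″ e e′ h″e′
            swap-inside : ∀ Y → inside H* Y + 𝟙 (within Y e′) ≡ inside H″ Y + 𝟙 (within Y e)
            swap-inside Y = trans (sym (inside-∖ᵉ H⁺ e′ Y e′∈⁺)) (inside-⊕ H″ e Y e∉)
            Q⊆ : ∀ Y → size Q ≤ size (Y ∩ Q) → Q ⊆ Y
            Q⊆ Y le w qw with Y w in yw
            ... | true = refl
            ... | false = ⊥-elim (<⇒≱ (≤-reflexive (sym (size-∖ Q w qw))) (≤-trans le (size-⊆ {Y = Y ∩ Q} {Q ∖ w}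
                    λ z p → ∖-∈ Q w (proj₂ (∧-split {Y z} p)) λ { refl → true≢false (proj₁ (∧-split {Y w} p)) yw })))
            -- Only a set `Y` containing `e` but not `e′` gains an edge. If it then had too many, it
            -- was tight for `H″`, so by minimality it contains `Q` and with it `e′`.
            sparse* : Sparse H*
            sparse* Y ne with within Y e in we | within Y e′ in we″ | swap-inside Y
            ... | false | _    | eq = ≤-trans
                (+-monoˡ-≤ 2 (≤-trans (m≤m+n (inside H* Y) _) (≤-reflexive (trans eq (+-identityʳ _))))) (sparse″ Y ne)
            ... | true | true  | eq = subst (λ k → k + 2 ≤ 2 * size Y) (sym (+-cancelʳ-≡ 1 _ _ eq)) (sparse″ Y ne)
            ... | true | false | eq = ≮⇒≥ λ lt → true≢false
                (within-⊆ {Q} {Y} (Q⊆ Y (least (Y ∩ Q) (small (ne , tightY lt)))) e′ we′) we″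
              where
              tightY : 2 * size Y < inside H* Y + 2 → 2 * size Y ≤ inside H″ Y + 2
              tightY lt = s≤s⁻¹ (≤-trans lt (≤-reflexive
                  (trans (cong (_+ 2) (trans (sym (+-identityʳ _)) (trans eq (+-comm _ 1)))) refl)))
              small : Tight H″ Y → Tight H″ (Y ∩ Q) × (Y ∩ Q) x ≡ true × (Y ∩ Q) y ≡ true × (Y ∩ Q) ⊆ W
              small tY = let yx , yy = within-link {Y} l we in
                proj₂ (tight-∪∩ {H″} {Y} {Q} sparse″ tY tQ yx qx) , ∧-intro yx qx , ∧-intro yy qy ,
                λ w p → Q⊆W w (proj₂ (∧-split {Y w} p))
            agree* : Agree W H* H
            agree* f wf with e′ ≟ f | e ≟ f
            ... | yes refl | _ = ⊥-elim (true≢false (within-⊆ {Q} {W} Q⊆W e′ we′) wf)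
            ... | no _ | yes refl = ⊥-elim (true≢false (link-within {W} l (hull-⊇ Z₀ x z₀x) (hull-⊇ Z₀ y z₀y)) wf)
            ... | no p | no q = trans (trans (∧-identityʳ _) (∨-identityʳ _))
                  (H″≡H f (¬true⇒false λ w → true≢false (within-⊆ {Zx} {W} (hull-Zx Z₀) f w) wf)
                          (¬true⇒false λ w → true≢false (within-⊆ {Zy} {W} (hull-Zy Z₀) f w) wf))
            same* : inside H* W ≡ inside H W
            same* = trans (+-cancelʳ-≡ 1 _ _ (trans (cong (λ k → inside H* W + 𝟙 k) (sym (within-⊆ {Q} {W} Q⊆W e′ we′)))
                     (trans (swap-inside W) (cong (λ k → inside H″ W + 𝟙 k)
                         (link-within {W} l (hull-⊇ Z₀ x z₀x) (hull-⊇ Z₀ y z₀y))))))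
                     (inside″ W (hull-Zx Z₀) (hull-Zy Z₀))
            slack* : deg H* v < h v
            slack* = ≤-trans (≤-reflexive eq) (bounded feasible″ v)
              where
              -- The ends of `e` lie in `Zx` and `Zy`, hence outside `S′`, so `v` loses `e′` and
              -- gains nothing.
              eq : suc (deg H* v) ≡ deg H″ v
              eq = begin
                suc (deg H* v) ≡⟨ +-comm 1 (deg H* v) ⟩
                deg H* v + 1 ≡⟨ cong (deg H* v +_) (link-inc-end l′) ⟨
                deg H* v + inc e′ v ≡⟨ deg-∖ H⁺ e′ v e′∈⁺ ⟨
                deg H⁺ v ≡⟨ deg-⊕ H″ e v e∉ ⟩
                deg H″ v + inc e v ≡⟨ cong (deg H″ v +_) (trans (link-inc l v) (cong₂ (λ p q → 𝟙 p + 𝟙 q)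
                                                (≢⇒== {x = x} {v} λ { refl → true≢false s′v (avoids rx v (contains rx)) })
                                                (≢⇒== {x = y} {v} λ { refl → true≢false s′v (avoids ry v (contains ry)) }))) ⟩
                deg H″ v + 0 ≡⟨ +-identityʳ _ ⟩
                deg H″ v ∎
                where open ≡-Reasoning

      record Barrier : Set where
        field
          S         : Mask n
          saturated : ∀ v → S v ≡ true → h v ≤ deg H v
          reducible : ∀ v → S v ≡ false → ¬ ¬ Reducible H S v
          closed    : Closed H S

      -- `S` is replaced by the set `S′` of vertices that are irreducible relative to it until
      -- nothing new appears. `S′` contains `S`, because a reducing set has to contain its vertex
      -- and avoid `S`. A newly added vertex is saturated, since otherwise its singleton with `H`
      -- unchanged would reduce it.
      barrier : (∀ K → Feasible K → size K ≤ size H) → ¬ ¬ Barrier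
      barrier largest = grow n ∅ (m≤n+m n _) (λ _ ()) (closed-∅ largest)
        where
        grow : ∀ k S → n ≤ size S + k → (∀ v → S v ≡ true → h v ≤ deg H v) → Closed H S → ¬ ¬ Barrier
        grow k S bound sat closed = do
          (S′ , spec) ← comprehension (λ v → ¬ Reducible H S v)
          (inj₁ (v , s′v , sv)) ← em {A = ∃ λ v → S′ v ≡ true × S v ≡ false}
            where (inj₂ none) → return (record { S = S ; saturated = sat ; closed = closed
                    ; reducible = λ v sv → proj₂ (spec v) (¬true⇒false λ s′ → none (v , s′ , sv)) })
          next k S′ bound spec v s′v sv
          where
          next : ∀ k S′ → n ≤ size S + k → (∀ v → (S′ v ≡ true → ¬ Reducible H S v) × (S′ v ≡ false → ¬ ¬ Reducible H S v)) →
                 ∀ v → S′ v ≡ true → S v ≡ false → ¬ ¬ Barrier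
          next k S′ bound spec v s′v sv = continue k bound
            where
            S⊆S′ : S ⊆ S′
            S⊆S′ w sw with S′ w in s′w
            ... | true  = refl
            ... | false = ⊥-elim (proj₂ (spec w) s′w λ r → true≢false sw (avoids r w (contains r)))
            sat′ : ∀ w → S′ w ≡ true → h w ≤ deg H w
            sat′ w s′w with S w in sw
            ... | true  = sat w sw
            ... | false = ≮⇒≥ λ lt → proj₁ (spec w) s′w (record
                    { Z = ⁅ w ⁆ ; contains = ==-refl w ; tight = tight-⁅⁆ a b loopless H w
                    ; avoids = λ u p → subst (λ u → S u ≡ false) (==⇒≡ {x = w} p) sw
                    ; H′ = H ; feasible = fH ; agree = λ _ _ → refl ; same = refl ; slack = lt })
            bigger : suc (size S) ≤ size S′
            bigger = ≤-trans (≤-reflexive (sym (size-⊕ S v sv))) (size-⊆ {Y = S ⊕ v} {S′}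
                       λ w p → [ S⊆S′ w , (λ { refl → s′v }) ]′ (⊕-split S v w p))
            continue : ∀ k → n ≤ size S + k → ¬ ¬ Barrier
            continue zero bound _ = <⇒≱ (≤-trans bigger (size-≤ S′)) (subst (n ≤_) (+-identityʳ _) bound)
            continue (suc k) bound = grow k S′ (≤-trans bound (≤-trans (≤-reflexive (+-suc (size S) k)) (+-monoˡ-≤ k bigger)))
              sat′ (closed-step S⊆S′ (λ w s → proj₁ (spec w) s) closed)

-- Counting edges between maximal tight sets

-- The least element of Y; v only witnesses that Y is inhabited.
least : ∀ {n} → Mask n → Fin n → Fin n
least Y zero = zero
least Y (suc v) with Y zero
... | true  = zero
... | false = suc (least (Y ∘ suc) v)

least-∈ : ∀ {n} (Y : Mask n) v → Y v ≡ true → Y (least Y v) ≡ true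
least-∈ Y zero h = h
least-∈ Y (suc v) h with Y zero in y₀
... | true  = y₀
... | false = least-∈ (Y ∘ suc) v h

least-unique : ∀ {n} (Y Z : Mask n) v w → (∀ u → Y u ≡ Z u) → Y v ≡ true → Z w ≡ true → least Y v ≡ least Z w
least-unique Y Z zero zero e yv zw = refl
least-unique Y Z zero (suc w) e yv zw with Z zero in z₀
... | true  = refl
... | false = ⊥-elim (true≢false (trans (sym (e zero)) yv) z₀)
least-unique Y Z (suc v) zero e yv zw with Y zero in y₀
... | true  = refl
... | false = ⊥-elim (true≢false (trans (e zero) zw) y₀)
least-unique Y Z (suc v) (suc w) e yv zw with Y zero | Z zero | e zero
... | true  | true  | _ = refl
... | false | false | _ = cong suc (least-unique (Y ∘ suc) (Z ∘ suc) v w (e ∘ suc) yv zw)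

-- B v is the class of v.
record Partition (n : ℕ) : Set where
  field
    B     : Fin n → Fin n → Bool
    B-refl : ∀ v → B v v ≡ true
    B-cong : ∀ v w → B v w ≡ true → ∀ u → B v u ≡ B w u

  L : Fin n → Fin n
  L v = least (B v) v

  rep : Mask n
  rep r = L r == r

  B-L : ∀ v → B v (L v) ≡ true
  B-L v = least-∈ (B v) v (B-refl v)

  L-cong : ∀ v w → B v w ≡ true → L v ≡ L w
  L-cong v w h = least-unique (B v) (B w) v w (B-cong v w h) (B-refl v) (B-refl w)

  L-idem : ∀ v → L (L v) ≡ L v
  L-idem v = sym (L-cong v (L v) (B-L v))

  -- Turns a double sum over representatives and the members of their classes into a selection at
  -- `L v`.
  rep-∈ : ∀ r v → rep r ∧ B r v ≡ (L v == r)
  rep-∈ r v with L v ≟ r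
  ... | yes refl = ∧-intro (trans (cong (_== L v) (L-idem v)) (==-refl (L v)))
                           (trans (sym (B-cong v (L v) (B-L v) v)) (B-refl v))
  ... | no ne = ¬true⇒false λ h → let p , q = ∧-split {rep r} h in ne (trans (sym (L-cong r v q)) (==⇒≡ {x = L r} p))

  cross : ∀ {m} → (a b : Fin m → Fin n) → Fin m → Bool
  cross a b e = not (L (a e) == L (b e))

  sum-classes : ∀ (f : Fin n → ℕ) → sum (λ r → 𝟙 (rep r) * sum (λ v → 𝟙 (B r v) * f v)) ≡ sum f
  sum-classes f = begin
    sum (λ r → 𝟙 (rep r) * sum (λ v → 𝟙 (B r v) * f v))
      ≡⟨ sum-cong-≗ (λ r → *-distribˡ-sum (𝟙 (rep r)) (λ v → 𝟙 (B r v) * f v)) ⟩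
    sum (λ r → sum (λ v → 𝟙 (rep r) * (𝟙 (B r v) * f v)))
      ≡⟨ sum-cong-≗ (λ r → sum-cong-≗ (λ v → trans (pt (rep r) (B r v) (f v)) (cong (λ x → f v * 𝟙 x) (rep-∈ r v)))) ⟩
    sum (λ r → sum (λ v → f v * 𝟙 (L v == r)))
      ≡⟨ ∑-comm (λ r v → f v * 𝟙 (L v == r)) ⟩
    sum (λ v → sum (λ r → f v * 𝟙 (L v == r)))
      ≡⟨ sum-cong-≗ (λ v → sum-select (λ _ → f v) (L v)) ⟩
    sum f ∎
    where
    open ≡-Reasoning
    pt : ∀ p q k → 𝟙 p * (𝟙 q * k) ≡ k * 𝟙 (p ∧ q)
    pt true  q k = trans (+-identityʳ _) (*-comm (𝟙 q) k)
    pt false q k = sym (*-zeroʳ k)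

module Count {n m : ℕ} (a b : Fin m → Fin n) (loopless : ∀ e → a e ≢ b e) (P : Partition n) where
  open Multigraph a b
  open Partition P

  xcross : Mask m
  xcross = cross a b

  sum-sizes : sum (λ r → 𝟙 (rep r) * size (B r)) ≡ n
  sum-sizes = trans (sum-cong-≗ (λ r → cong (𝟙 (rep r) *_) (sum-cong-≗ (λ v → sym (*-identityʳ (𝟙 (B r v)))))))
                    (trans (sum-classes (λ _ → 1)) (size-full n))

  sum-insides : ∀ H → sum (λ r → 𝟙 (rep r) * inside H (B r)) ≡ size (λ e → H e ∧ not (xcross e))
  sum-insides H = begin
    sum (λ r → 𝟙 (rep r) * inside H (B r))
      ≡⟨ sum-cong-≗ (λ r → *-distribˡ-sum (𝟙 (rep r)) (𝟙 ∘ (H ∩ within (B r)))) ⟩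
    sum (λ r → sum (λ e → 𝟙 (rep r) * 𝟙 ((H ∩ within (B r)) e)))
      ≡⟨ sum-cong-≗ (λ r → sum-cong-≗ (λ e → trans (pt (rep r) (H e) (B r (a e)) (B r (b e)))
           (cong₂ (λ x y → 𝟙 (H e ∧ x) * 𝟙 y) (rep-∈ r (b e)) (rep-∈ r (a e))))) ⟩
    sum (λ r → sum (λ e → 𝟙 (H e ∧ (L (b e) == r)) * 𝟙 (L (a e) == r)))
      ≡⟨ ∑-comm (λ r e → 𝟙 (H e ∧ (L (b e) == r)) * 𝟙 (L (a e) == r)) ⟩
    sum (λ e → sum (λ r → 𝟙 (H e ∧ (L (b e) == r)) * 𝟙 (L (a e) == r)))
      ≡⟨ sum-cong-≗ (λ e → trans (sum-select (λ r → 𝟙 (H e ∧ (L (b e) == r))) (L (a e)))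
           (cong (λ x → 𝟙 (H e ∧ x)) (trans (==-sym (L (b e)) (L (a e))) (sym (not-involutive _))))) ⟩
    size (λ e → H e ∧ not (xcross e)) ∎
    where
    open ≡-Reasoning
    pt : ∀ i h x y → 𝟙 i * 𝟙 (h ∧ (x ∧ y)) ≡ 𝟙 (h ∧ (i ∧ y)) * 𝟙 (i ∧ x)
    pt = toWitness {a? = ∀Bool? λ i → ∀Bool? λ h → ∀Bool? λ x → ∀Bool? λ y → _ ≟ℕ _} _

  -- A tight class B takes up at least 2|B| - 2 edges, so all classes together take up at least 2n
  -- minus twice their number. Of at most 2n - 3 edges, at most twice the number of classes minus 3
  -- remain between them.
  cross-count : ∀ H → (∀ r → 2 * size (B r) ≤ inside H (B r) + 2) → size H + 3 ≤ 2 * n →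
                size (λ e → H e ∧ xcross e) + 3 ≤ 2 * size rep
  cross-count H tight small = linear 0 (+-mono-≤ (+-mono-≤ classes small) (≤-reflexive (sym divide)))
    (count n (size rep) _ (size (λ e → H e ∧ xcross e)) (size H))
    where
    N = size (λ e → H e ∧ not (xcross e))
    divide : size H ≡ N + size (λ e → H e ∧ xcross e)
    divide = size-partition H xcross
    classes : 2 * n ≤ N + 2 * size rep
    classes = begin
      2 * n ≡⟨ cong (2 *_) sum-sizes ⟨
      2 * sum (λ r → 𝟙 (rep r) * size (B r)) ≡⟨ *-distribˡ-sum 2 (λ r → 𝟙 (rep r) * size (B r)) ⟩
      sum (λ r → 2 * (𝟙 (rep r) * size (B r))) ≤⟨ sum-mono (λ r → ≤-trans (≤-reflexive (shift (𝟙 (rep r)) (size (B r))))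
                                                                      (*-monoʳ-≤ (𝟙 (rep r)) (tight r))) ⟩
      sum (λ r → 𝟙 (rep r) * (inside H (B r) + 2)) ≡⟨ sum-cong-≗ (λ r → expand (𝟙 (rep r)) (inside H (B r))) ⟩
      sum (λ r → 𝟙 (rep r) * inside H (B r) + 2 * 𝟙 (rep r)) ≡⟨ ∑-distrib-+ (λ r → 𝟙 (rep r) * inside H (B r)) _ ⟩
      sum (λ r → 𝟙 (rep r) * inside H (B r)) + sum (λ r → 2 * 𝟙 (rep r))
                                                                 ≡⟨ cong₂ _+_ (sum-insides H) (sym (*-distribˡ-sum 2 (𝟙 ∘ rep))) ⟩
      N + 2 * size rep ∎
      where
      open ≤-Reasoning
      shift : ∀ p s → 2 * (p * s) ≡ p * (2 * s)
      shift = solve-∀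
      expand : ∀ p s → p * (s + 2) ≡ p * s + 2 * p
      expand = solve-∀
    count : ∀ n p N c s → N + 2 * p + 2 * n + s + (c + 3) + 0 ≡ 2 * n + (s + 3) + (N + c) + 2 * p
    count = solve-∀

  module _ (A : Mask m) (S : Mask n) (S-L : ∀ v → S (L v) ≡ S v) where

    -- An edge meets the cuts of at most two classes, those of its own ends, and is charged only to
    -- the ends outside `S`.
    cut-count : ∀ k → (∀ r → S r ≡ false → k ≤ cut A (B r)) →
      k * size (λ r → rep r ∧ not (S r)) ≤ sum (λ e → 𝟙 (A e ∧ xcross e) * (𝟙 (not (S (a e))) + 𝟙 (not (S (b e)))))
    cut-count k cuts = begin
      k * size (λ r → rep r ∧ not (S r)) ≡⟨ *-distribˡ-sum k (λ r → 𝟙 (rep r ∧ not (S r))) ⟩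
      sum (λ r → k * 𝟙 (rep r ∧ not (S r))) ≤⟨ sum-mono pt₁ ⟩
      sum (λ r → 𝟙 (rep r ∧ not (S r)) * cut A (B r)) ≡⟨ sum-cong-≗
          (λ r → *-distribˡ-sum (𝟙 (rep r ∧ not (S r))) (𝟙 ∘ (A ∩ crosses (B r)))) ⟩
      sum (λ r → sum (λ e → 𝟙 (rep r ∧ not (S r)) * 𝟙 ((A ∩ crosses (B r)) e)))
                                                                  ≡⟨ ∑-comm (λ r e → 𝟙 (rep r ∧ not (S r)) * 𝟙
                                                                      ((A ∩ crosses (B r)) e)) ⟩
      sum (λ e → sum (λ r → 𝟙 (rep r ∧ not (S r)) * 𝟙 ((A ∩ crosses (B r)) e)))
                                                                  ≤⟨ sum-mono (λ e → sum-mono (λ r → pt₂ e r)) ⟩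
      sum (λ e → sum (λ r → C e (a e) * 𝟙 (L (a e) == r) + C e (b e) * 𝟙 (L (b e) == r)))
                                                                  ≡⟨ sum-cong-≗ (λ e → trans (∑-distrib-+
                                                                      (λ r → C e (a e) * 𝟙 (L (a e) == r)) _)
                                                                       (cong₂ _+_ (sum-select (λ _ → C e (a e))
                                                                           (L (a e))) (sum-select (λ _ → C e (b e)) (L (b e))))) ⟩
      sum (λ e → C e (a e) + C e (b e)) ≡⟨ sum-cong-≗ (λ e → pt₃ (A e ∧ xcross e) (not (S (a e))) (not (S (b e)))) ⟩
      sum (λ e → 𝟙 (A e ∧ xcross e) * (𝟙 (not (S (a e))) + 𝟙 (not (S (b e))))) ∎
      where
      open ≤-Reasoning
      C : Fin m → Fin n → ℕ
      C e v = 𝟙 ((A e ∧ xcross e) ∧ not (S v))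
      pt₁ : ∀ r → k * 𝟙 (rep r ∧ not (S r)) ≤ 𝟙 (rep r ∧ not (S r)) * cut A (B r)
      pt₁ r with rep r | S r in sr
      ... | true  | false = ≤-trans (≤-reflexive (*-identityʳ k)) (≤-trans (cuts r sr) (≤-reflexive (sym (+-identityʳ _))))
      ... | true  | true  = ≤-reflexive (*-zeroʳ k)
      ... | false | _     = ≤-reflexive (*-zeroʳ k)
      pt₃ : ∀ p q r → 𝟙 (p ∧ q) + 𝟙 (p ∧ r) ≡ 𝟙 p * (𝟙 q + 𝟙 r)
      pt₃ = toWitness {a? = ∀Bool? λ p → ∀Bool? λ q → ∀Bool? λ r → _ ≟ℕ _} _
      S-rep : ∀ r v → (L v == r) ≡ true → S r ≡ S v
      S-rep r v h = trans (cong S (sym (==⇒≡ {x = L v} h))) (S-L v)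
      pt₂ : ∀ e r → 𝟙 (rep r ∧ not (S r)) * 𝟙 ((A ∩ crosses (B r)) e) ≤ C e (a e) * 𝟙 (L (a e) == r) + C e (b e) * 𝟙
          (L (b e) == r)
      pt₂ e r = bools (rep r) (A e) (B r (a e)) (B r (b e)) (S r) (S (a e)) (S (b e)) (L (a e) == r) (L (b e) == r) (xcross e)
                  (rep-∈ r (a e)) (rep-∈ r (b e)) (S-rep r (a e)) (S-rep r (b e)) uncrossed
        where
        uncrossed : xcross e ≡ false → (L (a e) == r) ≡ (L (b e) == r)
        uncrossed h = cong (_== r) (==⇒≡ {x = L (a e)} {L (b e)} (not-false h))
        bools : ∀ i h x y s s₁ s₂ l₁ l₂ c → i ∧ x ≡ l₁ → i ∧ y ≡ l₂ → (l₁ ≡ true → s ≡ s₁) → (l₂ ≡ true → s ≡ s₂) →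
            (c ≡ false → l₁ ≡ l₂) →
                𝟙 (i ∧ not s) * 𝟙 (h ∧ (x xor y)) ≤ 𝟙 ((h ∧ c) ∧ not s₁) * 𝟙 l₁ + 𝟙 ((h ∧ c) ∧ not s₂) * 𝟙 l₂
        bools false h x y s s₁ s₂ l₁ l₂ c _ _ _ _ _ = z≤n
        bools true h x y true s₁ s₂ l₁ l₂ c _ _ _ _ _ = z≤n
        bools true false x y false s₁ s₂ l₁ l₂ c _ _ _ _ _ = z≤n
        bools true true true true false s₁ s₂ l₁ l₂ c _ _ _ _ _ = z≤n
        bools true true false false false s₁ s₂ l₁ l₂ c _ _ _ _ _ = z≤n
        bools true true true false false s₁ s₂ l₁ l₂ true refl refl p q r rewrite sym (p refl) = s≤s z≤n
        bools true true false true false s₁ s₂ l₁ l₂ true refl refl p q r rewrite sym (q refl) | *-zeroʳ (𝟙 (not s₁)) = s≤s z≤n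
        bools true true true false false s₁ s₂ l₁ l₂ false refl refl p q r = case r refl of λ ()
        bools true true false true false s₁ s₂ l₁ l₂ false refl refl p q r = case r refl of λ ()

module _ {n m : ℕ} (a b : Fin m → Fin n) (loopless : ∀ e → a e ≢ b e) (A : Mask m) (h : Fin n → ℕ) where
  open Multigraph a b
  open Loopless loopless
  open Exchange a b loopless
  open Bounded A h
  open Feasible

  module Blocked {H : Mask m} (fH : Feasible H) (bar : Barrier H fH) where
    open Barrier bar

    -- Vertices of `S` become classes of their own, the others take a maximal tight set avoiding
    -- `S`; thus `S` is a union of classes and every class is tight.
    record Block (v : Fin n) : Set where
      field
        Z         : Mask n
        tight     : Tight H Z
        contains  : Z v ≡ true
        avoids    : S v ≡ false → Disjoint Z S
        singleton : S v ≡ true → ∀ u → Z u ≡ true → v ≡ u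
        greatest  : S v ≡ false → ∀ Y → Tight H Y → Disjoint Y S → Y v ≡ true → Y ⊆ Z

    block : ∀ v → ¬ ¬ Block v
    block v with S v in sv
    ... | true = return (record { Z = ⁅ v ⁆ ; tight = tight-⁅⁆ a b loopless H v ; contains = ==-refl v
                                ; avoids = λ p → ⊥-elim (true≢false sv p) ; singleton = λ _ u → ==⇒≡ {x = v}
                                ; greatest = λ p → ⊥-elim (true≢false sv p) })
    ... | false = do
      (Z , (tZ , dZ , zv) , largest) ← maximal (λ Z → Tight H Z × Disjoint Z S × Z v ≡ true) size n (λ Z _ → size-≤ Z)
        ⁅ v ⁆ (tight-⁅⁆ a b loopless H v , (λ u p → subst (λ u → S u ≡ false) (==⇒≡ {x = v} p) sv) , ==-refl v)
      return (record { Z = Z ; tight = tZ ; contains = zv ; avoids = λ _ → dZ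
                     ; singleton = λ p → ⊥-elim (true≢false p sv) ; greatest = λ _ → greatest Z tZ dZ zv largest })
      where
      greatest : ∀ Z → Tight H Z → Disjoint Z S → Z v ≡ true →
                 (∀ Y → Tight H Y × Disjoint Y S × Y v ≡ true → size Y ≤ size Z) →
                 ∀ Y → Tight H Y → Disjoint Y S → Y v ≡ true → Y ⊆ Z
      greatest Z tZ dZ zv largest Y tY dY yv u yu with Z u in zu
      ... | true  = refl
      ... | false = ⊥-elim (<⇒≱ (≤-reflexive (sym (size-⊕ Z u zu))) (≤-trans
              (size-⊆ {Y = Z ⊕ u} {Z ∪ Y} λ w p → [ ∨-introˡ , (λ { refl → ∨-introʳ {Z u} yu }) ]′ (⊕-split Z u w p))
              (largest (Z ∪ Y) (tight-∪ {H} {Z} {Y} (sparse fH) tZ tY zv yv ,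
                (λ w p → [ dZ w , dY w ]′ (∨-split {Z w} p)) , ∨-introˡ zv))))

    module _ (blocks : ∀ v → Block v) where
      open Block

      partition : Partition n
      partition = record { B = λ v → Z (blocks v) ; B-refl = λ v → contains (blocks v) ; B-cong = B-cong }
        where
        B-cong : ∀ v w → Z (blocks v) w ≡ true → ∀ u → Z (blocks v) u ≡ Z (blocks w) u
        B-cong v w h u = by-cases (S v) refl
          where
          by-cases : ∀ s → S v ≡ s → Z (blocks v) u ≡ Z (blocks w) u
          by-cases true  sv = cong (λ w → Z (blocks w) u) (singleton (blocks v) sv w h)
          by-cases false sv = bool-ext (v⊆w u) (greatest (blocks v) sv (Z (blocks w)) (tight (blocks w)) (avoids (blocks w) sw)
                                (v⊆w v (contains (blocks v))) u)
            where
            sw = avoids (blocks v) sv w h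
            v⊆w : Z (blocks v) ⊆ Z (blocks w)
            v⊆w = greatest (blocks w) sw (Z (blocks v)) (tight (blocks v)) (avoids (blocks v) sv) h

      open Partition partition
      open Count a b loopless partition

      L-S : ∀ {v} → S v ≡ true → L v ≡ v
      L-S {v} sv = sym (singleton (blocks v) sv (L v) (B-L v))

      S-L : ∀ v → S (L v) ≡ S v
      S-L v = by-cases (S v) refl
        where
        by-cases : ∀ s → S v ≡ s → S (L v) ≡ S v
        by-cases true  sv = cong S (L-S sv)
        by-cases false sv = trans (avoids (blocks v) sv (L v) (B-L v)) (sym sv)

      uncrossed : ∀ e → xcross e ≡ false → L (a e) ≡ L (b e)
      uncrossed e h = ==⇒≡ {x = L (a e)} (not-false h)

      touching-a : ∀ e → S (a e) ≡ true → xcross e ≡ true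
      touching-a e sa with xcross e in c
      ... | true  = refl
      ... | false = ⊥-elim (loopless e (trans (sym (L-S sa)) (trans La≡Lb (L-S sb))))
        where
        La≡Lb = uncrossed e c
        sb : S (b e) ≡ true
        sb = trans (sym (S-L (b e))) (trans (cong S (trans (sym La≡Lb) (L-S sa))) sa)

      touching-b : ∀ e → S (b e) ≡ true → xcross e ≡ true
      touching-b e sb with xcross e in c
      ... | true  = refl
      ... | false = ⊥-elim (true≢false (touching-a e sa) c)
        where
        sa : S (a e) ≡ true
        sa = trans (sym (S-L (a e))) (trans (cong S (trans (uncrossed e c) (L-S sb))) sb)

      -- Both ends are reducible, so the invariant of the barrier puts them into a common tight set
      -- avoiding `S`, and this lies in a single maximal one.
      unused : ∀ e → A e ≡ true → H e ≡ false → S (a e) ≡ false → S (b e) ≡ false → xcross e ≡ false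
      unused e ae he sa sb = ¬true⇒false λ c → related λ (Z′ , tZ′ , dZ′ , za , zb) →
        ==⇒≢ {x = L (a e)} (not-true c) (L-cong (a e) (b e) (greatest (blocks (a e)) sa Z′ tZ′ dZ′ za (b e) zb))
        where
        related : ¬ ¬ Related H S (a e) (b e)
        related = do
          ra ← reducible (a e) sa
          rb ← reducible (b e) sb
          closed ae he (inj₁ (refl , refl)) ra rb

      module _ (κ : ℕ) (cuts : MinCut (4 + κ) A)
               (weight : ∀ v → 2 * deg A v + 4 * (4 + κ) ≤ (4 + κ) * h v + 8) (small : size H + 3 ≤ 2 * n) where

        one two : Mask m → ℕ
        one F = size (λ e → F e ∧ (S (a e) xor S (b e)))
        two F = inside F S

        none = size (λ e → (A e ∧ xcross e) ∧ (not (S (a e)) ∧ not (S (b e))))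
        p₀ = size (λ r → rep r ∧ not (S r))
        s = size S

        degrees : ∀ F → sum (λ v → 𝟙 (S v) * deg F v) ≡ one F + 2 * two F
        degrees F = trans (handshake F S) (trans (sum-cong-≗ (λ e → pt (F e) (S (a e)) (S (b e))))
          (trans (∑-distrib-+ (λ e → 𝟙 (F e ∧ (S (a e) xor S (b e)))) _)
              (cong (one F +_) (sym (*-distribˡ-sum 2 (𝟙 ∘ (F ∩ within S)))))))
          where
          pt : ∀ f p q → 𝟙 f * (𝟙 p + 𝟙 q) ≡ 𝟙 (f ∧ (p xor q)) + 2 * 𝟙 (f ∧ (p ∧ q))
          pt = toWitness {a? = ∀Bool? λ f → ∀Bool? λ p → ∀Bool? λ q → _ ≟ℕ _} _

        reps : size rep ≡ p₀ + s
        reps = trans (sum-cong-≗ (λ r → pt (rep r) (S r) (λ sr → trans (cong (_== r) (L-S sr)) (==-refl r))))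
            (∑-distrib-+ (λ r → 𝟙 (rep r ∧ not (S r))) _)
          where
          pt : ∀ i s → (s ≡ true → i ≡ true) → 𝟙 i ≡ 𝟙 (i ∧ not s) + 𝟙 s
          pt true  true  _ = refl
          pt true  false _ = refl
          pt false true  f = case f refl of λ ()
          pt false false _ = refl

        bound₁ : none + one H + two H + 3 ≤ 2 * (p₀ + s)
        bound₁ = begin
          none + one H + two H + 3 ≡⟨ cong (_+ 3) crossing ⟨
          size (λ e → H e ∧ xcross e) + 3 ≤⟨ cross-count H (λ r → proj₂ (tight (blocks r))) small ⟩
          2 * size rep ≡⟨ cong (2 *_) reps ⟩
          2 * (p₀ + s) ∎
          where
          open ≤-Reasoning
          pt : ∀ A h c p q → (h ≡ true → A ≡ true) → (p ≡ true → c ≡ true) → (q ≡ true → c ≡ true) →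
               (A ≡ true → h ≡ false → p ≡ false → q ≡ false → c ≡ false) →
               𝟙 (h ∧ c) ≡ 𝟙 ((A ∧ c) ∧ (not p ∧ not q)) + 𝟙 (h ∧ (p xor q)) + 𝟙 (h ∧ (p ∧ q))
          pt = toWitness {a? = ∀Bool? λ A → ∀Bool? λ h → ∀Bool? λ c → ∀Bool? λ p → ∀Bool? λ q →
            (h ≟ᵇ true →-dec A ≟ᵇ true) →-dec ((p ≟ᵇ true →-dec c ≟ᵇ true) →-dec ((q ≟ᵇ true →-dec c ≟ᵇ true) →-dec
            ((A ≟ᵇ true →-dec (h ≟ᵇ false →-dec (p ≟ᵇ false →-dec (q ≟ᵇ false →-dec c ≟ᵇ false)))) →-dec (_ ≟ℕ _))))} _
          crossing : size (λ e → H e ∧ xcross e) ≡ none + one H + two H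
          crossing = trans (sum-cong-≗ (λ e → pt (A e) (H e) (xcross e) (S (a e)) (S (b e)) (allowed fH e)
              (touching-a e) (touching-b e) (unused e)))
            (trans (∑-distrib-+ (λ e → 𝟙 ((A e ∧ xcross e) ∧ (not (S (a e)) ∧ not (S (b e)))) +
                                   𝟙 (H e ∧ (S (a e) xor S (b e)))) _)
                   (cong (_+ two H) (∑-distrib-+ (λ e → 𝟙 ((A e ∧ xcross e) ∧ (not (S (a e)) ∧ not (S (b e))))) _)))

        -- The cut bound requires a vertex outside the class; a class containing every vertex would
        -- be tight and contradict `small`.
        block-cut : ∀ r → S r ≡ false → 4 + κ ≤ cut A (B r)
        block-cut r _ with all-or-missing (B r)
        ... | inj₂ (v , out) = cuts (B r) (B-refl r) out
        ... | inj₁ all = ⊥-elim (<⇒≱ (s≤s (≤-refl {size H + 2})) (begin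
            suc (size H + 2) ≡⟨ +-suc (size H) 2 ⟨
            size H + 3 ≤⟨ small ⟩
            2 * n ≡⟨ cong (2 *_) (trans (size-cong all) (size-full n)) ⟨
            2 * size (B r) ≤⟨ proj₂ (tight (blocks r)) ⟩
            inside H (B r) + 2 ≤⟨ +-monoˡ-≤ 2 (size-⊆ {Y = H ∩ within (B r)} {H} (λ e p → proj₁ (∧-split {H e} p))) ⟩
            size H + 2 ∎))
          where open ≤-Reasoning

        bound₂ : (4 + κ) * p₀ ≤ 2 * none + one A
        bound₂ = ≤-trans (cut-count A S S-L (4 + κ) block-cut) (≤-trans (sum-mono (λ e → pt (A e) (xcross e) (S (a e)) (S (b e))))
          (≤-reflexive (trans (∑-distrib-+ (λ e → 2 * 𝟙 ((A e ∧ xcross e) ∧ (not (S (a e)) ∧ not (S (b e))))) _)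
            (cong (_+ one A) (sym (*-distribˡ-sum 2 (λ e → 𝟙 ((A e ∧ xcross e) ∧ (not (S (a e)) ∧ not (S (b e)))))))))))
          where
          pt : ∀ A c p q → 𝟙 (A ∧ c) * (𝟙 (not p) + 𝟙 (not q)) ≤ 2 * 𝟙 ((A ∧ c) ∧ (not p ∧ not q)) + 𝟙 (A ∧ (p xor q))
          pt = toWitness {a? = ∀Bool? λ A → ∀Bool? λ c → ∀Bool? λ p → ∀Bool? λ q → _ ≤? _} _

        -- The hypothesis `weight` summed over `S`, where saturation allows `h` to be replaced by
        -- the degree in `H`.
        bound₃ : 2 * (one A + 2 * two A) + 4 * (4 + κ) * s ≤ (4 + κ) * (one H + 2 * two H) + 8 * s
        bound₃ = begin
          2 * (one A + 2 * two A) + 4 * (4 + κ) * s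
            ≡⟨ cong₂ (λ x y → 2 * x + y) (sym (degrees A)) (*-distribˡ-sum (4 * (4 + κ)) (𝟙 ∘ S)) ⟩
          2 * sum (λ v → 𝟙 (S v) * deg A v) + sum (λ v → 4 * (4 + κ) * 𝟙 (S v))
            ≡⟨ cong (_+ _) (*-distribˡ-sum 2 (λ v → 𝟙 (S v) * deg A v)) ⟩
          sum (λ v → 2 * (𝟙 (S v) * deg A v)) + sum (λ v → 4 * (4 + κ) * 𝟙 (S v))
            ≡⟨ ∑-distrib-+ (λ v → 2 * (𝟙 (S v) * deg A v)) _ ⟨
          sum (λ v → 2 * (𝟙 (S v) * deg A v) + 4 * (4 + κ) * 𝟙 (S v))
            ≤⟨ sum-mono pt ⟩
          sum (λ v → (4 + κ) * (𝟙 (S v) * deg H v) + 8 * 𝟙 (S v))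
            ≡⟨ ∑-distrib-+ (λ v → (4 + κ) * (𝟙 (S v) * deg H v)) _ ⟩
          sum (λ v → (4 + κ) * (𝟙 (S v) * deg H v)) + sum (λ v → 8 * 𝟙 (S v))
            ≡⟨ cong₂ _+_ (sym (*-distribˡ-sum (4 + κ) (λ v → 𝟙 (S v) * deg H v))) (sym (*-distribˡ-sum 8 (𝟙 ∘ S))) ⟩
          (4 + κ) * sum (λ v → 𝟙 (S v) * deg H v) + 8 * s
            ≡⟨ cong (λ x → (4 + κ) * x + 8 * s) (degrees H) ⟩
          (4 + κ) * (one H + 2 * two H) + 8 * s ∎
          where
          open ≤-Reasoning
          simplify : ∀ d k → 2 * (1 * d) + 4 * k * 1 ≡ 2 * d + 4 * k
          simplify = solve-∀
          simplify′ : ∀ d k → k * d + 8 ≡ k * (1 * d) + 8 * 1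
          simplify′ = solve-∀
          vanish : ∀ d k → 2 * (0 * d) + 4 * k * 0 ≡ k * (0 * d) + 8 * 0
          vanish = solve-∀
          pt : ∀ v → 2 * (𝟙 (S v) * deg A v) + 4 * (4 + κ) * 𝟙 (S v) ≤ (4 + κ) * (𝟙 (S v) * deg H v) + 8 * 𝟙 (S v)
          pt v with S v in sv
          ... | true  = ≤-trans (≤-reflexive (simplify (deg A v) (4 + κ))) (≤-trans (weight v)
                          (≤-trans (+-monoˡ-≤ 8 (*-monoʳ-≤ (4 + κ) (saturated v sv)))
                              (≤-reflexive (simplify′ (deg H v) (4 + κ)))))
          ... | false = ≤-reflexive (trans (cong₂ (λ x y → 2 * x + y) (refl {x = 0}) refl)
              (trans (vanish (deg A v) (4 + κ)) refl))

        bound₄ : two H ≤ 2 * s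
        bound₄ with size S in eq
        ... | suc _ = ≤-trans (m≤m+n (two H) 2)
            (≤-trans (sparse fH S (size-inhabited S (≤-trans (s≤s z≤n) (≤-reflexive (sym eq))))) (≤-reflexive (cong (2 *_) eq)))
        ... | zero  = ≤-reflexive (sum-zero λ e → cong 𝟙 (¬true⇒false λ p →
                        <⇒≱ (s≤s z≤n) (≤-trans (size-pos S (proj₁ (∧-split {S (a e)} (proj₂ (∧-split {H e} p)))))
                            (≤-reflexive eq))))

        bound₅ : two H ≤ two A
        bound₅ = size-⊆ {Y = H ∩ within S} {A ∩ within S} λ e p → let h , w = ∧-split {H e} p in ∧-intro (allowed fH e h) w

        -- With k = 4 + κ, the five bounds are taken k, 2, 1, κ and 4 times. All counts cancel
        -- except κ times `none`, leaving that term plus 3k to be at most 0. The coefficient κ is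
        -- where k ≥ 4 enters; the slack is this total minus 1.
        impossible : ⊥
        impossible = case linear {L = 1} {R = 0} (κ * none + 3 * κ + 11)
          (+-mono-≤ (+-mono-≤ (+-mono-≤ (+-mono-≤ (*-monoʳ-≤ (4 + κ) bound₁) (*-monoʳ-≤ 2 bound₂)) bound₃)
              (*-monoʳ-≤ κ bound₄)) (*-monoʳ-≤ 4 bound₅))
          (count none (one A) (two A) (one H) (two H) p₀ s κ) of λ ()
          where
          count : ∀ N₀ N₁ N₂ H₁ H₂ p s κ →
            ((4 + κ) * (2 * (p + s)) + 2 * (2 * N₀ + N₁) + ((4 + κ) * (H₁ + 2 * H₂) + 8 * s) + κ * (2 * s) + 4 * N₂)
                + 1 + (κ * N₀ + 3 * κ + 11) ≡
            ((4 + κ) * (N₀ + H₁ + H₂ + 3) + 2 * ((4 + κ) * p) + (2 * (N₁ + 2 * N₂) + 4 * (4 + κ) * s) + κ * H₂ + 4 * H₂) + 0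
          count = solve-∀

  tight-feasible : ∀ κ → MinCut (4 + κ) A →
                   (∀ v → 2 * deg A v + 4 * (4 + κ) ≤ (4 + κ) * h v + 8) → Fin n →
                   ¬ ¬ (∃ λ H → Feasible H × Tight H full)
  tight-feasible κ cuts weight v₀ = do
    (H , fH , largest) ← maximal Feasible size m (λ H _ → size-≤ H) ∅ feasible-∅
    bar ← barrier H fH largest
    blocks ← ¬¬-Fin (Blocked.block fH bar)
    return (H , fH , (v₀ , refl) , ≮⇒≥ λ lt → Blocked.impossible fH bar blocks κ cuts weight (small H lt))
    where
    feasible-∅ : Feasible ∅
    feasible-∅ = record { allowed = λ _ () ; sparse = λ Y (y , yy) → subst (λ k → k + 2 ≤ 2 * size Y)
        (sym (sum-zero {m} (λ _ → refl))) (*-monoʳ-≤ 2 (size-pos Y yy))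
                        ; bounded = λ v → ≤-trans (≤-reflexive (sum-zero {m} (λ _ → refl))) z≤n }
    small : ∀ H → inside H full + 2 < 2 * size (full {n}) → size H + 3 ≤ 2 * n
    small H lt = begin
      size H + 3 ≡⟨ +-suc (size H) 2 ⟩
      suc (size H + 2) ≡⟨ cong (λ k → suc (k + 2)) (sum-cong-≗ (λ e → cong 𝟙 (∧-identityʳ (H e)))) ⟨
      suc (inside H full + 2) ≤⟨ lt ⟩
      2 * size (full {n}) ≡⟨ cong (2 *_) (size-full n) ⟩
      2 * n ∎
      where open ≤-Reasoning

-- Matchings and the Tutte–Berge theorem

module _ {N : ℕ} (μ : Fin N → Fin N) (invol : ∀ x → μ (μ x) ≡ x) where

  sum-involution : ∀ (f : Fin N → ℕ) → sum (f ∘ μ) ≡ sum f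
  sum-involution f = sym (sum-permute f (permutation μ μ invol invol))

  -- The points that are not fixed lie either below or above their image, and `μ` exchanges these
  -- two halves without changing `f`.
  involution-halves : ∀ (f : Fin N → ℕ) → (∀ x → f (μ x) ≡ f x) →
    sum f ≡ sum (λ x → 𝟙 (μ x == x) * f x) + (sum (λ x → 𝟙 (does (x <ᶠ? μ x)) * f x) + sum (λ x → 𝟙 (does (x <ᶠ? μ x)) * f x))
  involution-halves f inv = begin
    sum f
      ≡⟨ sum-cong-≗ pt ⟩
    sum (λ x → 𝟙 (μ x == x) * f x + (up x + down x))
      ≡⟨ ∑-distrib-+ (λ x → 𝟙 (μ x == x) * f x) _ ⟩
    sum (λ x → 𝟙 (μ x == x) * f x) + sum (λ x → up x + down x)
      ≡⟨ cong (sum (λ x → 𝟙 (μ x == x) * f x) +_) (∑-distrib-+ up down) ⟩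
    sum (λ x → 𝟙 (μ x == x) * f x) + (sum up + sum down)
      ≡⟨ cong (λ s → sum (λ x → 𝟙 (μ x == x) * f x) + (sum up + s)) (trans (sym (sum-involution down)) (sum-cong-≗ flip)) ⟩
    sum (λ x → 𝟙 (μ x == x) * f x) + (sum up + sum up) ∎
    where
    open ≡-Reasoning
    up down : Fin N → ℕ
    up   x = 𝟙 (does (x <ᶠ? μ x)) * f x
    down x = 𝟙 (does (μ x <ᶠ? x)) * f x
    flip : ∀ x → down (μ x) ≡ up x
    flip x rewrite invol x | inv x = refl
    pt : ∀ x → f x ≡ 𝟙 (μ x == x) * f x + (up x + down x)
    pt x with <ᶠ-cmp x (μ x)
    ... | tri< p q r rewrite dec-true (x <ᶠ? μ x) p | dec-false (μ x <ᶠ? x) r | ≢⇒== (q ∘ sym) = count (f x)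
      where
      count : ∀ k → k ≡ 1 * k + 0
      count = solve-∀
    ... | tri> p q r rewrite dec-false (x <ᶠ? μ x) p | dec-true (μ x <ᶠ? x) r | ≢⇒== (q ∘ sym) = count (f x)
      where
      count : ∀ k → k ≡ 1 * k
      count = solve-∀
    ... | tri≈ p q r rewrite dec-false (x <ᶠ? μ x) p | dec-false (μ x <ᶠ? x) r | trans (cong (μ x ==_) q)
        (==-refl (μ x)) = count (f x)
      where
      count : ∀ k → k ≡ 1 * k + 0
      count = solve-∀

  involution-parity : ∀ Y → (∀ x → Y (μ x) ≡ Y x) → odd (size Y) ≡ odd (size (λ x → (μ x == x) ∧ Y x))
  involution-parity Y inv = trans (cong odd (involution-halves (𝟙 ∘ Y) (λ x → cong 𝟙 (inv x))))
    (trans (odd-+ F (U + U)) (trans (cong (odd F xor_) (odd-double U))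
    (trans (xor-identityʳ (odd F)) (cong odd (sum-cong-≗ (λ x → sym (𝟙-∧ (μ x == x) (Y x))))))))
    where
    F = sum (λ x → 𝟙 (μ x == x) * 𝟙 (Y x))
    U = sum (λ x → 𝟙 (does (x <ᶠ? μ x)) * 𝟙 (Y x))

module Matchings {N : ℕ} (Adj : Fin N → Fin N → Set) (Adj-sym : ∀ {x y} → Adj x y → Adj y x) where

  -- A matching as an involution. Its fixed points are the unmatched vertices together with
  -- everything outside `X`, which is why `exposed` intersects with `X`.
  record Matching (X : Mask N) : Set where
    field
      μ     : Fin N → Fin N
      invol : ∀ x → μ (μ x) ≡ x
      inX   : ∀ x → μ x ≢ x → X x ≡ true
      adj   : ∀ x → μ x ≢ x → Adj x (μ x)

    exposed : Mask N
    exposed x = (μ x == x) ∧ X x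

    deficiency : ℕ
    deficiency = size exposed

    injective : ∀ {x y} → μ x ≡ μ y → x ≡ y
    injective {x} {y} p = trans (sym (invol x)) (trans (cong μ p) (invol y))

    X-invariant : ∀ x → X (μ x) ≡ X x
    X-invariant x with μ x ≟ x
    ... | yes p = cong X p
    ... | no p  = trans (inX (μ x) (λ q → p (injective q))) (sym (inX x p))

    exposed-intro : ∀ {x} → μ x ≡ x → X x ≡ true → exposed x ≡ true
    exposed-intro {x} p q = ∧-intro (trans (cong (_== x) p) (==-refl x)) q
  open Matching

  trivial : ∀ X → Matching X
  trivial X = record { μ = id ; invol = λ _ → refl ; inX = λ x p → ⊥-elim (p refl) ; adj = λ x p → ⊥-elim (p refl) }

  deficiency-parity : ∀ {X} (M : Matching X) → odd (deficiency M) ≡ odd (size X)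
  deficiency-parity {X} M = sym (involution-parity (μ M) (invol M) X (X-invariant M))

  module Override (μ₀ : Fin N → Fin N) {x y p q : Fin N} (x≢y : x ≢ y) where
    f : Fin N → Fin N
    f u = if x == u then p else if y == u then q else μ₀ u

    f-x : f x ≡ p
    f-x rewrite ==-refl x = refl

    f-y : f y ≡ q
    f-y rewrite ≢⇒== x≢y | ==-refl y = refl

    f-else : ∀ {u} → x ≢ u → y ≢ u → f u ≡ μ₀ u
    f-else ne ne′ rewrite ≢⇒== ne | ≢⇒== ne′ = refl

    data Case (u : Fin N) : Set where
      is-x  : u ≡ x → Case u
      is-y  : u ≡ y → Case u
      other : x ≢ u → y ≢ u → Case u

    case? : ∀ u → Case u
    case? u with x ≟ u | y ≟ u
    ... | yes refl | _       = is-x refl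
    ... | no ne | yes refl   = is-y refl
    ... | no ne | no ne′     = other ne ne′

  module Match {X} (M : Matching X) {x y} (x≢y : x ≢ y) (mx : μ M x ≡ x) (my : μ M y ≡ y)
               (xy : Adj x y) (xx : X x ≡ true) (xy′ : X y ≡ true) where
    open Override (μ M) {x} {y} {y} {x} x≢y public

    matched : Matching X
    matched = record { μ = f ; invol = iv ; inX = ix ; adj = ad }
      where
      iv : ∀ u → f (f u) ≡ u
      iv u with case? u
      ... | is-x refl = trans (cong f f-x) f-y
      ... | is-y refl = trans (cong f f-y) f-x
      ... | other p q = trans (cong f (f-else p q)) (trans (f-else (p′ p mx) (p′ q my)) (invol M u))
        where
        p′ : ∀ {z} → z ≢ u → μ M z ≡ z → z ≢ μ M u
        p′ ne mz eq = ne (injective M (trans mz eq))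
      ix : ∀ u → f u ≢ u → X u ≡ true
      ix u ne with case? u
      ... | is-x refl = xx
      ... | is-y refl = xy′
      ... | other p q = inX M u (λ e → ne (trans (f-else p q) e))
      ad : ∀ u → f u ≢ u → Adj u (f u)
      ad u ne with case? u
      ... | is-x refl = subst (Adj u) (sym f-x) xy
      ... | is-y refl = subst (Adj u) (sym f-y) (Adj-sym xy)
      ... | other p q = subst (Adj u) (sym (f-else p q)) (adj M u (λ e → ne (trans (f-else p q) e)))

    fewer : deficiency matched + 2 ≡ deficiency M
    fewer = begin
      deficiency matched + 2
        ≡⟨ cong (deficiency matched +_)
            (trans (cong₂ _+_ (sym (size-⁅⁆ x)) (sym (size-⁅⁆ y))) (sym (∑-distrib-+ (𝟙 ∘ ⁅ x ⁆) (𝟙 ∘ ⁅ y ⁆)))) ⟩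
      deficiency matched + sum (λ u → 𝟙 (x == u) + 𝟙 (y == u))
        ≡⟨ ∑-distrib-+ (𝟙 ∘ exposed matched) _ ⟨
      sum (λ u → 𝟙 (exposed matched u) + (𝟙 (x == u) + 𝟙 (y == u)))
        ≡⟨ sum-cong-≗ pt ⟩
      deficiency M ∎
      where
      open ≡-Reasoning
      pt : ∀ u → 𝟙 (exposed matched u) + (𝟙 (x == u) + 𝟙 (y == u)) ≡ 𝟙 (exposed M u)
      pt u with case? u
      ... | is-x refl rewrite f-x | ≢⇒== (x≢y ∘ sym) | ==-refl x | mx | ==-refl x | xx = refl
      ... | is-y refl rewrite f-y | ≢⇒== x≢y | ==-refl y | my | ==-refl y | xy′ = refl
      ... | other p q rewrite f-else p q | ≢⇒== p | ≢⇒== q = +-identityʳ _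

  module Unmatch {X} (M : Matching X) {w} (mw : μ M w ≢ w) where
    r : Fin N
    r = μ M w

    open Override (μ M) {w} {r} {w} {r} (mw ∘ sym) public
      renaming (f-x to f-w; f-y to f-r; is-x to is-w; is-y to is-r)

    unmatched : Matching X
    unmatched = record { μ = f ; invol = iv ; inX = ix ; adj = ad }
      where
      iv : ∀ u → f (f u) ≡ u
      iv u with case? u
      ... | is-w refl = trans (cong f f-w) f-w
      ... | is-r refl = trans (cong f f-r) f-r
      ... | other p q = trans (cong f (f-else p q))
          (trans (f-else (λ e → q (trans (cong (μ M) e) (invol M u))) (λ e → p (injective M e))) (invol M u))
      ix : ∀ u → f u ≢ u → X u ≡ true
      ix u ne with case? u
      ... | is-w refl = ⊥-elim (ne f-w)
      ... | is-r refl = ⊥-elim (ne f-r)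
      ... | other p q = inX M u (λ e → ne (trans (f-else p q) e))
      ad : ∀ u → f u ≢ u → Adj u (f u)
      ad u ne with case? u
      ... | is-w refl = ⊥-elim (ne f-w)
      ... | is-r refl = ⊥-elim (ne f-r)
      ... | other p q = subst (Adj u) (sym (f-else p q)) (adj M u (λ e → ne (trans (f-else p q) e)))

    more : deficiency unmatched ≡ deficiency M + 2
    more = begin
      deficiency unmatched
        ≡⟨ sum-cong-≗ pt ⟩
      sum (λ u → 𝟙 (exposed M u) + (𝟙 (w == u) + 𝟙 (r == u)))
        ≡⟨ ∑-distrib-+ (𝟙 ∘ exposed M) _ ⟩
      deficiency M + sum (λ u → 𝟙 (w == u) + 𝟙 (r == u))
        ≡⟨ cong (deficiency M +_) (trans (∑-distrib-+ (𝟙 ∘ ⁅ w ⁆) (𝟙 ∘ ⁅ r ⁆)) (cong₂ _+_ (size-⁅⁆ w) (size-⁅⁆ r))) ⟩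
      deficiency M + 2 ∎
      where
      open ≡-Reasoning
      xw : X w ≡ true
      xw = inX M w mw
      xr : X r ≡ true
      xr = trans (X-invariant M w) xw
      pt : ∀ u → 𝟙 (exposed unmatched u) ≡ 𝟙 (exposed M u) + (𝟙 (w == u) + 𝟙 (r == u))
      pt u with case? u
      ... | is-w refl rewrite f-w | ==-refl w | ≢⇒== mw | xw = refl
      ... | is-r refl rewrite f-r | ==-refl r | invol M w | ≢⇒== (mw ∘ sym) | xr = refl
      ... | other p q rewrite f-else p q | ≢⇒== p | ≢⇒== q = sym (+-identityʳ _)

  -- The classes K r with r ∈ I are odd unions of components of X minus the barrier Bar.
  record Certificate (X : Mask N) (d : ℕ) : Set where
    field
      Bar I    : Mask N
      K        : Fin N → Fin N → Bool
      K⊆       : ∀ r x → I r ≡ true → K r x ≡ true → X x ≡ true × Bar x ≡ false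
      K-odd    : ∀ r → I r ≡ true → odd (size (K r)) ≡ true
      K-closed : ∀ r x y → I r ≡ true → K r x ≡ true → Adj x y → X y ≡ true → K r y ≡ true ⊎ Bar y ≡ true
      disjoint : ∀ r s x → I r ≡ true → I s ≡ true → K r x ≡ true → K s x ≡ true → r ≡ s
      count    : size Bar + d ≤ size I
  open Certificate

  size-⊕-≤ : ∀ {n} (Y : Mask n) v → size (Y ⊕ v) ≤ suc (size Y)
  size-⊕-≤ Y v with Y v in yv
  ... | false = ≤-reflexive (size-⊕ Y v yv)
  ... | true  = ≤-trans (size-⊆ {Y = Y ⊕ v} {Y} λ u p → [ id , (λ { refl → yv }) ]′ (⊕-split Y v u p)) (n≤1+n _)

  -- A matching of `X` without `b` is a matching of `X` that exposes `b`, so its deficiency there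
  -- exceeds that of `M`, and by parity exceeds it by at least two. One of these is the exposed `b`
  -- itself; the other pays for adding `b` to the barrier.
  essential : ∀ {X} (M : Matching X) b → X b ≡ true → (∀ (ν : Matching X) → deficiency ν ≤ deficiency M → μ ν b ≢ b) →
              (M′ : Matching (X ∖ b)) → Certificate (X ∖ b) (deficiency M′) → Certificate X (deficiency M)
  essential {X} M b xb ess M′ C = record
    { Bar = Bar C ⊕ b ; I = I C ; K = K C
    ; K⊆ = λ r x i k → let p , q = K⊆ C r x i k in ∖-⊆ X b x p , ¬true⇒false λ h → [ (λ t → true≢false t q) , ∖-≢ X b x p ]′ (⊕-split (Bar C) b x h)
    ; K-odd = K-odd C ; K-closed = closed ; disjoint = disjoint C
    ; count = begin
        size (Bar C ⊕ b) + deficiency M ≤⟨ +-monoˡ-≤ (deficiency M) (size-⊕-≤ (Bar C) b) ⟩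
        suc (size (Bar C) + deficiency M) ≡⟨ +-suc (size (Bar C)) (deficiency M) ⟨
        size (Bar C) + suc (deficiency M) ≤⟨ +-monoʳ-≤ (size (Bar C)) (s≤s⁻¹ (subst (suc (deficiency M) <_) lift-size bigger)) ⟩
        size (Bar C) + deficiency M′ ≤⟨ count C ⟩
        size (I C) ∎ }
    where
    open ≤-Reasoning
    closed : ∀ r x y → I C r ≡ true → K C r x ≡ true → Adj x y → X y ≡ true → K C r y ≡ true ⊎ (Bar C ⊕ b) y ≡ true
    closed r x y i k xy xy′ with b ≟ y
    ... | yes refl = inj₂ (∨-introʳ {Bar C b} refl)
    ... | no b≢y = [ inj₁ , (λ h → inj₂ (∨-introˡ h)) ]′ (K-closed C r x y i k xy (∖-∈ X b xy′ b≢y))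
    lift : Matching X
    lift = record { μ = μ M′ ; invol = invol M′ ; inX = λ x p → ∖-⊆ X b x (inX M′ x p) ; adj = adj M′ }
    fixed : μ M′ b ≡ b
    fixed with μ M′ b ≟ b
    ... | yes p = p
    ... | no p  = ⊥-elim (∖-≢ X b b (inX M′ b p) refl)
    lift-size : deficiency lift ≡ suc (deficiency M′)
    lift-size = trans (size-∖ (exposed lift) b (exposed-intro lift fixed xb))
      (cong suc (sum-cong-≗ (λ x → cong 𝟙 (∧-assoc (μ M′ x == x) (X x) _))))
    bigger : suc (deficiency M) < deficiency lift
    bigger = skip (deficiency M) (deficiency lift) (≰⇒> λ le → ess lift le fixed)
        (trans (deficiency-parity M) (sym (deficiency-parity lift)))
      where
      skip : ∀ j k → j < k → odd j ≡ odd k → suc j < k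
      skip j k lt eq with m≤n⇒m<n∨m≡n lt
      ... | inj₁ lt′  = lt′
      ... | inj₂ refl = ⊥-elim (not-≢ (odd j) eq)
        where
        not-≢ : ∀ x → x ≢ not x
        not-≢ true ()
        not-≢ false ()

  -- Gallai's lemma: if every vertex is exposed by some optimal matching, then being equal or never
  -- exposed together is an equivalence relation. The classes of the vertices exposed by `M` are odd
  -- and closed under adjacency, so they form a certificate with empty barrier.
  module Gallai {X} (M : Matching X) (least : ∀ (ν : Matching X) → deficiency M ≤ deficiency ν)
                (exposable : ∀ x → X x ≡ true → ¬ ¬ (Σ (Matching X) λ ν → deficiency ν ≤ deficiency M × μ ν x ≡ x)) where

    infix 4 _⋈_
    _⋈_ : Fin N → Fin N → Set
    x ⋈ y = x ≡ y ⊎ (∀ (ν : Matching X) → deficiency ν ≤ deficiency M → μ ν x ≡ x → μ ν y ≡ y → ⊥)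

    ⋈-sym : ∀ {x y} → x ⋈ y → y ⋈ x
    ⋈-sym (inj₁ p) = inj₁ (sym p)
    ⋈-sym (inj₂ f) = inj₂ λ ν le p q → f ν le q p

    ⋈-adj : ∀ {x y} → X x ≡ true → X y ≡ true → Adj x y → x ⋈ y
    ⋈-adj {x} {y} xx xy adj with x ≟ y
    ... | yes p = inj₁ p
    ... | no ne = inj₂ λ ν le p q → <⇒≱
        (≤-trans (≤-trans (m<m+n _ (s≤s (z≤n {1}))) (≤-reflexive (Match.fewer ν ne p q adj xx xy))) le)
                                       (least (Match.matched ν ne p q adj xx xy))

    -- If x ⋈ t and t ⋈ y but ν₀ exposes x and y, a matching ν that exposes t and agrees with ν₀ as much as
    -- possible can be changed to agree with it more.
    module Improve {x t y} (xX : X x ≡ true) (yX : X y ≡ true) (x≢y : x ≢ y)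
                   (xt : ∀ (ν : Matching X) → deficiency ν ≤ deficiency M → μ ν x ≡ x → μ ν t ≡ t → ⊥)
                   (ty : ∀ (ν : Matching X) → deficiency ν ≤ deficiency M → μ ν t ≡ t → μ ν y ≡ y → ⊥)
                   (ν₀ : Matching X) (le₀ : deficiency ν₀ ≤ deficiency M) (x₀ : μ ν₀ x ≡ x) (y₀ : μ ν₀ y ≡ y) where

      agreement : Matching X → ℕ
      agreement ν = size (λ u → μ ν₀ u == μ ν u)

      module _ (ν : Matching X) (le : deficiency ν ≤ deficiency M) (νt : μ ν t ≡ t) where

        lost gained : Mask N
        lost   u = exposed ν₀ u ∧ not (exposed ν u)
        gained u = exposed ν u ∧ not (exposed ν₀ u)

        balance : size gained ≡ size lost
        balance = +-cancelˡ-≡ (size both) _ _ (trans (sym (part (exposed ν) (exposed ν₀)))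
          (trans (≤-antisym (≤-trans le (least ν₀)) (≤-trans le₀ (least ν)))
          (trans (part (exposed ν₀) (exposed ν)) (cong (_+ size lost) (size-cong (λ u → ∧-comm (exposed ν₀ u) (exposed ν u)))))))
          where
          both : Mask N
          both u = exposed ν u ∧ exposed ν₀ u
          part : ∀ (P Q : Mask N) → size P ≡ size (λ u → P u ∧ Q u) + size (λ u → P u ∧ not (Q u))
          part P Q = trans (size-partition P Q) (+-comm (size (λ u → P u ∧ not (Q u))) _)

        covered-lost : ∀ {u} → X u ≡ true → μ ν₀ u ≡ u → (μ ν u ≡ u → ⊥) → lost u ≡ true
        covered-lost {u} xu p q = ∧-intro (exposed-intro ν₀ p xu)
            (not-intro (¬true⇒false λ h → q (==⇒≡ {x = μ ν u} (proj₁ (∧-split h)))))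

        lost-x : lost x ≡ true
        lost-x = covered-lost xX x₀ (λ p → xt ν le p νt)

        lost-y : lost y ≡ true
        lost-y = covered-lost yX y₀ (λ p → ty ν le νt p)

        2≤gained : 2 ≤ size gained
        2≤gained = subst (2 ≤_) (sym balance)
            (≤-trans (s≤s (size-pos (lost ∖ x) (∖-∈ lost x lost-y x≢y))) (≤-reflexive (sym (size-∖ lost x lost-x))))

        -- `x` and `y` are exposed by `ν₀` but covered by `ν`. As the deficiencies are equal, at
        -- least two vertices are exposed by `ν` only, so one of them is not `t`.
        another : ∃ λ z → gained z ≡ true × t ≢ z
        another with gained t in gt
        ... | true  = let z , p = size-inhabited (gained ∖ t) (s≤s⁻¹ (≤-trans 2≤gained (≤-reflexive (size-∖ gained t gt)))) in
                      z , ∖-⊆ gained t z p , ∖-≢ gained t z p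
        ... | false = let z , p = size-inhabited gained (≤-trans (s≤s z≤n) 2≤gained) in
                      z , p , λ tz → true≢false (trans (cong gained tz) p) gt

        improve : Σ (Matching X) λ ν′ → deficiency ν′ ≤ deficiency M × μ ν′ t ≡ t × agreement ν < agreement ν′
        improve with another
        ... | z , gz , t≢z = matched , ≤-trans (≤-reflexive same) le , fixes-t , more-agreement
          where
          ez : exposed ν z ≡ true
          ez = proj₁ (∧-split {exposed ν z} gz)
          νz : μ ν z ≡ z
          νz = ==⇒≡ {x = μ ν z} (proj₁ (∧-split {μ ν z == z} ez))
          zX : X z ≡ true
          zX = proj₂ (∧-split {μ ν z == z} ez)
          -- The improvement gives `z` its partner in `ν₀`. By optimality `w` is matched in `ν`; its
          -- partner `r` becomes exposed in place of `z`. Neither `w` nor `r` agreed with `ν₀`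
          -- before, so only agreement is gained.
          w = μ ν₀ z
          w≢z : w ≢ z
          w≢z p = true≢false (exposed-intro ν₀ p zX) (not-true (proj₂ (∧-split {exposed ν z} gz)))
          wX : X w ≡ true
          wX = trans (X-invariant ν₀ z) zX
          zw : Adj z w
          zw = adj ν₀ z w≢z
          νw : μ ν w ≢ w
          νw p = [ (w≢z ∘ sym) , (λ f → f ν le νz p) ]′ (⋈-adj zX wX zw)
          open Unmatch ν νw using (r; unmatched; more)
          module U = Unmatch ν νw
          z≢r : z ≢ r
          z≢r p = w≢z (trans (sym (invol ν w)) (trans (cong (μ ν) (sym p)) νz))
          uz : μ unmatched z ≡ z
          uz = trans (U.f-else w≢z (z≢r ∘ sym)) νz
          open Match unmatched (w≢z ∘ sym) uz U.f-w zw zX wX using (matched; fewer)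
          module V = Match unmatched (w≢z ∘ sym) uz U.f-w zw zX wX
          same : deficiency matched ≡ deficiency ν
          same = +-cancelʳ-≡ 2 _ _ (trans fewer more)
          t≢w : t ≢ w
          t≢w refl = νw νt
          t≢r : t ≢ r
          t≢r p = t≢w (trans (trans (sym νt) (cong (μ ν) p)) (invol ν w))
          fixes-t : μ matched t ≡ t
          fixes-t = trans (V.f-else (t≢z ∘ sym) (t≢w ∘ sym)) (trans (U.f-else (t≢w ∘ sym) (t≢r ∘ sym)) νt)
          pt : ∀ u → 𝟙 (μ ν₀ u == μ ν u) + 𝟙 (z == u) ≤ 𝟙 (μ ν₀ u == μ matched u)
          pt u with V.case? u
          ... | V.is-x refl = ≤-reflexive (trans (cong₂ (λ p q → 𝟙 p + 𝟙 q) (trans (cong (w ==_) νz) (≢⇒== w≢z)) (==-refl z))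
                               (cong 𝟙 (sym (trans (cong (w ==_) V.f-x) (==-refl w)))))
          ... | V.is-y refl = ≤-trans (≤-reflexive
              (cong₂ (λ p q → 𝟙 p + 𝟙 q) (trans (cong (_== μ ν w) (invol ν₀ z)) (≢⇒== z≢r)) (≢⇒== (w≢z ∘ sym)))) z≤n
          ... | V.other p q with U.case? u
          ...   | U.is-w refl = ⊥-elim (q refl)
          ...   | U.is-r refl = ≤-trans (≤-reflexive (cong₂ (λ p q → 𝟙 p + 𝟙 q)
                                 (trans (cong (μ ν₀ r ==_) (invol ν w)) (≢⇒== (λ h → z≢r (injective ν₀ (sym h)))))
                                     (≢⇒== z≢r))) z≤n
          ...   | U.other p′ q′ = ≤-reflexive (trans (cong (λ s → 𝟙 (μ ν₀ u == μ ν u) + 𝟙 s) (≢⇒== p))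
                                   (trans (+-identityʳ _) (cong (λ s → 𝟙 (μ ν₀ u == s))
                                       (sym (trans (V.f-else p q) (U.f-else p′ q′))))))
          more-agreement : agreement ν < agreement matched
          more-agreement = begin
            suc (agreement ν) ≡⟨ +-comm 1 _ ⟩
            agreement ν + 1 ≡⟨ cong (agreement ν +_) (size-⁅⁆ z) ⟨
            agreement ν + size ⁅ z ⁆ ≡⟨ ∑-distrib-+ (λ u → 𝟙 (μ ν₀ u == μ ν u)) _ ⟨
            sum (λ u → 𝟙 (μ ν₀ u == μ ν u) + 𝟙 (z == u)) ≤⟨ sum-mono pt ⟩
            agreement matched ∎
            where open ≤-Reasoning

    ⋈-trans : ∀ {x t y} → X x ≡ true → X t ≡ true → X y ≡ true → x ⋈ t → t ⋈ y → ¬ ¬ (x ⋈ y)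
    ⋈-trans xX tX yX (inj₁ refl) q = return q
    ⋈-trans xX tX yX p (inj₁ refl) = return p
    ⋈-trans {x} {t} {y} xX tX yX (inj₂ xt) (inj₂ ty) with x ≟ y
    ... | yes p = return (inj₁ p)
    ... | no x≢y = return (inj₂ λ ν₀ le₀ x₀ y₀ → absurd ν₀ le₀ x₀ y₀ id)
      where
      absurd : ∀ (ν₀ : Matching X) → deficiency ν₀ ≤ deficiency M → μ ν₀ x ≡ x → μ ν₀ y ≡ y → ¬ ¬ ⊥
      absurd ν₀ le₀ x₀ y₀ = do
        (ν₁ , le₁ , t₁) ← exposable t tX
        (ν , (le , νt) , most) ← maximal (λ ν → deficiency ν ≤ deficiency M × μ ν t ≡ t) I.agreement N
            (λ ν _ → size-≤ (λ u → μ ν₀ u == μ ν u)) ν₁ (le₁ , t₁)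
        let (ν′ , le′ , νt′ , lt) = I.improve ν le νt
        return (<⇒≱ lt (most ν′ (le′ , νt′)))
        where module I = Improve xX yX x≢y xt ty ν₀ le₀ x₀ y₀

    certificate : ¬ ¬ Certificate X (deficiency M)
    certificate = do
      classes ← ¬¬-Fin (λ r → comprehension (λ x → X x ≡ true × r ⋈ x))
      return (build classes)
      where
      build : (∀ r → Σ (Fin N → Bool) λ f → ∀ v → (f v ≡ true → X v ≡ true × r ⋈ v) × (f v ≡ false → ¬ (X v ≡ true × r ⋈ v))) →
              Certificate X (deficiency M)
      build classes = record
        { Bar = ∅ ; I = exposed M ; K = C
        ; K⊆ = λ r x i k → proj₁ (elim r x k) , refl
        ; K-odd = C-odd
        ; K-closed = λ r x y i k xy yX → inj₁ (closed r x y (proj₂ (∧-split {μ M r == r} i)) k xy yX)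
        ; disjoint = C-disjoint
        ; count = ≤-reflexive (cong (_+ deficiency M) (sum-zero {N} (λ _ → refl))) }
        where
        C : Fin N → Fin N → Bool
        C r = proj₁ (classes r)
        elim : ∀ r x → C r x ≡ true → X x ≡ true × r ⋈ x
        elim r x = proj₁ (proj₂ (classes r) x)
        intro : ∀ r x → X x ≡ true → ¬ ¬ (r ⋈ x) → C r x ≡ true
        intro r x xX ¬¬rx with C r x in c
        ... | true  = refl
        ... | false = ⊥-elim (¬¬rx λ rx → proj₂ (proj₂ (classes r) x) c (xX , rx))
        closed : ∀ r x y → X r ≡ true → C r x ≡ true → Adj x y → X y ≡ true → C r y ≡ true
        closed r x y rX k xy yX = let xX , rx = elim r x k in intro r y yX (⋈-trans rX xX yX rx (⋈-adj xX yX xy))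
        only : ∀ {r s} → r ⋈ s → μ M r ≡ r → μ M s ≡ s → r ≡ s
        only (inj₁ p) _ _ = p
        only (inj₂ f) p q = ⊥-elim (f M ≤-refl p q)
        fix : ∀ {r} → exposed M r ≡ true → μ M r ≡ r
        fix {r} i = ==⇒≡ {x = μ M r} (proj₁ (∧-split i))
        C-disjoint : ∀ r s x → exposed M r ≡ true → exposed M s ≡ true → C r x ≡ true → C s x ≡ true → r ≡ s
        C-disjoint r s x i j k l with r ≟ s
        ... | yes p = p
        ... | no r≢s = ⊥-elim (⋈-trans (proj₂ (∧-split {μ M r == r} i)) (proj₁ (elim r x k)) (proj₂ (∧-split {μ M s == s} j))
                         (proj₂ (elim r x k)) (⋈-sym (proj₂ (elim s x l))) λ rs → r≢s (only rs (fix i) (fix j)))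
        -- `M` maps the class to itself, and `r` is its only exposed vertex because no two vertices
        -- of a class are exposed together.
        C-odd : ∀ r → exposed M r ≡ true → odd (size (C r)) ≡ true
        C-odd r i = trans (involution-parity (μ M) (invol M) (C r) invariant) (cong odd (trans (size-cong single) (size-⁅⁆ r)))
          where
          rX : X r ≡ true
          rX = proj₂ (∧-split {μ M r == r} i)
          step : ∀ x → C r x ≡ true → C r (μ M x) ≡ true
          step x k with μ M x ≟ x
          ... | yes p = trans (cong (C r) p) k
          ... | no p  = closed r x (μ M x) rX k (adj M x p) (trans (X-invariant M x) (proj₁ (elim r x k)))
          invariant : ∀ x → C r (μ M x) ≡ C r x
          invariant x with C r x in k
          ... | true  = step x k
          ... | false = ¬true⇒false λ h → true≢false (trans (cong (C r) (sym (invol M x))) (step (μ M x) h)) k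
          single : ∀ x → (μ M x == x) ∧ C r x ≡ (r == x)
          single x with r ≟ x
          ... | yes refl = ∧-intro (proj₁ (∧-split {μ M r == r} i)) (intro r r rX (return (inj₁ refl)))
          ... | no r≢x = ¬true⇒false λ h → let p , k = ∧-split {μ M x == x} h in
                           r≢x (only (proj₂ (elim r x k)) (fix i) (==⇒≡ {x = μ M x} p))

  -- Either every vertex of `X` is exposed by some optimal matching, and Gallai's lemma applies, or
  -- an essential vertex is deleted and joins the barrier of the smaller certificate.
  tutte-berge : ∀ k X → size X ≤ k → ¬ ¬ (Σ (Matching X) λ M → Certificate X (deficiency M))
  tutte-berge k X bound = do
    (M , _ , least) ← minimal (λ (_ : Matching X) → ⊤) deficiency (trivial X) tt
    inj₁ (b , xb , ess) ← em {A = ∃ λ b → X b ≡ true × (∀ (ν : Matching X) → deficiency ν ≤ deficiency M → μ ν b ≢ b)}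
      where inj₂ none → Gallai.certificate M (λ ν → least ν tt)
                          (λ x xX no-ν → none (x , xX , λ ν le p → no-ν (ν , le , p))) >>= λ C → return (M , C)
    (M′ , C) ← smaller k bound b xb
    return (M , essential M b xb ess M′ C)
    where
    smaller : ∀ k → size X ≤ k → ∀ b → X b ≡ true → ¬ ¬ (Σ (Matching (X ∖ b)) λ M → Certificate (X ∖ b) (deficiency M))
    smaller zero    bound b xb = ⊥-elim (<⇒≱ (size-pos X xb) bound)
    smaller (suc k) bound b xb = tutte-berge k (X ∖ b) (s≤s⁻¹ (≤-trans (≤-reflexive (sym (size-∖ X b xb))) bound))

-- Edge sets of prescribed parity

fibres : ∀ {n} (g : Fin n → ℕ) → ∃ λ N → Σ (Fin N → Fin n) λ φ → ∀ v → size (λ x → φ x == v) ≡ g v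
fibres {zero}  g = 0 , (λ ()) , λ ()
fibres {suc n} g with fibres (g ∘ suc)
... | N , φ , fib = g zero + N , φ′ , fib′
  where
  φ′ : Fin (g zero + N) → Fin (suc n)
  φ′ x = [ const zero , suc ∘ φ ]′ (splitAt (g zero) x)
  φ′-l : ∀ i → φ′ (i ↑ˡ N) ≡ zero
  φ′-l i = cong [ const zero , suc ∘ φ ]′ (splitAt-↑ˡ (g zero) i N)
  φ′-r : ∀ j → φ′ (g zero ↑ʳ j) ≡ suc (φ j)
  φ′-r j = cong [ const zero , suc ∘ φ ]′ (splitAt-↑ʳ (g zero) N j)
  fib′ : ∀ v → size (λ x → φ′ x == v) ≡ g v
  fib′ zero = trans (sum-split (g zero) (λ x → 𝟙 (φ′ x == zero)))
    (trans (cong₂ _+_ (trans (sum-cong-≗ (λ i → cong (λ u → 𝟙 (u == zero)) (φ′-l i))) (size-full (g zero)))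
                      (sum-zero (λ j → cong (λ u → 𝟙 (u == zero)) (φ′-r j)))) (+-identityʳ (g zero)))
  fib′ (suc v) = trans (sum-split (g zero) (λ x → 𝟙 (φ′ x == suc v)))
    (cong₂ _+_ (sum-zero (λ i → cong (λ u → 𝟙 (u == suc v)) (φ′-l i)))
               (trans (sum-cong-≗ (λ j → trans (cong (λ u → 𝟙 (u == suc v)) (φ′-r j)) (cong 𝟙 (suc-== (φ j) v)))) (fib v)))

odd-* : ∀ m n → odd (m * n) ≡ odd m ∧ odd n
odd-* zero    n = refl
odd-* (suc m) n = trans (odd-+ n (m * n)) (trans (cong (odd n xor_) (odd-* m n)) (pt (odd m) (odd n)))
  where
  pt : ∀ p q → q xor (p ∧ q) ≡ not p ∧ q
  pt = toWitness {a? = ∀Bool? λ p → ∀Bool? λ q → _ ≟ᵇ _} _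

module _ {n m : ℕ} (a b : Fin m → Fin n) (loopless : ∀ e → a e ≢ b e) (g : Fin n → ℕ) where
  open Multigraph a b
  open Loopless loopless

  module Copies {N : ℕ} (φ : Fin N → Fin n) (fib : ∀ v → size (λ x → φ x == v) ≡ g v) where

    -- The blow-up of the graph: the copies of a vertex form a clique, and copies of adjacent
    -- vertices are completely joined. Matching two copies of the same vertex uses up capacity two
    -- at a time, so the parity of `g` survives while the degree may fall below `g`.
    Adj : Fin N → Fin N → Set
    Adj x y = x ≢ y × (φ x ≡ φ y ⊎ ∃ λ e → Link e (φ x) (φ y))

    Adj-sym : ∀ {x y} → Adj x y → Adj y x
    Adj-sym (ne , inj₁ p)       = ne ∘ sym , inj₁ (sym p)
    Adj-sym (ne , inj₂ (e , l)) = ne ∘ sym , inj₂ (e , swap l)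

    open Matchings Adj Adj-sym

    sum-fibres : ∀ f → sum (f ∘ φ) ≡ sum (λ v → f v * g v)
    sum-fibres f = begin
      sum (f ∘ φ) ≡⟨ sum-cong-≗ (λ x → sum-select f (φ x)) ⟨
      sum (λ x → sum (λ v → f v * 𝟙 (φ x == v))) ≡⟨ ∑-comm (λ x v → f v * 𝟙 (φ x == v)) ⟩
      sum (λ v → sum (λ x → f v * 𝟙 (φ x == v))) ≡⟨ sum-cong-≗ (λ v → *-distribˡ-sum (f v) (λ x → 𝟙 (φ x == v))) ⟨
      sum (λ v → f v * size (λ x → φ x == v)) ≡⟨ sum-cong-≗ (λ v → cong (f v *_) (fib v)) ⟩
      sum (λ v → f v * g v) ∎
      where open ≡-Reasoning

    module _ (M : Matching full) (perfect : ∀ x → Matching.μ M x ≢ x) where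
      open Matching M

      chosen : Fin N → Fin m → ℕ
      chosen x e with φ x ≟ φ (μ x) | adj x (perfect x)
      ... | yes _ | _                 = 0
      ... | no _  | _ , inj₁ _        = 0
      ... | no _  | _ , inj₂ (e′ , _) = 𝟙 (e′ == e)

      leaves : Fin n → Fin N → ℕ
      leaves v x = 𝟙 (not (φ x == φ (μ x))) * 𝟙 (φ x == v)

      chosen-degree : ∀ v x → sum (λ e → chosen x e * inc e v) ≡ leaves v x + leaves v (μ x)
      chosen-degree v x rewrite invol x | ==-sym (φ (μ x)) (φ x) with φ x ≟ φ (μ x) | adj x (perfect x)
      ... | yes _ | _                = sum-zero {m} (λ _ → refl)
      ... | no ne | _ , inj₁ p       = ⊥-elim (ne p)
      ... | no _  | _ , inj₂ (e′ , l) = trans (sum-cong-≗ (λ e → *-comm (𝟙 (e′ == e)) (inc e v)))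
              (trans (sum-select (λ e → inc e v) e′)
                  (trans (link-inc l v) (sym (cong₂ _+_ (+-identityʳ (𝟙 (φ x == v))) (+-identityʳ (𝟙 (φ (μ x) == v)))))))

      -- The edges chosen at `x` and at `μ x` may differ, so each matched pair is read off at its
      -- smaller member only.
      multiplicity : Fin m → ℕ
      multiplicity e = sum (λ x → 𝟙 (does (x <ᶠ? μ x)) * chosen x e)

      total-leaves : ∀ v → sum (λ e → multiplicity e * inc e v) ≡ sum (leaves v)
      total-leaves v = trans swap-sums
          (*-cancelˡ-≡ h (sum (leaves v)) 2 (trans (sym (double h)) (trans halves (double (sum (leaves v))))))
        where
        open ≡-Reasoning
        f : Fin N → ℕ
        f x = leaves v x + leaves v (μ x)
        h = sum (λ x → 𝟙 (does (x <ᶠ? μ x)) * f x)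
        double : ∀ k → k + k ≡ 2 * k
        double = solve-∀
        swap-sums : sum (λ e → multiplicity e * inc e v) ≡ h
        swap-sums = begin
          sum (λ e → multiplicity e * inc e v)
            ≡⟨ sum-cong-≗ (λ e → *-distribʳ-sum (inc e v) (λ x → 𝟙 (does (x <ᶠ? μ x)) * chosen x e)) ⟩
          sum (λ e → sum (λ x → 𝟙 (does (x <ᶠ? μ x)) * chosen x e * inc e v))
            ≡⟨ ∑-comm (λ e x → 𝟙 (does (x <ᶠ? μ x)) * chosen x e * inc e v) ⟩
          sum (λ x → sum (λ e → 𝟙 (does (x <ᶠ? μ x)) * chosen x e * inc e v))
            ≡⟨ sum-cong-≗ (λ x → trans (sum-cong-≗ (λ e → *-assoc (𝟙 (does (x <ᶠ? μ x))) (chosen x e) (inc e v)))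
                 (trans (sym (*-distribˡ-sum (𝟙 (does (x <ᶠ? μ x))) (λ e → chosen x e * inc e v)))
                     (cong (𝟙 (does (x <ᶠ? μ x)) *_) (chosen-degree v x)))) ⟩
          h ∎
        halves : h + h ≡ sum (leaves v) + sum (leaves v)
        halves = begin
          h + h
            ≡⟨ cong (_+ (h + h)) (sum-zero (λ x → cong (λ p → 𝟙 p * f x) (≢⇒== (perfect x)))) ⟨
          sum (λ x → 𝟙 (μ x == x) * f x) + (h + h)
            ≡⟨ involution-halves μ invol f (λ x → trans (cong (λ y → leaves v (μ x) + leaves v y) (invol x))
                (+-comm (leaves v (μ x)) _)) ⟨
          sum f
            ≡⟨ ∑-distrib-+ (leaves v) (leaves v ∘ μ) ⟩
          sum (leaves v) + sum (leaves v ∘ μ)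
            ≡⟨ cong (sum (leaves v) +_) (sum-involution μ invol (leaves v)) ⟩
          sum (leaves v) + sum (leaves v) ∎

      -- An edge may be chosen by several matched pairs. Reducing modulo 2 keeps all degree parities
      -- and can only lower the degrees.
      D : Mask m
      D e = odd (multiplicity e)

      stays : Fin n → Fin N → Bool
      stays v x = (φ x == φ (μ x)) ∧ (φ x == v)

      fibre-split : ∀ v → g v ≡ sum (leaves v) + size (stays v)
      fibre-split v = trans (sym (fib v)) (trans (sum-cong-≗ (λ x → pt (φ x == φ (μ x)) (φ x == v))) (∑-distrib-+ (leaves v) _))
        where
        pt : ∀ p q → 𝟙 q ≡ 𝟙 (not p) * 𝟙 q + 𝟙 (p ∧ q)
        pt = toWitness {a? = ∀Bool? λ p → ∀Bool? λ q → _ ≟ℕ _} _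

      stays-even : ∀ v → odd (size (stays v)) ≡ false
      stays-even v = trans (involution-parity μ invol (stays v) invariant)
        (cong odd (sum-zero (λ x → cong (λ p → 𝟙 (p ∧ stays v x)) (≢⇒== (perfect x)))))
        where
        invariant : ∀ x → stays v (μ x) ≡ stays v x
        invariant x rewrite invol x with φ x ≟ φ (μ x)
        ... | yes p rewrite sym p | ==-refl (φ x) = refl
        ... | no ne rewrite ≢⇒== (ne ∘ sym) = refl

      D-bounded : ∀ v → deg D v ≤ g v
      D-bounded v = begin
        deg D v ≤⟨ sum-mono (λ e → *-monoˡ-≤ (inc e v) (𝟙-odd (multiplicity e))) ⟩
        sum (λ e → multiplicity e * inc e v) ≡⟨ total-leaves v ⟩
        sum (leaves v) ≤⟨ m≤m+n _ _ ⟩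
        sum (leaves v) + size (stays v) ≡⟨ fibre-split v ⟨
        g v ∎
        where
        open ≤-Reasoning
        𝟙-odd : ∀ k → 𝟙 (odd k) ≤ k
        𝟙-odd zero = z≤n
        𝟙-odd (suc k) with not (odd k)
        ... | true  = s≤s z≤n
        ... | false = z≤n

      D-parity : ∀ v → odd (deg D v) ≡ odd (g v)
      D-parity v = begin
        odd (deg D v) ≡⟨ sum-odd-cong (λ e → trans (odd-* (𝟙 (D e)) (inc e v))
            (trans (cong (_∧ odd (inc e v)) (odd-𝟙 (D e))) (sym (odd-* (multiplicity e) (inc e v))))) ⟩
        odd (sum (λ e → multiplicity e * inc e v)) ≡⟨ cong odd (total-leaves v) ⟩
        odd (sum (leaves v)) ≡⟨ xor-identityʳ _ ⟨
        odd (sum (leaves v)) xor false ≡⟨ cong (odd (sum (leaves v)) xor_) (stays-even v) ⟨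
        odd (sum (leaves v)) xor odd (size (stays v)) ≡⟨ odd-+ (sum (leaves v)) _ ⟨
        odd (sum (leaves v) + size (stays v)) ≡⟨ cong odd (fibre-split v) ⟨
        odd (g v) ∎
        where
        open ≡-Reasoning

    module _ (cuts : MinCut 3 full)
             (parity : ∀ v → odd (g v) ≡ odd (deg full v)) (capacity : ∀ v → deg full v ≤ 3 * g v) where
      open Certificate

      -- A vertex with an edge has positive degree, and `capacity` then forces at least one copy of
      -- it.
      copy : ∀ {e u v} → Link e u v → ∃ λ y → φ y ≡ v
      copy {e} {u} {v} l with g v in gv
      ... | zero = ⊥-elim (<⇒≱ (s≤s z≤n) (≤-trans pos (≤-trans (capacity v) (≤-reflexive (trans (cong (3 *_) gv) refl)))))
        where
        pos : 1 ≤ deg full v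
        pos = ≤-trans (≤-reflexive (sym (trans (+-identityʳ (inc e v)) (link-inc-end (swap l))))) (sum-≥ (λ e → 1 * inc e v) e)
      ... | suc k = let y , p = size-inhabited (λ x → φ x == v) (≤-trans (s≤s z≤n) (≤-reflexive (sym (trans (fib v) gv)))) in
                    y , ==⇒≡ {x = φ y} p

      -- In a certificate with smallest barrier, the barrier contains all copies of a vertex or none:
      -- a copy whose twin y is missing touches only the class of y, so both can be dropped.
      saturated : (C : Certificate full 1) → (∀ (C′ : Certificate full 1) → size (Bar C) ≤ size (Bar C′)) →
                  ∀ x y → φ x ≡ φ y → Bar C x ≡ true → Bar C y ≡ true
      saturated C least x y xy bx with Bar C y in by
      ... | true  = refl
      ... | false = ⊥-elim (<⇒≱ (≤-reflexive (sym (size-∖ (Bar C) x bx))) (least C′))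
        where
        Bar′ I′ : Mask N
        Bar′ = Bar C ∖ x
        I′ r = I C r ∧ not (K C r y)
        shrink : size (I C) ≤ size I′ + 1
        shrink = ≤-trans (≤-reflexive (size-partition (I C) (λ r → K C r y)))
          (+-monoʳ-≤ (size I′) (at-most-one (λ r → I C r ∧ K C r y) λ r s p q →
            let i , k = ∧-split {I C r} p ; j , l = ∧-split {I C s} q in disjoint C r s y i j k l))
        I′⇒ : ∀ r → I′ r ≡ true → I C r ≡ true × K C r y ≡ false
        I′⇒ r i = let p , q = ∧-split {I C r} i in p , not-true q
        closed : ∀ r z u → I′ r ≡ true → K C r z ≡ true → Adj z u → full u ≡ true → K C r u ≡ true ⊎ Bar′ u ≡ true
        closed r z u i k zu _ with I′⇒ r i
        ... | ir , ry with K-closed C r z u ir k zu refl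
        ...   | inj₁ ku = inj₁ ku
        ...   | inj₂ bu with x ≟ u
        ...     | no x≢u = inj₂ (∧-intro bu refl)
        ...     | yes refl with z ≟ y
        ...       | yes refl = ⊥-elim (true≢false k ry)
        ...       | no z≢y with K-closed C r z y ir k (z≢y , subst (λ v → φ z ≡ v ⊎ ∃ λ e → Link e (φ z) v) xy (proj₂ zu)) refl
        ...         | inj₁ ky = ⊥-elim (true≢false ky ry)
        ...         | inj₂ by′ = ⊥-elim (true≢false by′ by)
        C′ : Certificate full 1
        C′ = record
          { Bar = Bar′ ; I = I′ ; K = K C
          ; K⊆ = λ r z i k → refl , cong (_∧ not (x == z)) (proj₂ (K⊆ C r z (proj₁ (I′⇒ r i)) k))
          ; K-odd = λ r i → K-odd C r (proj₁ (I′⇒ r i))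
          ; K-closed = closed
          ; disjoint = λ r s z i j → disjoint C r s z (proj₁ (I′⇒ r i)) (proj₁ (I′⇒ s j))
          ; count = +-cancelʳ-≤ 1 _ _ (≤-trans
              (≤-reflexive (cong (_+ 1) (trans (+-comm (size Bar′) 1) (sym (size-∖ (Bar C) x bx)))))
                      (≤-trans (count C) shrink)) }

      -- With a smallest barrier, the barrier and the classes are unions of fibres and become vertex
      -- sets `U` and `W r` of the graph. The parity of `g` makes the cut of `W r` odd, hence
      -- nonempty, hence of size at least 3. All these edges end in `U`, whose degrees sum to at
      -- most 3|Bar|, so there are at most |Bar| classes, one too few.
      no-certificate : ¬ Certificate full 1
      no-certificate C₀ = contradiction id
        where
        contradiction : ¬ ¬ ⊥
        contradiction = do
          (C , _ , smallest) ← minimal (λ (_ : Certificate full 1) → ⊤) (size ∘ Bar) C₀ tt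
          (U , U-spec) ← comprehension (λ v → ∃ λ x → φ x ≡ v × Bar C x ≡ true)
          W ← ¬¬-Fin (λ r → comprehension (λ v → ∃ λ x → φ x ≡ v × K C r x ≡ true))
          return (count-cuts C (saturated C (λ C′ → smallest C′ tt)) U U-spec W)
          where
          Spec : Mask n → (Fin n → Set) → Set
          Spec f P = ∀ v → (f v ≡ true → P v) × (f v ≡ false → ¬ P v)

          count-cuts : (C : Certificate full 1) → (∀ x y → φ x ≡ φ y → Bar C x ≡ true → Bar C y ≡ true) →
                       ∀ U → Spec U (λ v → ∃ λ x → φ x ≡ v × Bar C x ≡ true) →
                       (∀ r → Σ (Fin n → Bool) λ W → Spec W (λ v → ∃ λ x → φ x ≡ v × K C r x ≡ true)) → ⊥
          count-cuts C sat U U-spec Ws = <⇒≱ (≤-trans (≤-reflexive (+-comm 1 (size (Bar C)))) (count C)) (*-cancelˡ-≤ 3 (begin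
            3 * size (I C)
              ≡⟨ *-distribˡ-sum 3 (𝟙 ∘ I C) ⟩
            sum (λ r → 3 * 𝟙 (I C r))
              ≤⟨ sum-mono three ⟩
            sum (λ r → 𝟙 (I C r) * cut full (W r))
              ≡⟨ sum-cong-≗ (λ r → *-distribˡ-sum (𝟙 (I C r)) (𝟙 ∘ crosses (W r))) ⟩
            sum (λ r → sum (λ e → 𝟙 (I C r) * 𝟙 (crosses (W r) e)))
              ≡⟨ ∑-comm (λ r e → 𝟙 (I C r) * 𝟙 (crosses (W r) e)) ⟩
            sum (λ e → sum (λ r → 𝟙 (I C r) * 𝟙 (crosses (W r) e)))
              ≤⟨ sum-mono edge ⟩
            sum (λ e → 1 * (𝟙 (U (a e)) + 𝟙 (U (b e))))
              ≡⟨ handshake full U ⟨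
            sum (λ v → 𝟙 (U v) * deg full v)
              ≤⟨ sum-mono (λ v → *-monoʳ-≤ (𝟙 (U v)) (capacity v)) ⟩
            sum (λ v → 𝟙 (U v) * (3 * g v))
              ≡⟨ sum-cong-≗ (λ v → shift (𝟙 (U v)) (g v)) ⟩
            sum (λ v → 3 * (𝟙 (U v) * g v))
              ≡⟨ *-distribˡ-sum 3 (λ v → 𝟙 (U v) * g v) ⟨
            3 * sum (λ v → 𝟙 (U v) * g v)
              ≡⟨ cong (3 *_) (trans (sym (sum-fibres (𝟙 ∘ U))) (sum-cong-≗ (λ x → cong 𝟙 (U-φ x)))) ⟩
            3 * size (Bar C) ∎))
            where
            open ≤-Reasoning
            shift : ∀ p k → p * (3 * k) ≡ 3 * (p * k)
            shift = solve-∀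
            W : Fin N → Fin n → Bool
            W r = proj₁ (Ws r)
            spec-intro : ∀ {f P} → Spec f P → ∀ v → P v → f v ≡ true
            spec-intro {f} sp v p with f v in fv
            ... | true  = refl
            ... | false = ⊥-elim (proj₂ (sp v) fv p)
            U-φ : ∀ x → U (φ x) ≡ Bar C x
            U-φ x = bool-ext (λ u → let y , p , by = proj₁ (U-spec (φ x)) u in sat y x p by)
                             (λ bx → spec-intro U-spec (φ x) (x , refl , bx))
            K-twin : ∀ r x y → I C r ≡ true → φ x ≡ φ y → K C r x ≡ true → K C r y ≡ true
            K-twin r x y i p k with x ≟ y
            ... | yes refl = k
            ... | no x≢y with K-closed C r x y i k (x≢y , inj₁ p) refl
            ...   | inj₁ ky = ky
            ...   | inj₂ by = ⊥-elim (true≢false (sat y x (sym p) by) (proj₂ (K⊆ C r x i k)))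
            W-φ : ∀ r → I C r ≡ true → ∀ x → W r (φ x) ≡ K C r x
            W-φ r i x = bool-ext (λ w → let y , p , ky = proj₁ (proj₂ (Ws r) (φ x)) w in K-twin r y x i p ky)
                                 (λ k → spec-intro (proj₂ (Ws r)) (φ x) (x , refl , k))
            cut-odd : ∀ r → I C r ≡ true → odd (cut full (W r)) ≡ true
            cut-odd r i =
              trans (odd-cut full (W r))
              (trans (sum-odd-cong (λ v → trans (odd-* (𝟙 (W r v)) (deg full v))
                                         (trans (cong (odd (𝟙 (W r v)) ∧_) (sym (parity v))) (sym (odd-* (𝟙 (W r v)) (g v))))))
              (trans (cong odd (sym (sum-fibres (𝟙 ∘ W r))))
              (trans (cong odd (sum-cong-≗ (λ x → cong 𝟙 (W-φ r i x))))
                     (K-odd C r i))))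
            three : ∀ r → 3 * 𝟙 (I C r) ≤ 𝟙 (I C r) * cut full (W r)
            three r with I C r in i
            ... | false = z≤n
            ... | true  = ≤-trans (3≤cut (cut full (W r)) refl) (≤-reflexive (sym (+-identityʳ _)))
              where
              3≤cut : ∀ k → cut full (W r) ≡ k → 3 ≤ cut full (W r)
              3≤cut zero    eq = ⊥-elim (true≢false (cut-odd r i) (cong odd eq))
              3≤cut (suc k) eq with size-inhabited (crosses (W r)) (≤-trans (s≤s z≤n) (≤-reflexive (sym eq)))
              ... | e , c with crosses-link {W r} e c
              ...   | u , v , _ , wu , wv = cuts (W r) wu wv
            blocked : ∀ r {e u v} → I C r ≡ true → Link e u v → W r u ≡ true → W r v ≡ false → U v ≡ true
            blocked r {e} {u} {v} i l wu wv with proj₁ (proj₂ (Ws r) u) wu | copy l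
            ... | x , refl , kx | y , refl with K-closed C r x y i kx ((λ { refl → link-≢ l refl }) , inj₂ (e , l)) refl
            ...   | inj₁ ky = ⊥-elim (true≢false (spec-intro (proj₂ (Ws r)) v (y , refl , ky)) wv)
            ...   | inj₂ by = spec-intro U-spec v (y , refl , by)
            owner : ∀ v r s → I C r ∧ W r v ≡ true → I C s ∧ W s v ≡ true → r ≡ s
            owner v r s p q = let i , w = ∧-split {I C r} p ; j , w′ = ∧-split {I C s} q
                                  x , φx , kx = proj₁ (proj₂ (Ws r) v) w ; y , φy , ky = proj₁ (proj₂ (Ws s) v) w′ in
                              disjoint C r s x i j kx (K-twin s y x j (trans φy (sym φx)) ky)
            -- When an edge leaves a class, its other end lies in `U` and pays for it; since an end
            -- belongs to at most one class, no end in `U` pays twice.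
            edge : ∀ e → sum (λ r → 𝟙 (I C r) * 𝟙 (crosses (W r) e)) ≤ 1 * (𝟙 (U (a e)) + 𝟙 (U (b e)))
            edge e = begin
              sum (λ r → 𝟙 (I C r) * 𝟙 (crosses (W r) e))
                ≤⟨ sum-mono (λ r → pt (I C r) (W r (a e)) (W r (b e)) (U (a e)) (U (b e))
                     (λ i p q → blocked r i (inj₁ (refl , refl)) p q) (λ i p q → blocked r i (inj₂ (refl , refl)) q p)) ⟩
              sum (λ r → 𝟙 (U (b e)) * 𝟙 (I C r ∧ W r (a e)) + 𝟙 (U (a e)) * 𝟙 (I C r ∧ W r (b e)))
                ≡⟨ trans (∑-distrib-+ (λ r → 𝟙 (U (b e)) * 𝟙 (I C r ∧ W r (a e))) _)
                     (sym (cong₂ _+_ (*-distribˡ-sum (𝟙 (U (b e))) (λ r → 𝟙 (I C r ∧ W r (a e))))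
                         (*-distribˡ-sum (𝟙 (U (a e))) (λ r → 𝟙 (I C r ∧ W r (b e)))))) ⟩
              𝟙 (U (b e)) * size (λ r → I C r ∧ W r (a e)) + 𝟙 (U (a e)) * size (λ r → I C r ∧ W r (b e))
                ≤⟨ +-mono-≤ (*-monoʳ-≤ (𝟙 (U (b e))) (at-most-one _ (owner (a e))))
                    (*-monoʳ-≤ (𝟙 (U (a e))) (at-most-one _ (owner (b e)))) ⟩
              𝟙 (U (b e)) * 1 + 𝟙 (U (a e)) * 1
                ≡⟨ flip (𝟙 (U (a e))) (𝟙 (U (b e))) ⟩
              1 * (𝟙 (U (a e)) + 𝟙 (U (b e))) ∎
              where
              flip : ∀ p q → q * 1 + p * 1 ≡ 1 * (p + q)
              flip = solve-∀
              pt : ∀ i x y p q → (i ≡ true → x ≡ true → y ≡ false → q ≡ true) → (i ≡ true → x ≡ false → y ≡ true → p ≡ true) →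
                   𝟙 i * 𝟙 (x xor y) ≤ 𝟙 q * 𝟙 (i ∧ x) + 𝟙 p * 𝟙 (i ∧ y)
              pt false x y p q f h = z≤n
              pt true true  true  p q f h = z≤n
              pt true false false p q f h = z≤n
              pt true true  false p q f h rewrite f refl refl refl = s≤s z≤n
              pt true false true  p q f h rewrite h refl refl refl | *-zeroʳ (𝟙 q) = s≤s z≤n

  parity-subgraph : MinCut 3 full →
                    (∀ v → odd (g v) ≡ odd (deg full v)) → (∀ v → deg full v ≤ 3 * g v) →
                    ¬ ¬ (∃ λ D → (∀ v → deg D v ≤ g v) × (∀ v → odd (deg D v) ≡ odd (g v)))
  parity-subgraph cuts parity capacity with fibres g
  ... | N , φ , fib = do
      (M , C) ← tutte-berge N full (size-≤ full)
      return (from M C)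
    where
    open Copies φ fib
    open Matchings Adj Adj-sym
    from : (M : Matching full) → Certificate full (Matching.deficiency M) → ∃ λ D → (∀ v → deg D v ≤ g v) ×
        (∀ v → odd (deg D v) ≡ odd (g v))
    from M C with Matching.deficiency M in d
    ... | suc k = ⊥-elim (no-certificate cuts parity capacity
        (record { Certificate C ; count = ≤-trans (+-monoʳ-≤ _ (s≤s (z≤n {k}))) (Certificate.count C) }))
    ... | zero = D M perfect , D-bounded M perfect , D-parity M perfect
      where
      perfect : ∀ x → Matching.μ M x ≢ x
      perfect x p = <⇒≱ (s≤s z≤n) (≤-trans (size-pos (Matching.exposed M) (Matching.exposed-intro M p refl)) (≤-reflexive d))

open import Data.Integer using (+_; -[1+_]) renaming (_≤_ to _≤ℤ_)

-- Ceilings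

≤-ceiling : ∀ p → ↥ p ≤ℤ ceiling p ℤ.* ↧ p
≤-ceiling p@(mkℚ _ _ _) = begin
  ↥ p ≡⟨ ℤ.neg-involutive (↥ p) ⟨
  ℤ.- (ℤ.- ↥ p) ≡⟨ cong ℤ.-_ (↥-neg p) ⟨
  ℤ.- (↥ (ℚ.- p)) ≤⟨ ℤ.neg-mono-≤ (floor-≤ (ℚ.- p)) ⟩
  ℤ.- (floor (ℚ.- p) ℤ.* ↧ (ℚ.- p)) ≡⟨ ℤ.neg-distribˡ-* (floor (ℚ.- p)) (↧ (ℚ.- p)) ⟩
  ceiling p ℤ.* ↧ (ℚ.- p) ≡⟨ cong (λ k → ceiling p ℤ.* k) (↧-neg p) ⟩
  ceiling p ℤ.* ↧ p ∎
  where
  open ℤ.≤-Reasoning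
  floor-≤ : ∀ q → floor q ℤ.* ↧ q ≤ℤ ↥ q
  floor-≤ q@(mkℚ _ _ _) = [n/d]*d≤n (↥ q) (↧ q)

≤-ceiling-/ : ∀ i N .{{_ : NonZero N}} → i ≤ℤ ceiling (i / N) ℤ.* + N
≤-ceiling-/ i N = begin
  i ≡⟨ ↥-/ i N ⟨
  ↥ (i / N) ℤ.* gcd i (+ N) ≤⟨ ℤ.*-monoʳ-≤-nonNeg (gcd i (+ N)) (≤-ceiling (i / N)) ⟩
  ceiling (i / N) ℤ.* ↧ (i / N) ℤ.* gcd i (+ N) ≡⟨ ℤ.*-assoc (ceiling (i / N)) _ _ ⟩
  ceiling (i / N) ℤ.* (↧ (i / N) ℤ.* gcd i (+ N)) ≡⟨ cong (λ k → ceiling (i / N) ℤ.* k) (↧-/ i N) ⟩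
  ceiling (i / N) ℤ.* + N ∎
  where open ℤ.≤-Reasoning

-- A negative ceiling is at most -1 and forces the second alternative, which the uses refute from
-- `4 ≤ k` or from `k ≤ d`.
ceiling-cases : ∀ x y N .{{_ : NonZero N}} →
  (∃ λ q → ceiling ((+ x ℤ.- + y) / N) ≡ + q × x ≤ q * N + y) ⊎ x + N ≤ y
ceiling-cases x y N with ceiling ((+ x ℤ.- + y) / N) | ≤-ceiling-/ (+ x ℤ.- + y) N
... | + q | le = inj₁ (q , refl , ℤ.drop‿+≤+ (begin
    + x ≡⟨ restore (+ x) (+ y) ⟩
    + x ℤ.- + y ℤ.+ + y ≤⟨ ℤ.+-monoˡ-≤ (+ y) le ⟩
    + q ℤ.* + N ℤ.+ + y ≡⟨ cong (λ k → k ℤ.+ + y) (ℤ.pos-* q N) ⟨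
    + (q * N) ℤ.+ + y ∎))
  where
  open ℤ.≤-Reasoning
  restore : ∀ a b → a ≡ a ℤ.- b ℤ.+ b
  restore = ℤ-Solver.solve-∀
... | -[1+ q ] | le = inj₂ (≤-trans (+-monoʳ-≤ x (m≤m+n N (q * N))) (ℤ.drop‿+≤+ (begin
    + (x + suc q * N) ≡⟨ cong (λ k → + x ℤ.+ k) (ℤ.pos-* (suc q) N) ⟩
    + x ℤ.+ + suc q ℤ.* + N ≡⟨ restore (+ x) (+ y) (+ suc q ℤ.* + N) ⟩
    + x ℤ.- + y ℤ.+ (+ y ℤ.+ + suc q ℤ.* + N) ≤⟨ ℤ.+-monoˡ-≤ (+ y ℤ.+ + suc q ℤ.* + N) le ⟩
    -[1+ q ] ℤ.* + N ℤ.+ (+ y ℤ.+ + suc q ℤ.* + N) ≡⟨ cancel (+ suc q) (+ N) (+ y) ⟩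
    + y ∎)))
  where
  open ℤ.≤-Reasoning
  restore : ∀ a b c → a ℤ.+ c ≡ a ℤ.- b ℤ.+ (b ℤ.+ c)
  restore = ℤ-Solver.solve-∀
  cancel : ∀ a c b → ℤ.- a ℤ.* c ℤ.+ (b ℤ.+ a ℤ.* c) ≡ b
  cancel = ℤ-Solver.solve-∀

-- Degrees and cuts of the given graph, and the search for a suitable edge set.

length-filter : ∀ {A : Set} {P : A → Set} (P? : ∀ x → Dec (P x)) {m} (f : Fin m → A) →
                length (filter P? (tabulate f)) ≡ size (λ i → does (P? (f i)))
length-filter P? {zero}  f = refl
length-filter P? {suc m} f with P? (f zero)
... | yes _ = cong suc (length-filter P? (f ∘ suc))
... | no _  = length-filter P? (f ∘ suc)

module _ (G : Graph) where
  open Multigraph (src G) (tgt G)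
  open Trails G using (joins⇒link)

  degree≡deg : ∀ v → degree G v ≡ deg full v
  degree≡deg v = trans (length-filter (λ e → (proj₁ (ends G e) ≟ v) ⊎-dec (proj₂ (ends G e) ≟ v)) id) (sum-cong-≗ pt)
    where
    pt : ∀ e → 𝟙 (does ((src G e ≟ v) ⊎-dec (tgt G e ≟ v))) ≡ 1 * inc e v
    pt e with src G e ≟ v | tgt G e ≟ v
    ... | yes p | yes q = ⊥-elim (loopless G e (trans p (sym q)))
    ... | yes _ | no _  = refl
    ... | no _  | yes _ = refl
    ... | no _  | no _  = refl

  edge-cuts : ∀ {k} → EdgeConnected k G → MinCut k full
  edge-cuts {k} (_ , conn) Y {x} {y} yx yy = ≮⇒≥ λ lt →
    let W , avoids = conn F (≤-trans (s≤s (≤-reflexive count)) lt) x y in crossing W avoids yx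
    where
    crosses? : ∀ e → Dec (crosses Y e ≡ true)
    crosses? e = crosses Y e ≟ᵇ true
    F = filter crosses? (allFin (m G))
    count : length F ≡ cut full Y
    count = trans (length-filter crosses? id) (size-cong (λ e → pt (crosses Y e)))
      where
      pt : ∀ p → does (p ≟ᵇ true) ≡ p
      pt true = refl
      pt false = refl
    crossing : ∀ {u} (W : Walk G u y) → All (_∉ F) (edges W) → Y u ≡ true → ⊥
    crossing nil _ yu = true≢false yu yy
    crossing (cons {x = w} e j W) (e∉ ∷ rest) yu with Y w in yw
    ... | true  = crossing W rest yw
    ... | false = e∉ (∈-filter⁺ crosses? (∈-allFin e) (link-crosses {Y} (joins⇒link j) yu yw))

  -- With at least two vertices a singleton defines a proper cut, and its edges are incident with
  -- `v`.
  min-degree : ∀ {k} → EdgeConnected k G → ∀ v → k ≤ deg full v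
  min-degree ec@(1<n , _) v with all-or-missing ⁅ v ⁆
  ... | inj₁ all = ⊥-elim (<⇒≱ 1<n (≤-reflexive (trans (sym (size-full (n G))) (trans (sym (size-cong all)) (size-⁅⁆ v)))))
  ... | inj₂ (w , out) = ≤-trans (edge-cuts ec ⁅ v ⁆ (==-refl v) out) (sum-mono pt)
    where
    pt : ∀ e → 𝟙 (crosses ⁅ v ⁆ e) ≤ 1 * inc e v
    pt e rewrite ==-sym v (src G e) | ==-sym v (tgt G e) = bools (src G e == v) (tgt G e == v)
      where
      bools : ∀ p q → 𝟙 (p xor q) ≤ 1 * (𝟙 p + 𝟙 q)
      bools = toWitness {a? = ∀Bool? λ p → ∀Bool? λ q → _ ≤? _} _

  Good : (Fin (n G) → ℕ) → Mask (m G) → Set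
  Good f M = Eulerian _ _ (loopless G) M × (∀ v → deg M v ≤ 2 * f v)

  good-cong : ∀ {f M M′} → (∀ e → M e ≡ M′ e) → Good f M → Good f M′
  good-cong {f} {M} {M′} eq (eul , bound) =
    record { even = λ v → trans (cong odd (sym (degs v))) (even v)
           ; connects = λ Y xx yx xy yy → let e , me , r = connects Y xx yx xy yy in e , trans (sym (eq e)) me , r } ,
    λ v → ≤-trans (≤-reflexive (sym (degs v))) (bound v)
    where
    open Eulerian eul
    degs : ∀ v → deg M v ≡ deg M′ v
    degs v = sum-cong-≗ (λ e → cong (λ p → 𝟙 p * inc e v) (eq e))

  -- A failure of connectedness is searched for among the vectors of `Subset`, which can be
  -- enumerated; `tabulateᵛ` carries an arbitrary mask over to them.
  connects? : ∀ M → Dec (Connects M full)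
  connects? M = map′ to from (¬? (anySubset? λ s → any? (λ x → lookup s x ≟ᵇ true) ×-dec any? (λ y → lookup s y ≟ᵇ false)
                                     ×-dec ¬? (crossing? (lookup s))))
    where
    crossing? : ∀ (Y : Mask (n G)) → Dec (∃ λ e → M e ≡ true × crosses Y e ≡ true)
    crossing? Y = any? (λ e → (M e ≟ᵇ true) ×-dec (crosses Y e ≟ᵇ true))
    to : _ → Connects M full
    to none Y {x} {y} _ yx _ yy with crossing? Y
    ... | yes (e , me , c) = e , me , refl , c
    ... | no no-edge = ⊥-elim (none (tabulateᵛ Y , (x , trans (lookup∘tabulate Y x) yx) , (y , trans (lookup∘tabulate Y y) yy) ,
            λ (e , me , c) → no-edge (e , me , trans (cong₂ _xor_ (sym (lookup∘tabulate Y _)) (sym (lookup∘tabulate Y _))) c)))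
    from : Connects M full → _
    from conn (s , (x , sx) , (y , sy) , none) = let e , me , _ , c = conn (lookup s) {x} {y} refl sx refl sy in none (e , me , c)

  good? : ∀ f M → Dec (Good f M)
  good? f M = map′ (λ (ev , conn , bound) → record { even = ev ; connects = conn } , bound)
                   (λ (eul , bound) → Eulerian.even eul , Eulerian.connects eul , bound)
                   (all? (λ v → odd (deg M v) ≟ᵇ false) ×-dec connects? M ×-dec all? (λ v → deg M v ≤? 2 * f v))

  closed-trail : 1 < n G → ∀ f → ¬ ¬ (∃ λ M → Good f M) →
    Σ (Fin (n G)) λ s → Σ (Walk G s s) λ W → IsTrail W × Spanning W × (∀ v → times W v ≤ f v)
  closed-trail 1<n f ¬¬M = trace (decidable-stable (anySubset? (λ s → good? f (lookup s))) (¬¬M >>= encode))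
    where
    encode : (∃ λ M → Good f M) → ¬ ¬ (∃ λ (s : Subset (m G)) → Good f (lookup s))
    encode (M , good) = return (tabulateᵛ M , good-cong {f} {M} (λ e → sym (lookup∘tabulate M e)) good)
    trace : (∃ λ (s : Subset (m G)) → Good f (lookup s)) → _
    trace (s , eul , bound) = Trails.spanning-closed-trail G 1<n (lookup s) eul f bound

  -- The cap is taken to be `2f + 1`, which turns the weight condition of `tight-feasible` into the
  -- hypothesis here; evenness then removes the extra 1.
  good-subgraph : ∀ κ A f → 1 < n G → MinCut (4 + κ) A →
    (∀ v → 2 * deg A v + 3 * (4 + κ) ≤ 2 * (4 + κ) * f v + 8) → ¬ ¬ (∃ λ M → Good f M)
  good-subgraph κ A f 1<n cuts weight = do
    (H , fH , tH) ← tight-feasible (src G) (tgt G) (loopless G) A (λ v → 2 * f v + 1) κ cuts weight′ v₀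
    P ← packing (pred (n G)) (src G) (tgt G) (loopless G) H full (trans (size-full (n G)) (sym (suc-pred (n G))))
        (Feasible.sparse fH) tH
    let M , M⊆ , eul = eulerian (src G) (tgt G) (loopless G) P v₀
    return (M , eul , λ v → even-≤ (f v) (Eulerian.even eul v)
      (≤-trans (sum-mono (λ e → *-monoˡ-≤ (inc e v) (𝟙-mono (M⊆ e)))) (Feasible.bounded fH v)))
    where
    open Exchange.Bounded (src G) (tgt G) (loopless G) A (λ v → 2 * f v + 1)
    instance _ = >-nonZero (≤-trans (s≤s z≤n) 1<n)
    v₀ : Fin (n G)
    v₀ = fromℕ< (≤-trans (s≤s z≤n) 1<n)
    weight′ : ∀ v → 2 * deg A v + 4 * (4 + κ) ≤ (4 + κ) * (2 * f v + 1) + 8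
    weight′ v = linear 0 (weight v) (count (deg A v) (f v) κ)
      where
      count : ∀ d f κ → 2 * (4 + κ) * f + 8 + (2 * d + 4 * (4 + κ)) + 0 ≡ 2 * d + 3 * (4 + κ) + ((4 + κ) * (2 * f + 1) + 8)
      count = solve-∀
    even-≤ : ∀ {d} k → odd d ≡ false → d ≤ 2 * k + 1 → d ≤ 2 * k
    even-≤ {d} k ev le with m≤n⇒m<n∨m≡n le
    ... | inj₁ lt = s≤s⁻¹ (≤-trans lt (≤-reflexive (+-comm (2 * k) 1)))
    ... | inj₂ refl = ⊥-elim (true≢false (trans (odd-+ (2 * k) 1) (cong (_xor true) (trans (odd-* 2 k) refl))) ev)

-- The doubled graph and the cases k = 1, 2, 3.

double : Graph → Graph
double G = record { n = n G ; m = m G + m G ; ends = ends G ∘ fold ; loopless = loopless G ∘ fold }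
  where
  fold : Fin (m G + m G) → Fin (m G)
  fold e = [ id , id ]′ (splitAt (m G) e)

module Doubling (G : Graph) where
  open Multigraph (src G) (tgt G)
  module D = Multigraph (src (double G)) (tgt (double G))

  both : Mask (m G) → Mask (m G) → Fin (m G + m G) → Bool
  both A B e = [ A , B ]′ (splitAt (m G) e)

  sum-both : ∀ A B (w : Fin (m G) → ℕ) (w′ : Fin (m G + m G) → ℕ) →
             (∀ e → w′ e ≡ [ w , w ]′ (splitAt (m G) e)) →
             sum (λ e → 𝟙 (both A B e) * w′ e) ≡ sum (λ e → 𝟙 (A e) * w e) + sum (λ e → 𝟙 (B e) * w e)
  sum-both A B w w′ same = trans (sum-split (m G) (λ e → 𝟙 (both A B e) * w′ e)) (cong₂ _+_
    (sum-cong-≗ (λ i → cong₂ (λ p k → 𝟙 p * k) (cong [ A , B ]′ (splitAt-↑ˡ (m G) i (m G)))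
      (trans (same (i ↑ˡ m G)) (cong [ w , w ]′ (splitAt-↑ˡ (m G) i (m G))))))
    (sum-cong-≗ (λ i → cong₂ (λ p k → 𝟙 p * k) (cong [ A , B ]′ (splitAt-↑ʳ (m G) (m G) i))
      (trans (same (m G ↑ʳ i)) (cong [ w , w ]′ (splitAt-↑ʳ (m G) (m G) i))))))

  deg-both : ∀ A B v → D.deg (both A B) v ≡ deg A v + deg B v
  deg-both A B v = sum-both A B (λ e → inc e v) (λ e → D.inc e v) same
    where
    same : ∀ e → D.inc e v ≡ [ (λ e → inc e v) , (λ e → inc e v) ]′ (splitAt (m G) e)
    same e with splitAt (m G) e
    ... | inj₁ _ = refl
    ... | inj₂ _ = refl

  cut-both : ∀ A B Y → D.cut (both A B) Y ≡ cut A Y + cut B Y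
  cut-both A B Y = trans (sum-cong-≗ (λ e → 𝟙-∧ (both A B e) (D.crosses Y e)))
    (trans (sum-both A B (𝟙 ∘ crosses Y) (𝟙 ∘ D.crosses Y) same)
           (sym (cong₂ _+_ (sum-cong-≗ (λ e → 𝟙-∧ (A e) (crosses Y e))) (sum-cong-≗ (λ e → 𝟙-∧ (B e) (crosses Y e))))))
    where
    same : ∀ e → 𝟙 (D.crosses Y e) ≡ [ 𝟙 ∘ crosses Y , 𝟙 ∘ crosses Y ]′ (splitAt (m G) e)
    same e with splitAt (m G) e
    ... | inj₁ _ = refl
    ... | inj₂ _ = refl

  project : ∀ {u w} → Walk (double G) u w → Walk G u w
  project nil          = nil
  project (cons e j W) = cons _ j (project W)

  verts-project : ∀ {u w} (W : Walk (double G) u w) → verts (project W) ≡ verts W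
  verts-project nil                  = refl
  verts-project {u = u} (cons e j W) = cong (u ∷_) (verts-project W)

  passes-project : ∀ {s} (W : Walk (double G) s s) → passes (project W) ≡ passes W
  passes-project nil          = refl
  passes-project (cons e j W) = verts-project (cons e j W)

  closed-walk : 1 < n G → ∀ f → ¬ ¬ (∃ λ M → Good (double G) f M) →
    Σ (Fin (n G)) λ s → Σ (Walk G s s) λ W → Spanning W × (∀ v → times W v ≤ f v)
  closed-walk 1<n f ¬¬M = map-walk (closed-trail (double G) 1<n f ¬¬M)
    where
    map-walk : (Σ (Fin (n G)) λ s → Σ (Walk (double G) s s) λ W → IsTrail W × Spanning W × (∀ v → times W v ≤ f v)) →
               Σ (Fin (n G)) λ s → Σ (Walk G s s) λ W → Spanning W × (∀ v → times W v ≤ f v)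
    map-walk (s , W , _ , spanning , bound) = s , project W ,
        (λ v → subst (v ∈_) (sym (passes-project W)) (spanning v)) ,
        (λ v → ≤-trans (≤-reflexive (cong (λ vs → length (filter (_≟ v) vs)) (passes-project W))) (bound v))

  good-1 : ∀ f → EdgeConnected 1 G → (∀ v → deg full v ≤ f v) → ∃ λ M → Good (double G) f M
  good-1 f ec bound = both full full ,
    record { even = λ v → trans (cong odd (deg-both full full v)) (odd-double (deg full v)) ; connects = connects } ,
    λ v → ≤-trans (≤-reflexive (deg-both full full v))
        (≤-trans (+-mono-≤ (bound v) (≤-trans (bound v) (≤-reflexive (sym (+-identityʳ (f v)))))) ≤-refl)
    where
    connects : D.Connects (both full full) full
    connects Y {x} {y} _ yx _ yy with size-inhabited (both full full ∩ D.crosses Y)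
      (≤-trans (edge-cuts G ec Y yx yy) (≤-trans (m≤m+n _ _) (≤-reflexive (sym (cut-both full full Y)))))
    ... | e , p = e , proj₁ (∧-split {both full full e} p) , refl , proj₂ (∧-split {both full full e} p)

  -- Cuts of 4 edges correspond to κ = 0. For the degrees 2d of the doubled graph the condition is
  -- 4d + 12 ≤ 8f + 8, four times the hypothesis.
  good-2 : ∀ f → EdgeConnected 2 G → (∀ v → deg full v + 1 ≤ 2 * f v) → ¬ ¬ (∃ λ M → Good (double G) f M)
  good-2 f ec@(1<n , _) bound = good-subgraph (double G) 0 (both full full) f 1<n
    (λ Y yx yy → ≤-trans (+-mono-≤ (edge-cuts G ec Y yx yy) (edge-cuts G ec Y yx yy)) (≤-reflexive (sym (cut-both full full Y))))
    (λ v → ≤-trans (≤-reflexive (cong (λ d → 2 * d + 12) (deg-both full full v)))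
             (linear 0 (*-monoʳ-≤ 4 (bound v)) (count (deg full v) (f v))))
    where
    count : ∀ d f → 4 * (2 * f) + (2 * (d + d) + 12) + 0 ≡ 4 * (d + 1) + (8 * f + 8)
    count = solve-∀

  -- k = 3: an edge set D with deg D ≡ deg (mod 2) meets every cut of size 3, so doubling D makes all cuts at least 4.
  good-3 : ∀ f → EdgeConnected 3 G → (∀ v → deg full v + 2 ≤ 3 * f v) → ¬ ¬ (∃ λ M → Good (double G) f M)
  good-3 f ec@(1<n , _) bound = do
    (D , bounded , parity) ← parity-subgraph (src G) (tgt G) (loopless G) g (edge-cuts G ec) g-odd g-cap
    good-subgraph (double G) 0 (both full D) f 1<n (cuts D parity) (weight D bounded)
    where
    room : ∀ v → deg full v + 2 ≤ 4 * f v
    room v = ≤-trans (bound v) (*-monoˡ-≤ (f v) (n≤1+n 3))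
    g : Fin (n G) → ℕ
    g v = 4 * f v ∸ (deg full v + 2)
    g-spec : ∀ v → g v + (deg full v + 2) ≡ 4 * f v
    g-spec v = m∸n+n≡m (room v)
    g-odd : ∀ v → odd (g v) ≡ odd (deg full v)
    g-odd v = xor-false⇒≡ (odd (g v)) (odd (deg full v)) (begin
      odd (g v) xor odd (deg full v) ≡⟨ cong (odd (g v) xor_) (trans (odd-+ (deg full v) 2) (xor-identityʳ _)) ⟨
      odd (g v) xor odd (deg full v + 2) ≡⟨ odd-+ (g v) _ ⟨
      odd (g v + (deg full v + 2)) ≡⟨ cong odd (g-spec v) ⟩
      odd (4 * f v) ≡⟨ odd-* 4 (f v) ⟩
      false ∎)
      where
      open ≡-Reasoning
      xor-false⇒≡ : ∀ p q → p xor q ≡ false → p ≡ q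
      xor-false⇒≡ true  true  _ = refl
      xor-false⇒≡ false false _ = refl
    -- Since 3g = 12f - 3d - 6 and 12f ≥ 4d + 8, the inequality holds with a margin of 2.
    g-cap : ∀ v → deg full v ≤ 3 * g v
    g-cap v = linear 2 (+-mono-≤ (≤-reflexive (cong (3 *_) (sym (g-spec v)))) (*-monoʳ-≤ 4 (bound v)))
        (count (deg full v) (f v) (g v))
      where
      count : ∀ d f g → 3 * (g + (d + 2)) + 4 * (3 * f) + d + 2 ≡ 3 * (4 * f) + 4 * (d + 2) + 3 * g
      count = solve-∀
    cuts : ∀ D → (∀ v → odd (deg D v) ≡ odd (g v)) → D.MinCut 4 (both full D)
    cuts D parity Y yx yy = ≤-trans (four (cut full Y) (cut D Y) (edge-cuts G ec Y yx yy) same)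
        (≤-reflexive (sym (cut-both full D Y)))
      where
      same : odd (cut full Y) ≡ odd (cut D Y)
      same = trans (odd-cut full Y) (trans (sum-odd-cong (λ v → trans (odd-* (𝟙 (Y v)) (deg full v))
               (trans (cong (odd (𝟙 (Y v)) ∧_) (sym (trans (parity v) (g-odd v))))
                   (sym (odd-* (𝟙 (Y v)) (deg D v)))))) (sym (odd-cut D Y)))
      four : ∀ c d → 3 ≤ c → odd c ≡ odd d → 4 ≤ c + d
      four c d le eq with m≤n⇒m<n∨m≡n le
      ... | inj₁ lt = ≤-trans lt (m≤m+n c d)
      four c zero    le () | inj₂ refl
      four c (suc d) le eq | inj₂ refl = s≤s (s≤s (s≤s (s≤s z≤n)))
    weight : ∀ D → (∀ v → deg D v ≤ g v) → ∀ v → 2 * D.deg (both full D) v + 12 ≤ 8 * f v + 8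
    weight D bounded v = begin
      2 * D.deg (both full D) v + 12 ≡⟨ cong (λ d → 2 * d + 12) (deg-both full D v) ⟩
      2 * (deg full v + deg D v) + 12 ≤⟨ +-monoˡ-≤ 12 (*-monoʳ-≤ 2 (+-monoʳ-≤ (deg full v) (bounded v))) ⟩
      2 * (deg full v + g v) + 12 ≡⟨ regroup (deg full v) (g v) ⟩
      2 * (g v + (deg full v + 2)) + 8 ≡⟨ cong (λ k → 2 * k + 8) (g-spec v) ⟩
      2 * (4 * f v) + 8 ≡⟨ cong (_+ 8) (sym (*-assoc 2 4 (f v))) ⟩
      8 * f v + 8 ∎
      where
      open ≤-Reasoning
      regroup : ∀ d g → 2 * (d + g) + 12 ≡ 2 * (g + (d + 2)) + 8
      regroup = solve-∀

-- From the ceilings to linear degree bounds, and the two parts of the theorem.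

f₁-bound : ∀ k .{{_ : NonZero k}} d → 4 ≤ k → ∃ λ f → + f ≤ℤ f₁ k d × 2 * d + 3 * k ≤ 2 * k * f + 8
f₁-bound k d 4≤k with ceiling-cases (2 * d + k) 8 (2 * k) {{m*n≢0 2 k}}
-- A negative ceiling would give 2d + 3k ≤ 8, against 3k ≥ 12.
... | inj₂ le = ⊥-elim (<⇒≱ (m<m+n 8 (s≤s (z≤n {3})))
    (≤-trans (*-monoʳ-≤ 3 4≤k) (≤-trans (≤-trans (m≤n+m (3 * k) (2 * d)) (≤-reflexive (count d k))) le)))
  where
  count : ∀ d k → 2 * d + 3 * k ≡ 2 * d + k + 2 * k
  count = solve-∀
... | inj₁ (q , eq , le) = q + 1 , ℤ.≤-reflexive (cong (λ k → k ℤ.+ + 1) (sym eq)) , linear 0 le (count d k q)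
  where
  count : ∀ d k q → q * (2 * k) + 8 + (2 * d + 3 * k) + 0 ≡ 2 * d + k + (2 * k * (q + 1) + 8)
  count = solve-∀

f₂-bound : ∀ k .{{_ : NonZero k}} d → k ≤ d → ∃ λ f → + f ≤ℤ f₂ k d × d + k ≤ k * f + 1
f₂-bound k d k≤d with ceiling-cases d 1 k
... | inj₂ le = ⊥-elim (<⇒≱ (s≤s (s≤s z≤n)) (≤-trans (+-mono-≤ (≤-trans (>-nonZero⁻¹ k) k≤d) (>-nonZero⁻¹ k)) le))
... | inj₁ (q , eq , le) = q + 1 , ℤ.≤-reflexive (cong (λ k → k ℤ.+ + 1) (sym eq)) , linear 0 le (count d k q)
  where
  count : ∀ d k q → q * k + 1 + (d + k) + 0 ≡ d + (k * (q + 1) + 1)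
  count = solve-∀

theorem7p8 : (k : ℕ) → .{{_ : NonZero k}} → (G : Graph) → EdgeConnected k G →
    (4 ≤ k → Σ (Fin (n G)) (λ s → Σ (Walk G s s) (λ W →
    IsTrail W × Spanning W × (∀ v → + times W v ≤ℤ f₁ k (degree G v)))))
    × (k ≤ 3 → Σ (Fin (n G)) (λ s → Σ (Walk G s s) (λ W →
    Spanning W × (∀ v → + times W v ≤ℤ f₂ k (degree G v)))))
theorem7p8 k G ec@(1<n , _) = part₁ , part₂
  where
  open Multigraph (src G) (tgt G)
  open Doubling G using (closed-walk; good-1; good-2; good-3)

  part₁ : 4 ≤ k → Σ (Fin (n G)) (λ s → Σ (Walk G s s) (λ W → IsTrail W × Spanning W × (∀ v → + times W v ≤ℤ f₁ k (degree G v))))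
  part₁ 4≤k = weaken (closed-trail G 1<n f (good 4≤k))
    where
    f : Fin (n G) → ℕ
    f v = proj₁ (f₁-bound k (degree G v) 4≤k)
    weaken : (Σ (Fin (n G)) λ s → Σ (Walk G s s) λ W → IsTrail W × Spanning W × (∀ v → times W v ≤ f v)) →
             Σ (Fin (n G)) λ s → Σ (Walk G s s) λ W → IsTrail W × Spanning W × (∀ v → + times W v ≤ℤ f₁ k (degree G v))
    weaken (s , W , trail , spanning , bound) = s , W , trail , spanning ,
      λ v → ℤ.≤-trans (ℤ.+≤+ (bound v)) (proj₁ (proj₂ (f₁-bound k (degree G v) 4≤k)))
    good : 4 ≤ k → ¬ ¬ (∃ λ M → Good G f M)
    good le with m≤n⇒∃[o]m+o≡n le
    ... | κ , refl = good-subgraph G κ full f 1<n (edge-cuts G ec)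
      (λ v → subst (λ d → 2 * d + 3 * (4 + κ) ≤ 2 * (4 + κ) * f v + 8) (degree≡deg G v)
          (proj₂ (proj₂ (f₁-bound k (degree G v) 4≤k))))

  -- Edge connectivity gives every vertex degree at least k, which rules out a negative ceiling, so
  -- the bound can be taken in the natural numbers.
  f : Fin (n G) → ℕ
  f v = proj₁ (f₂-bound k (degree G v) (subst (k ≤_) (sym (degree≡deg G v)) (min-degree G ec v)))

  f≤f₂ : ∀ v → + f v ≤ℤ f₂ k (degree G v)
  f≤f₂ v = proj₁ (proj₂ (f₂-bound k (degree G v) (subst (k ≤_) (sym (degree≡deg G v)) (min-degree G ec v))))

  f-bound : ∀ v → deg full v + k ≤ k * f v + 1
  f-bound v = subst (λ d → d + k ≤ k * f v + 1) (degree≡deg G v)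
    (proj₂ (proj₂ (f₂-bound k (degree G v) (subst (k ≤_) (sym (degree≡deg G v)) (min-degree G ec v)))))

  good : ∀ j → k ≡ suc j → j ≤ 2 → ¬ ¬ (∃ λ M → Good (double G) f M)
  good 0 refl _ = return (good-1 f ec (λ v → linear 0 (f-bound v) (count (deg full v) (f v))))
    where
    count : ∀ d f → 1 * f + 1 + d + 0 ≡ d + 1 + f
    count = solve-∀
  good 1 refl _ = good-2 f ec (λ v → linear 0 (f-bound v) (count (deg full v) (f v)))
    where
    count : ∀ d f → 2 * f + 1 + (d + 1) + 0 ≡ d + 2 + 2 * f
    count = solve-∀
  good 2 refl _ = good-3 f ec (λ v → linear 0 (f-bound v) (count (deg full v) (f v)))
    where
    count : ∀ d f → 3 * f + 1 + (d + 2) + 0 ≡ d + 3 + 3 * f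
    count = solve-∀
  good (suc (suc (suc _))) _ (s≤s (s≤s ()))

  part₂ : k ≤ 3 → Σ (Fin (n G)) (λ s → Σ (Walk G s s) (λ W → Spanning W × (∀ v → + times W v ≤ℤ f₂ k (degree G v))))
  part₂ k≤3 = weaken (closed-walk 1<n f (good (pred k) (sym (suc-pred k)) (pred-mono-≤ k≤3)))
    where
    weaken : (Σ (Fin (n G)) λ s → Σ (Walk G s s) λ W → Spanning W × (∀ v → times W v ≤ f v)) →
             Σ (Fin (n G)) λ s → Σ (Walk G s s) λ W → Spanning W × (∀ v → + times W v ≤ℤ f₂ k (degree G v))
    weaken (s , W , spanning , bound) = s , W , spanning , λ v → ℤ.≤-trans (ℤ.+≤+ (bound v)) (f≤f₂ v)
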